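{- Let $a,b,m,n\geqslant 1$ be integers. Then $$\frac{1-q^{\gcd(am,m+n)}}{1-q^{m+n}}{am+bm-1\brack am}_q{an+bn\brack an}_q$$ is a polynomial in $q$ with non-negative integer coefficients.
   Context: The $q$-binomial coefficients are defined by ${n\brack k}_q=\dfrac{(1-q^n)(1-q^{n-1})\cdots(1-q^{n-k+1})}{(1-q)(1-q^2)\cdots(1-q^k)}$ if $0\leqslant k\leqslant n$, and ${n\brack k}_q=0$ otherwise. Here $q$ is an indeterminate and $\gcd$ denotes the greatest common divisor. -}

module Defs where

open import Data.Nat as ℕ using (ℕ; zero; suc)
open import Data.Bool using (if_then_else_)
open import Data.Integer as ℤ using (ℤ; 0ℤ; 1ℤ; -1ℤ)
import Data.Integer.Properties as ℤₚ
open import Data.List using (List; []; _∷_; map; replicate; _++_)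
open import Data.Product using (∃-syntax; _×_)
open import Data.Sum using (_⊎_; inj₁; inj₂; [_,_]′)
open import Relation.Nullary using (¬_)
open import Relation.Binary.PropositionalEquality
  using (_≡_; refl; sym; trans; cong)

-- ℤ[q]: a₀ ∷ a₁ ∷ … stands for a₀ + a₁ q + …; trailing zeros are allowed, so
-- equality of polynomials is _≈_ rather than _≡_.
Poly : Set
Poly = List ℤ

coeff : Poly → ℕ → ℤ
coeff []      _       = 0ℤ
coeff (a ∷ p) zero    = a
coeff (a ∷ p) (suc i) = coeff p i

infix 4 _≈_
_≈_ : Poly → Poly → Set
p ≈ r = ∀ i → coeff p i ≡ coeff r i

infixl 6 _+ᴾ_
infixl 7 _*ᴾ_ _·_

_+ᴾ_ : Poly → Poly → Poly
[]      +ᴾ r       = r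
(a ∷ p) +ᴾ []      = a ∷ p
(a ∷ p) +ᴾ (b ∷ r) = (a ℤ.+ b) ∷ (p +ᴾ r)

_·_ : ℤ → Poly → Poly
a · p = map (a ℤ.*_) p

_*ᴾ_ : Poly → Poly → Poly
[]      *ᴾ r = []
(a ∷ p) *ᴾ r = a · r +ᴾ (0ℤ ∷ p *ᴾ r)

0ᴾ 1ᴾ : Poly
0ᴾ = []
1ᴾ = 1ℤ ∷ []

q^_ : ℕ → Poly
q^ k = replicate k 0ℤ ++ 1ᴾ

1-q^_ : ℕ → Poly
1-q^ k = 1ᴾ +ᴾ -1ℤ · (q^ k)

-- ∏ k f = f 0 * f 1 * … * f (k - 1)
∏ : ℕ → (ℕ → Poly) → Poly
∏ zero    f = 1ᴾ
∏ (suc k) f = ∏ k f *ᴾ f k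

coeff-+ : ∀ p r i → coeff (p +ᴾ r) i ≡ coeff p i ℤ.+ coeff r i
coeff-+ []      r       i       = sym (ℤₚ.+-identityˡ _)
coeff-+ (a ∷ p) []      i       = sym (ℤₚ.+-identityʳ _)
coeff-+ (a ∷ p) (b ∷ r) zero    = refl
coeff-+ (a ∷ p) (b ∷ r) (suc i) = coeff-+ p r i

coeff-· : ∀ a p i → coeff (a · p) i ≡ a ℤ.* coeff p i
coeff-· a []      i       = sym (ℤₚ.*-zeroʳ a)
coeff-· a (b ∷ p) zero    = refl
coeff-· a (b ∷ p) (suc i) = coeff-· a p i

*ᴾ-shift₀ : ∀ p r → coeff (p *ᴾ (0ℤ ∷ r)) 0 ≡ 0ℤ
*ᴾ-shift₀ []      r = refl
*ᴾ-shift₀ (a ∷ p) r = trans (ℤₚ.+-identityʳ _) (ℤₚ.*-zeroʳ a)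

*ᴾ-shift : ∀ p r i → coeff (p *ᴾ (0ℤ ∷ r)) (suc i) ≡ coeff (p *ᴾ r) i
*ᴾ-shift []      r i = refl
*ᴾ-shift (a ∷ p) r i =
  trans (coeff-+ (a · r) (p *ᴾ (0ℤ ∷ r)) i)
        (trans (cong (λ c → coeff (a · r) i ℤ.+ c) (tail i))
               (sym (coeff-+ (a · r) (0ℤ ∷ p *ᴾ r) i)))
  where
  tail : ∀ i → coeff (p *ᴾ (0ℤ ∷ r)) i ≡ coeff (0ℤ ∷ p *ᴾ r) i
  tail zero    = *ᴾ-shift₀ p r
  tail (suc i) = *ᴾ-shift p r i

≈0-∷ : ∀ {a p} → a ≡ 0ℤ → p ≈ 0ᴾ → a ∷ p ≈ 0ᴾ
≈0-∷ e h zero    = e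
≈0-∷ e h (suc i) = h i

*ᴾ-tailˡ : ∀ {a} p r → a ≡ 0ℤ → (a ∷ p) *ᴾ r ≈ 0ᴾ → p *ᴾ r ≈ 0ᴾ
*ᴾ-tailˡ p r refl h i = trans (sym eq) (h (suc i))
  where
  eq : coeff ((0ℤ ∷ p) *ᴾ r) (suc i) ≡ coeff (p *ᴾ r) i
  eq = trans (coeff-+ (0ℤ · r) (0ℤ ∷ p *ᴾ r) (suc i))
             (trans (cong (λ c → c ℤ.+ coeff (p *ᴾ r) i) (coeff-· 0ℤ r (suc i)))
                    (ℤₚ.+-identityˡ _))

*ᴾ-tailʳ : ∀ {b} p r → b ≡ 0ℤ → p *ᴾ (b ∷ r) ≈ 0ᴾ → p *ᴾ r ≈ 0ᴾ
*ᴾ-tailʳ p r refl h i = trans (sym (*ᴾ-shift p r i)) (h (suc i))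

*ᴾ-noZeroDivisors : ∀ p r → p *ᴾ r ≈ 0ᴾ → p ≈ 0ᴾ ⊎ r ≈ 0ᴾ
*ᴾ-noZeroDivisors []      r       h = inj₁ λ _ → refl
*ᴾ-noZeroDivisors (a ∷ p) []      h = inj₂ λ _ → refl
*ᴾ-noZeroDivisors (a ∷ p) (b ∷ r) h =
  [ (λ a≡0 → [ (λ p≈0 → inj₁ (≈0-∷ a≡0 p≈0)) , inj₂ ]′
               (*ᴾ-noZeroDivisors p (b ∷ r) (*ᴾ-tailˡ p (b ∷ r) a≡0 h)))
  , (λ b≡0 → [ inj₁ , (λ r≈0 → inj₂ (≈0-∷ b≡0 r≈0)) ]′
               (*ᴾ-noZeroDivisors (a ∷ p) r (*ᴾ-tailʳ (a ∷ p) r b≡0 h)))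
  ]′ (ℤₚ.i*j≡0⇒i≡0∨j≡0 a (trans (sym (ℤₚ.+-identityʳ (a ℤ.* b))) (h 0)))

*ᴾ-nonzero : ∀ {p r} → ¬ (p ≈ 0ᴾ) → ¬ (r ≈ 0ᴾ) → ¬ (p *ᴾ r ≈ 0ᴾ)
*ᴾ-nonzero {p} {r} p≉0 r≉0 h = [ p≉0 , r≉0 ]′ (*ᴾ-noZeroDivisors p r h)

1ᴾ-nonzero : ¬ (1ᴾ ≈ 0ᴾ)
1ᴾ-nonzero h with () ← h 0

1-q^-nonzero : ∀ {k} → 1 ℕ.≤ k → ¬ (1-q^ k ≈ 0ᴾ)
1-q^-nonzero {suc k} _ h with () ← h 0

∏-nonzero : ∀ k {f} → (∀ i → ¬ (f i ≈ 0ᴾ)) → ¬ (∏ k f ≈ 0ᴾ)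
∏-nonzero zero    f≉0 = 1ᴾ-nonzero
∏-nonzero (suc k) f≉0 = *ᴾ-nonzero {∏ k _} (∏-nonzero k f≉0) (f≉0 k)

-- Elements of the fraction field ℚ(q) of ℤ[q], as unreduced fractions; equality is _≃_.
record RatFun : Set where
  constructor mkRatFun
  field
    num   : Poly
    den   : Poly
    den≉0 : ¬ (den ≈ 0ᴾ)

open RatFun public

infix 4 _≃_
_≃_ : RatFun → RatFun → Set
f ≃ g = num f *ᴾ den g ≈ num g *ᴾ den f

infixl 7 _*ᴿ_
_*ᴿ_ : RatFun → RatFun → RatFun
mkRatFun p d d≉0 *ᴿ mkRatFun r e e≉0 =
  mkRatFun (p *ᴾ r) (d *ᴾ e) (*ᴾ-nonzero {d} d≉0 e≉0)

fromPoly : Poly → RatFun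
fromPoly p = mkRatFun p 1ᴾ 1ᴾ-nonzero

qBinomial : ℕ → ℕ → RatFun
qBinomial n k =
  if k ℕ.≤ᵇ n
  then mkRatFun (∏ k λ i → 1-q^ (n ℕ.∸ i))
                (∏ k λ i → 1-q^ (suc i))
                (∏-nonzero k λ i → 1-q^-nonzero (ℕ.s≤s ℕ.z≤n))
  else fromPoly 0ᴾ

IsNonNegPolynomial : RatFun → Set
IsNonNegPolynomial f = ∃[ p ] (∀ i → 0ℤ ℤ.≤ coeff p i) × f ≃ fromPoly p

{-# OPTIONS --safe #-}
-- Write u k = 1 - q^k, N = m + n and g = gcd(am, N), and let P be the product of the two Gaussian
-- polynomials.
--
-- Divisibility of u g · P by u N. Every u k is the product of cyclotomic factors Φ d over d ∣ k, so
-- [k]! contains Φ d with exponent ⌊k / d⌋ and it suffices to compare exponents. The Φ d are obtained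
-- inductively: those with d ∣ k and d < k divide u k and are pairwise coprime over ℚ, and their
-- constant coefficients are units, which takes the divisibility of u k by their product back to ℤ.
--
-- Non-negativity. P is the graded dimension of a tensor product of two exterior powers of irreducible
-- representations of sl₂. Raising is injective below the middle degree and lowering above it, because
-- ‖lower f‖² - ‖raise f‖² is the weight of f times ‖f‖²; hence P is unimodal about its middle degree.
-- The coefficients of X = u g · P / u N then follow from X = q^N X + u g · P, read upwards from
-- degree 0 below the middle and downwards from the top degree above it.
module Submission where

-- With x = am, y = bm - 1, z = an, w = bn one has x + z = aN and y + w + 1 = bN. For each divisor d
-- of N the floors have to supply one extra factor Φ d, or u g has to. The divisors of N that divide
-- am are exactly those of g; if d divides N but not am, the two sums above leave remainders that
-- force the extra unit.
--
-- Non-negativity cannot be read off exponents, and u g · P itself has negative coefficients. What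
-- is needed is monotonicity of P on both sides of its middle, but a product of unimodal polynomials
-- need not be unimodal. Passing to a tensor product of representations avoids this: ranks and
-- degrees add, and the weight argument applies to the whole product at once.
--
-- All of this linear algebra takes place over ℤ. The inner product is diagonal with positive
-- integer weights, and injectivity becomes an inequality of dimensions through elimination without
-- division: a homogeneous integral system with fewer equations than unknowns has a non-zero
-- integral solution.

open import Defs

-- The commutative ring ℤ[q]

module PolynomialRing where
  open import Algebra.Bundles using (CommutativeRing)
  open import Data.Integer as ℤ using (ℤ; +_; 0ℤ; 1ℤ; -1ℤ)
  import Data.Integer.Properties as ℤₚ
  open import Data.List using ([]; _∷_)
  open import Data.Maybe using (Maybe; just; nothing)
  open import Data.Nat using (zero; suc)
  open import Data.Product using (_,_)
  open import Level using (0ℓ)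
  open import Relation.Binary.Bundles using (Setoid)
  open import Relation.Binary.PropositionalEquality using (_≡_; refl; sym; trans; cong; cong₂)
  open import Tactic.RingSolver.Core.AlmostCommutativeRing
    using (AlmostCommutativeRing; fromCommutativeRing)

  -- _≈_ unfolds to a family of equations from which its two sides cannot be
  -- inferred; wrapping it in a record makes implicit arguments solvable.
  infix 4 _≋_
  record _≋_ (p r : Poly) : Set where
    constructor mk≋
    field at : p ≈ r
  open _≋_

  private variable
    p p′ r r′ s : Poly

  ≋-refl : p ≋ p
  ≋-refl = mk≋ λ _ → refl

  ≋-sym : p ≋ r → r ≋ p
  ≋-sym e = mk≋ λ i → sym (at e i)

  ≋-trans : p ≋ r → r ≋ s → p ≋ s
  ≋-trans e e′ = mk≋ λ i → trans (at e i) (at e′ i)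

  ∷-cong : ∀ {a b} → a ≡ b → p ≋ r → a ∷ p ≋ b ∷ r
  ∷-cong e h = mk≋ λ { zero → e ; (suc i) → at h i }

  +-cong : p ≋ p′ → r ≋ r′ → p +ᴾ r ≋ p′ +ᴾ r′
  +-cong {p} {p′} {r} {r′} e h = mk≋ λ i →
    trans (coeff-+ p r i)
          (trans (cong₂ ℤ._+_ (at e i) (at h i)) (sym (coeff-+ p′ r′ i)))

  ·-congʳ : ∀ a → p ≋ r → a · p ≋ a · r
  ·-congʳ {p} {r} a e = mk≋ λ i →
    trans (coeff-· a p i) (trans (cong (a ℤ.*_) (at e i)) (sym (coeff-· a r i)))

  +-assoc : ∀ p r s → (p +ᴾ r) +ᴾ s ≋ p +ᴾ (r +ᴾ s)
  +-assoc p r s = mk≋ λ i → begin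
    coeff (p +ᴾ r +ᴾ s) i                     ≡⟨ coeff-+ (p +ᴾ r) s i ⟩
    coeff (p +ᴾ r) i ℤ.+ coeff s i            ≡⟨ cong (ℤ._+ _) (coeff-+ p r i) ⟩
    coeff p i ℤ.+ coeff r i ℤ.+ coeff s i     ≡⟨ ℤₚ.+-assoc (coeff p i) _ _ ⟩
    coeff p i ℤ.+ (coeff r i ℤ.+ coeff s i)   ≡⟨ cong (λ c → coeff p i ℤ.+ c) (coeff-+ r s i) ⟨
    coeff p i ℤ.+ coeff (r +ᴾ s) i            ≡⟨ coeff-+ p (r +ᴾ s) i ⟨
    coeff (p +ᴾ (r +ᴾ s)) i                   ∎
    where open Relation.Binary.PropositionalEquality.≡-Reasoning

  +-comm : ∀ p r → p +ᴾ r ≋ r +ᴾ p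
  +-comm p r = mk≋ λ i →
    trans (coeff-+ p r i) (trans (ℤₚ.+-comm (coeff p i) _) (sym (coeff-+ r p i)))

  +-identityʳ : ∀ p → p +ᴾ 0ᴾ ≋ p
  +-identityʳ p = +-comm p 0ᴾ

  ·-distribʳ : ∀ a b p → (a ℤ.+ b) · p ≋ a · p +ᴾ b · p
  ·-distribʳ a b p = mk≋ λ i → begin
    coeff ((a ℤ.+ b) · p) i                   ≡⟨ coeff-· (a ℤ.+ b) p i ⟩
    (a ℤ.+ b) ℤ.* coeff p i                   ≡⟨ ℤₚ.*-distribʳ-+ (coeff p i) a b ⟩
    a ℤ.* coeff p i ℤ.+ b ℤ.* coeff p i       ≡⟨ cong₂ ℤ._+_ (coeff-· a p i) (coeff-· b p i) ⟨
    coeff (a · p) i ℤ.+ coeff (b · p) i       ≡⟨ coeff-+ (a · p) (b · p) i ⟨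
    coeff (a · p +ᴾ b · p) i                  ∎
    where open Relation.Binary.PropositionalEquality.≡-Reasoning

  ·-distribˡ : ∀ a p r → a · (p +ᴾ r) ≋ a · p +ᴾ a · r
  ·-distribˡ a p r = mk≋ λ i → begin
    coeff (a · (p +ᴾ r)) i                    ≡⟨ coeff-· a (p +ᴾ r) i ⟩
    a ℤ.* coeff (p +ᴾ r) i                    ≡⟨ cong (a ℤ.*_) (coeff-+ p r i) ⟩
    a ℤ.* (coeff p i ℤ.+ coeff r i)           ≡⟨ ℤₚ.*-distribˡ-+ a (coeff p i) _ ⟩
    a ℤ.* coeff p i ℤ.+ a ℤ.* coeff r i       ≡⟨ cong₂ ℤ._+_ (coeff-· a p i) (coeff-· a r i) ⟨
    coeff (a · p) i ℤ.+ coeff (a · r) i       ≡⟨ coeff-+ (a · p) (a · r) i ⟨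
    coeff (a · p +ᴾ a · r) i                  ∎
    where open Relation.Binary.PropositionalEquality.≡-Reasoning

  ·-assoc : ∀ a b p → a · (b · p) ≋ (a ℤ.* b) · p
  ·-assoc a b p = mk≋ λ i → begin
    coeff (a · (b · p)) i         ≡⟨ coeff-· a (b · p) i ⟩
    a ℤ.* coeff (b · p) i         ≡⟨ cong (a ℤ.*_) (coeff-· b p i) ⟩
    a ℤ.* (b ℤ.* coeff p i)       ≡⟨ ℤₚ.*-assoc a b _ ⟨
    a ℤ.* b ℤ.* coeff p i         ≡⟨ coeff-· (a ℤ.* b) p i ⟨
    coeff ((a ℤ.* b) · p) i       ∎
    where open Relation.Binary.PropositionalEquality.≡-Reasoning

  0·-zero : ∀ p → 0ℤ · p ≋ 0ᴾ
  0·-zero p = mk≋ λ i → coeff-· 0ℤ p i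

  1·-identity : ∀ p → 1ℤ · p ≋ p
  1·-identity p = mk≋ λ i → trans (coeff-· 1ℤ p i) (ℤₚ.*-identityˡ _)

  0∷-zero : 0ℤ ∷ 0ᴾ ≋ 0ᴾ
  0∷-zero = mk≋ λ { zero → refl ; (suc i) → refl }

  ≋-setoid : Setoid 0ℓ 0ℓ
  ≋-setoid = record
    { Carrier = Poly ; _≈_ = _≋_
    ; isEquivalence = record { refl = ≋-refl ; sym = ≋-sym ; trans = ≋-trans } }

  open import Relation.Binary.Reasoning.Setoid ≋-setoid

  +-interchange : ∀ p r s t → (p +ᴾ r) +ᴾ (s +ᴾ t) ≋ (p +ᴾ s) +ᴾ (r +ᴾ t)
  +-interchange p r s t = begin
    (p +ᴾ r) +ᴾ (s +ᴾ t)   ≈⟨ +-assoc p r _ ⟩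
    p +ᴾ (r +ᴾ (s +ᴾ t))   ≈⟨ +-cong (≋-refl {p}) (≋-trans (≋-sym (+-assoc r s t)) (≋-trans (+-cong (+-comm r s) ≋-refl) (+-assoc s r t))) ⟩
    p +ᴾ (s +ᴾ (r +ᴾ t))   ≈⟨ +-assoc p s _ ⟨
    (p +ᴾ s) +ᴾ (r +ᴾ t)   ∎

  *-congʳ : ∀ p → r ≋ r′ → p *ᴾ r ≋ p *ᴾ r′
  *-congʳ []      e = ≋-refl
  *-congʳ (a ∷ p) e = +-cong (·-congʳ a e) (∷-cong refl (*-congʳ p e))

  *-zeroʳ : ∀ p → p *ᴾ 0ᴾ ≋ 0ᴾ
  *-zeroʳ []      = ≋-refl
  *-zeroʳ (a ∷ p) = ≋-trans (∷-cong refl (*-zeroʳ p)) 0∷-zero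

  -- The mirror image of the recursion that defines `_*ᴾ_`; commutativity then follows by an
  -- induction that matches the two.
  *-∷ʳ : ∀ p b r → p *ᴾ (b ∷ r) ≋ b · p +ᴾ (0ℤ ∷ p *ᴾ r)
  *-∷ʳ []      b r = ≋-sym 0∷-zero
  *-∷ʳ (a ∷ p) b r = ∷-cong (cong (ℤ._+ 0ℤ) (ℤₚ.*-comm a b)) (begin
    a · r +ᴾ p *ᴾ (b ∷ r)                  ≈⟨ +-cong (≋-refl {a · r}) (*-∷ʳ p b r) ⟩
    a · r +ᴾ (b · p +ᴾ (0ℤ ∷ p *ᴾ r))      ≈⟨ +-assoc (a · r) (b · p) _ ⟨
    a · r +ᴾ b · p +ᴾ (0ℤ ∷ p *ᴾ r)        ≈⟨ +-cong (+-comm (a · r) (b · p)) ≋-refl ⟩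
    b · p +ᴾ a · r +ᴾ (0ℤ ∷ p *ᴾ r)        ≈⟨ +-assoc (b · p) (a · r) _ ⟩
    b · p +ᴾ (a · r +ᴾ (0ℤ ∷ p *ᴾ r))      ∎)

  *-comm : ∀ p r → p *ᴾ r ≋ r *ᴾ p
  *-comm []      r = ≋-sym (*-zeroʳ r)
  *-comm (a ∷ p) r = begin
    a · r +ᴾ (0ℤ ∷ p *ᴾ r)   ≈⟨ +-cong (≋-refl {a · r}) (∷-cong refl (*-comm p r)) ⟩
    a · r +ᴾ (0ℤ ∷ r *ᴾ p)   ≈⟨ *-∷ʳ r a p ⟨
    r *ᴾ (a ∷ p)             ∎

  *-cong : p ≋ p′ → r ≋ r′ → p *ᴾ r ≋ p′ *ᴾ r′
  *-cong {p} {p′} {r} {r′} e h = begin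
    p *ᴾ r     ≈⟨ *-congʳ p h ⟩
    p *ᴾ r′    ≈⟨ *-comm p r′ ⟩
    r′ *ᴾ p    ≈⟨ *-congʳ r′ e ⟩
    r′ *ᴾ p′   ≈⟨ *-comm r′ p′ ⟩
    p′ *ᴾ r′   ∎

  *-distribˡ : ∀ p r s → p *ᴾ (r +ᴾ s) ≋ p *ᴾ r +ᴾ p *ᴾ s
  *-distribˡ []      r s = ≋-refl
  *-distribˡ (a ∷ p) r s = begin
    a · (r +ᴾ s) +ᴾ (0ℤ ∷ p *ᴾ (r +ᴾ s))
      ≈⟨ +-cong (·-distribˡ a r s) (∷-cong refl (*-distribˡ p r s)) ⟩
    (a · r +ᴾ a · s) +ᴾ ((0ℤ ∷ p *ᴾ r) +ᴾ (0ℤ ∷ p *ᴾ s))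
      ≈⟨ +-interchange (a · r) (a · s) _ _ ⟩
    (a ∷ p) *ᴾ r +ᴾ (a ∷ p) *ᴾ s ∎

  *-distribʳ : ∀ p r s → (r +ᴾ s) *ᴾ p ≋ r *ᴾ p +ᴾ s *ᴾ p
  *-distribʳ p r s = begin
    (r +ᴾ s) *ᴾ p      ≈⟨ *-comm (r +ᴾ s) p ⟩
    p *ᴾ (r +ᴾ s)      ≈⟨ *-distribˡ p r s ⟩
    p *ᴾ r +ᴾ p *ᴾ s   ≈⟨ +-cong (*-comm p r) (*-comm p s) ⟩
    r *ᴾ p +ᴾ s *ᴾ p   ∎

  ·-*-assoc : ∀ a p r → (a · p) *ᴾ r ≋ a · (p *ᴾ r)
  ·-*-assoc a []      r = ≋-refl
  ·-*-assoc a (b ∷ p) r = begin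
    (a ℤ.* b) · r +ᴾ (0ℤ ∷ (a · p) *ᴾ r)
      ≈⟨ +-cong (≋-sym (·-assoc a b r)) (∷-cong (sym (ℤₚ.*-zeroʳ a)) (·-*-assoc a p r)) ⟩
    a · (b · r) +ᴾ a · (0ℤ ∷ p *ᴾ r)
      ≈⟨ ·-distribˡ a (b · r) _ ⟨
    a · ((b ∷ p) *ᴾ r) ∎

  0∷-* : ∀ p r → (0ℤ ∷ p) *ᴾ r ≋ 0ℤ ∷ p *ᴾ r
  0∷-* p r = +-cong (0·-zero r) ≋-refl

  *-assoc : ∀ p r s → (p *ᴾ r) *ᴾ s ≋ p *ᴾ (r *ᴾ s)
  *-assoc []      r s = ≋-refl
  *-assoc (a ∷ p) r s = begin
    (a · r +ᴾ (0ℤ ∷ p *ᴾ r)) *ᴾ s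
      ≈⟨ *-distribʳ s (a · r) _ ⟩
    (a · r) *ᴾ s +ᴾ (0ℤ ∷ p *ᴾ r) *ᴾ s
      ≈⟨ +-cong (·-*-assoc a r s) (≋-trans (0∷-* (p *ᴾ r) s) (∷-cong refl (*-assoc p r s))) ⟩
    a · (r *ᴾ s) +ᴾ (0ℤ ∷ p *ᴾ (r *ᴾ s)) ∎

  const-* : ∀ a p → (a ∷ []) *ᴾ p ≋ a · p
  const-* a p = ≋-trans (+-cong (≋-refl {a · p}) 0∷-zero) (+-identityʳ _)

  *-identityˡ : ∀ p → 1ᴾ *ᴾ p ≋ p
  *-identityˡ p = ≋-trans (const-* 1ℤ p) (1·-identity p)

  *-identityʳ : ∀ p → p *ᴾ 1ᴾ ≋ p
  *-identityʳ p = ≋-trans (*-comm p 1ᴾ) (*-identityˡ p)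

  -ᴾ_ : Poly → Poly
  -ᴾ p = -1ℤ · p

  -‿inverseˡ : ∀ p → (-ᴾ p) +ᴾ p ≋ 0ᴾ
  -‿inverseˡ p = begin
    -1ℤ · p +ᴾ p         ≈⟨ +-cong (≋-refl { -ᴾ p}) (1·-identity p) ⟨
    -1ℤ · p +ᴾ 1ℤ · p    ≈⟨ ·-distribʳ -1ℤ 1ℤ p ⟨
    0ℤ · p               ≈⟨ 0·-zero p ⟩
    0ᴾ                   ∎

  polyRing : CommutativeRing 0ℓ 0ℓ
  polyRing = record
    { Carrier = Poly ; _≈_ = _≋_ ; _+_ = _+ᴾ_ ; _*_ = _*ᴾ_ ; -_ = -ᴾ_ ; 0# = 0ᴾ ; 1# = 1ᴾ
    ; isCommutativeRing = record
      { *-comm = *-comm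
      ; isRing = record
        { *-cong = *-cong
        ; *-assoc = *-assoc
        ; *-identity = *-identityˡ , *-identityʳ
        ; distrib = *-distribˡ , *-distribʳ
        ; +-isAbelianGroup = record
          { comm = +-comm
          ; isGroup = record
            { inverse = -‿inverseˡ , λ p → ≋-trans (+-comm p _) (-‿inverseˡ p)
            ; ⁻¹-cong = ·-congʳ -1ℤ
            ; isMonoid = record
              { identity = (λ _ → ≋-refl) , +-identityʳ
              ; isSemigroup = record
                { assoc = +-assoc
                ; isMagma = record
                  { isEquivalence = record { refl = ≋-refl ; sym = ≋-sym ; trans = ≋-trans }
                  ; ∙-cong = +-cong } } } } } } } }

  -- A zero test for the ring solver. It recognises lists of literal zeros; answering `nothing` is
  -- always sound.
  0≟ᴾ_ : ∀ p → Maybe (0ᴾ ≋ p)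
  0≟ᴾ []      = just ≋-refl
  0≟ᴾ (+ 0 ∷ p) with 0≟ᴾ p
  ... | just e  = just (≋-trans (≋-sym 0∷-zero) (∷-cong refl e))
  ... | nothing = nothing
  0≟ᴾ (_ ∷ p) = nothing

  polyACR : AlmostCommutativeRing 0ℓ 0ℓ
  polyACR = fromCommutativeRing polyRing 0≟ᴾ_

-- Divisibility and coprimality in ℤ[q]

module Divisibility where
  open PolynomialRing
  open import Data.Integer as ℤ using (ℤ; +_; 0ℤ; 1ℤ; -1ℤ)
  import Data.Integer.Properties as ℤₚ
  import Data.Integer.Tactic.RingSolver as ℤ-Solver
  open import Data.List using ([]; _∷_)
  open import Data.Nat as ℕ using (ℕ; zero; suc; _≤_; _<_; s≤s; _≟_)
  import Data.Nat.Properties as ℕₚ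
  open import Data.Nat.Divisibility using (_∣_; divides)
  open import Data.Nat.GCD using (gcd; gcd-GCD; module Bézout)
  open import Data.Product using (∃-syntax; _×_; _,_; proj₁; proj₂)
  open import Data.Sum using ([_,_]′)
  open import Relation.Nullary using (¬_; yes; no; contradiction)
  open import Relation.Binary.PropositionalEquality using (_≡_; _≢_; refl; sym; trans; cong; cong₂)
  open import Tactic.RingSolver using (solve; solve-∀)
  open import Relation.Binary.Reasoning.Setoid ≋-setoid
  open _≋_

  private variable
    f f′ g g′ h x y : Poly

  ≋-reflexive : x ≡ y → x ≋ y
  ≋-reflexive refl = ≋-refl

  *-congˡ : f ≋ f′ → f *ᴾ g ≋ f′ *ᴾ g
  *-congˡ e = *-cong e ≋-refl

  *-cancelʳ : ∀ x y {c} → ¬ c ≈ 0ᴾ → x *ᴾ c ≋ y *ᴾ c → x ≋ y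
  *-cancelʳ x y {c} c≉0 e =
    [ (λ x-y≈0 → begin
        x                        ≈⟨ solve (x ∷ y ∷ []) polyACR ⟩
        (x +ᴾ (-ᴾ y)) +ᴾ y       ≈⟨ +-cong {x +ᴾ (-ᴾ y)} {0ᴾ} {y} (mk≋ x-y≈0) ≋-refl ⟩
        y                        ∎)
    , (λ c≈0 → contradiction c≈0 c≉0)
    ]′ (*ᴾ-noZeroDivisors (x +ᴾ (-ᴾ y)) c (at (begin
        (x +ᴾ (-ᴾ y)) *ᴾ c         ≈⟨ solve (x ∷ y ∷ c ∷ []) polyACR ⟩
        x *ᴾ c +ᴾ (-ᴾ (y *ᴾ c))    ≈⟨ +-cong e ≋-refl ⟩
        y *ᴾ c +ᴾ (-ᴾ (y *ᴾ c))    ≈⟨ solve (y ∷ c ∷ []) polyACR ⟩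
        0ᴾ                         ∎)))

  infix 4 _∣ᴾ_
  _∣ᴾ_ : Poly → Poly → Set
  f ∣ᴾ g = ∃[ h ] h *ᴾ f ≋ g

  ∣ᴾ-refl : f ∣ᴾ f
  ∣ᴾ-refl = 1ᴾ , *-identityˡ _

  1∣ᴾ : 1ᴾ ∣ᴾ f
  1∣ᴾ {f} = f , *-identityʳ f

  ∣ᴾ-trans : f ∣ᴾ g → g ∣ᴾ h → f ∣ᴾ h
  ∣ᴾ-trans {f} {g} {h} (a , e) (b , e′) = b *ᴾ a , (begin
    b *ᴾ a *ᴾ f      ≈⟨ *-assoc b a f ⟩
    b *ᴾ (a *ᴾ f)    ≈⟨ *-congʳ b e ⟩
    b *ᴾ g           ≈⟨ e′ ⟩
    h                ∎)

  ∣ᴾ-respʳ : g ≋ h → f ∣ᴾ g → f ∣ᴾ h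
  ∣ᴾ-respʳ e (a , e′) = a , ≋-trans e′ e

  ∣ᴾ-respˡ : f ≋ f′ → f ∣ᴾ g → f′ ∣ᴾ g
  ∣ᴾ-respˡ e (a , e′) = a , ≋-trans (*-congʳ a (≋-sym e)) e′

  ∏-cong : ∀ k {F G : ℕ → Poly} → (∀ i → i < k → F i ≋ G i) → ∏ k F ≋ ∏ k G
  ∏-cong zero    e = ≋-refl
  ∏-cong (suc k) e = *-cong (∏-cong k λ i i<k → e i (ℕₚ.m<n⇒m<1+n i<k)) (e k ℕₚ.≤-refl)

  ∏-* : ∀ k (F G : ℕ → Poly) → ∏ k (λ i → F i *ᴾ G i) ≋ ∏ k F *ᴾ ∏ k G
  ∏-* zero    F G = ≋-sym (*-identityˡ 1ᴾ)
  ∏-* (suc k) F G = begin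
    ∏ k (λ i → F i *ᴾ G i) *ᴾ (F k *ᴾ G k)   ≈⟨ *-congˡ (∏-* k F G) ⟩
    ∏ k F *ᴾ ∏ k G *ᴾ (F k *ᴾ G k)           ≈⟨ interchange (∏ k F) (∏ k G) (F k) (G k) ⟩
    ∏ k F *ᴾ F k *ᴾ (∏ k G *ᴾ G k)           ∎
    where
    interchange : ∀ a b c d → a *ᴾ b *ᴾ (c *ᴾ d) ≋ a *ᴾ c *ᴾ (b *ᴾ d)
    interchange = solve-∀ polyACR

  factor-∣-∏ : ∀ k (F : ℕ → Poly) {i} → i < k → F i ∣ᴾ ∏ k F
  factor-∣-∏ (suc k) F {i} i<1+k with i ≟ k
  ... | yes refl = ∏ k F , ≋-refl
  ... | no  i≢k  = ∣ᴾ-trans (factor-∣-∏ k F (ℕₚ.≤∧≢⇒< (ℕₚ.≤-pred i<1+k) i≢k))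
                            (F k , *-comm (F k) (∏ k F))

  q^-+ : ∀ m n → q^ (m ℕ.+ n) ≋ q^ m *ᴾ q^ n
  q^-+ zero    n = ≋-sym (*-identityˡ _)
  q^-+ (suc m) n = ≋-trans (∷-cong refl (q^-+ m n)) (≋-sym (0∷-* (q^ m) (q^ n)))

  1-q^-+ : ∀ m n → 1-q^ (m ℕ.+ n) ≋ 1-q^ m +ᴾ q^ m *ᴾ 1-q^ n
  1-q^-+ m n = ≋-trans (+-cong (≋-refl {1ᴾ}) (·-congʳ -1ℤ (q^-+ m n))) (expand (q^ m) (q^ n))
    where
    expand : ∀ a b → 1ᴾ +ᴾ (-ᴾ (a *ᴾ b)) ≋ (1ᴾ +ᴾ (-ᴾ a)) +ᴾ a *ᴾ (1ᴾ +ᴾ (-ᴾ b))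
    expand = solve-∀ polyACR

  const : ℤ → Poly
  const k = k ∷ []

  -- v is 1 + q^n + ⋯ + q^{(s-1)n}, and each q^{in} is congruent to 1 modulo 1 - q^n.
  geometric : ∀ n s → ∃[ v ] ∃[ z ] v *ᴾ 1-q^ n ≋ 1-q^ (s ℕ.* n) × v ≋ const (+ s) +ᴾ z *ᴾ 1-q^ n
  geometric n zero    = 0ᴾ , 0ᴾ , mk≋ (λ { zero → refl ; (suc i) → refl }) , mk≋ λ { zero → refl ; (suc i) → refl }
  geometric n (suc s) with geometric n s
  ... | v , z , e , e′ =
    1ᴾ +ᴾ q^ n *ᴾ v , z +ᴾ (-ᴾ v) , (begin
      (1ᴾ +ᴾ q^ n *ᴾ v) *ᴾ 1-q^ n          ≈⟨ lemma₁ (q^ n) v (1-q^ n) ⟩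
      1-q^ n +ᴾ q^ n *ᴾ (v *ᴾ 1-q^ n)      ≈⟨ +-cong (≋-refl {1-q^ n}) (*-congʳ (q^ n) e) ⟩
      1-q^ n +ᴾ q^ n *ᴾ 1-q^ (s ℕ.* n)     ≈⟨ 1-q^-+ n (s ℕ.* n) ⟨
      1-q^ (n ℕ.+ s ℕ.* n)                 ∎) , (begin
      1ᴾ +ᴾ q^ n *ᴾ v                                                ≈⟨ lemma₂ (q^ n) v ⟩
      1ᴾ +ᴾ v +ᴾ (-ᴾ v) *ᴾ 1-q^ n                                    ≈⟨ +-cong (+-cong (≋-refl {1ᴾ}) e′) ≋-refl ⟩
      1ᴾ +ᴾ (const (+ s) +ᴾ z *ᴾ 1-q^ n) +ᴾ (-ᴾ v) *ᴾ 1-q^ n         ≈⟨ lemma₃ (const (+ s)) z v (1-q^ n) ⟩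
      const (+ suc s) +ᴾ (z +ᴾ (-ᴾ v)) *ᴾ 1-q^ n                     ∎)
    where
    lemma₁ : ∀ a v u → (1ᴾ +ᴾ a *ᴾ v) *ᴾ u ≋ u +ᴾ a *ᴾ (v *ᴾ u)
    lemma₁ = solve-∀ polyACR
    lemma₂ : ∀ a v → 1ᴾ +ᴾ a *ᴾ v ≋ 1ᴾ +ᴾ v +ᴾ (-ᴾ v) *ᴾ (1ᴾ +ᴾ (-ᴾ a))
    lemma₂ = solve-∀ polyACR
    lemma₃ : ∀ c z v u → 1ᴾ +ᴾ (c +ᴾ z *ᴾ u) +ᴾ (-ᴾ v) *ᴾ u ≋ (1ᴾ +ᴾ c) +ᴾ (z +ᴾ (-ᴾ v)) *ᴾ u
    lemma₃ = solve-∀ polyACR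

  1-q^-∣ : ∀ {m n} → m ∣ n → 1-q^ m ∣ᴾ 1-q^ n
  1-q^-∣ {m} (divides s refl) with geometric m s
  ... | v , _ , e , _ = v , e

  -- An identity d + t n = s m between exponents gives 1 - q^(sm) = (1 - q^d) + q^d (1 - q^(tn)),
  -- whose outer terms are multiples of 1 - q^m and 1 - q^n. The coefficients therefore stay in
  -- ℤ[q].
  1-q^-Bézout : ∀ m n → ∃[ x ] ∃[ y ] x *ᴾ 1-q^ m +ᴾ y *ᴾ 1-q^ n ≋ 1-q^ (gcd m n)
  1-q^-Bézout m n = identity (gcd m n) m n (Bézout.identity (gcd-GCD m n))
    where
    step : ∀ d m n s t → d ℕ.+ t ℕ.* n ≡ s ℕ.* m → ∃[ x ] ∃[ y ] x *ᴾ 1-q^ m +ᴾ y *ᴾ 1-q^ n ≋ 1-q^ d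
    step d m n s t e with 1-q^-∣ {m} (divides s refl) | 1-q^-∣ {n} (divides t refl)
    ... | v , v-eq | w , w-eq = v , (-ᴾ (q^ d *ᴾ w)) , (begin
      v *ᴾ 1-q^ m +ᴾ (-ᴾ (q^ d *ᴾ w)) *ᴾ 1-q^ n
        ≈⟨ +-cong v-eq (pull (q^ d) w (1-q^ n)) ⟩
      1-q^ (s ℕ.* m) +ᴾ (-ᴾ (q^ d *ᴾ (w *ᴾ 1-q^ n)))
        ≡⟨ cong (λ k → 1-q^ k +ᴾ (-ᴾ (q^ d *ᴾ (w *ᴾ 1-q^ n)))) e ⟨
      1-q^ (d ℕ.+ t ℕ.* n) +ᴾ (-ᴾ (q^ d *ᴾ (w *ᴾ 1-q^ n)))
        ≈⟨ +-cong (1-q^-+ d (t ℕ.* n)) (·-congʳ -1ℤ (*-congʳ (q^ d) w-eq)) ⟩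
      1-q^ d +ᴾ q^ d *ᴾ 1-q^ (t ℕ.* n) +ᴾ (-ᴾ (q^ d *ᴾ 1-q^ (t ℕ.* n)))
        ≈⟨ cancel (1-q^ d) (q^ d *ᴾ 1-q^ (t ℕ.* n)) ⟩
      1-q^ d ∎)
      where
      pull : ∀ a w u → (-ᴾ (a *ᴾ w)) *ᴾ u ≋ -ᴾ (a *ᴾ (w *ᴾ u))
      pull = solve-∀ polyACR
      cancel : ∀ a b → a +ᴾ b +ᴾ (-ᴾ b) ≋ a
      cancel = solve-∀ polyACR
    identity : ∀ d m n → Bézout.Identity d m n → ∃[ x ] ∃[ y ] x *ᴾ 1-q^ m +ᴾ y *ᴾ 1-q^ n ≋ 1-q^ d
    identity d m n (Bézout.+- s t e) = step d m n s t e
    identity d m n (Bézout.-+ s t e) =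
      let x , y , h = step d n m t s e in y , x , ≋-trans (+-comm (y *ᴾ 1-q^ m) (x *ᴾ 1-q^ n)) h

  -- Coprimality over ℚ: some non-zero integer lies in the ideal (f , g) of ℤ[q].
  Coprime : Poly → Poly → Set
  Coprime f g = ∃[ k ] k ≢ 0ℤ × ∃[ x ] ∃[ y ] x *ᴾ f +ᴾ y *ᴾ g ≋ const k

  coprime-1 : Coprime f 1ᴾ
  coprime-1 = 1ℤ , (λ ()) , 0ᴾ , 1ᴾ , *-identityˡ 1ᴾ

  coprime-sym : Coprime f g → Coprime g f
  coprime-sym {f} {g} (k , k≢0 , x , y , e) =
    k , k≢0 , y , x , ≋-trans (+-comm (y *ᴾ g) (x *ᴾ f)) e

  coprime-* : Coprime f g → Coprime f h → Coprime f (g *ᴾ h)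
  coprime-* {f} {g} {h} (k , k≢0 , x , y , e) (l , l≢0 , x′ , y′ , e′) =
    k ℤ.* l , (λ kl≡0 → [ k≢0 , l≢0 ]′ (ℤₚ.i*j≡0⇒i≡0∨j≡0 k kl≡0)) ,
    x *ᴾ (x′ *ᴾ f +ᴾ y′ *ᴾ h) +ᴾ y *ᴾ g *ᴾ x′ , y *ᴾ y′ , (begin
      (x *ᴾ (x′ *ᴾ f +ᴾ y′ *ᴾ h) +ᴾ y *ᴾ g *ᴾ x′) *ᴾ f +ᴾ y *ᴾ y′ *ᴾ (g *ᴾ h)
        ≈⟨ solve (f ∷ g ∷ h ∷ x ∷ y ∷ x′ ∷ y′ ∷ []) polyACR ⟩
      (x *ᴾ f +ᴾ y *ᴾ g) *ᴾ (x′ *ᴾ f +ᴾ y′ *ᴾ h)   ≈⟨ *-cong e e′ ⟩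
      const k *ᴾ const l                          ≈⟨ ∷-cong (ℤₚ.+-identityʳ _) ≋-refl ⟩
      const (k ℤ.* l)                             ∎)

  coprime-∣ : f′ ∣ᴾ f → g′ ∣ᴾ g → Coprime f g → Coprime f′ g′
  coprime-∣ {f′} {f} {g′} {g} (a , e) (b , e′) (k , k≢0 , x , y , h) =
    k , k≢0 , x *ᴾ a , y *ᴾ b , (begin
      x *ᴾ a *ᴾ f′ +ᴾ y *ᴾ b *ᴾ g′       ≈⟨ +-cong (*-assoc x a f′) (*-assoc y b g′) ⟩
      x *ᴾ (a *ᴾ f′) +ᴾ y *ᴾ (b *ᴾ g′)   ≈⟨ +-cong (*-congʳ x e) (*-congʳ y e′) ⟩
      x *ᴾ f +ᴾ y *ᴾ g                   ≈⟨ h ⟩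
      const k                            ∎)

  coprime-∏ : ∀ k F → (∀ i → i < k → Coprime f (F i)) → Coprime f (∏ k F)
  coprime-∏ zero    F h = coprime-1
  coprime-∏ (suc k) F h =
    coprime-* {g = ∏ k F} (coprime-∏ k F λ i i<k → h i (ℕₚ.m<n⇒m<1+n i<k)) (h k ℕₚ.≤-refl)

  -- Polynomials with invertible constant coefficient are primitive, so integer
  -- factors can be cancelled from what they divide.
  Unit₀ : Poly → Set
  Unit₀ p = ∃[ c ] c ℤ.* coeff p 0 ≡ 1ℤ

  coeff₀-* : ∀ p r → coeff (p *ᴾ r) 0 ≡ coeff p 0 ℤ.* coeff r 0
  coeff₀-* []      r       = refl
  coeff₀-* (a ∷ p) r       = trans (coeff-+ (a · r) _ 0) (trans (ℤₚ.+-identityʳ _) (coeff-· a r 0))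

  unit₀-∣ : f ∣ᴾ g → Unit₀ g → Unit₀ f
  unit₀-∣ {f} {g} (h , e) (c , c-inv) = c ℤ.* coeff h 0 , (trans (ℤₚ.*-assoc c _ _)
    (trans (cong (c ℤ.*_) (trans (sym (coeff₀-* h f)) (at e 0))) c-inv))

  unit₀-* : Unit₀ f → Unit₀ g → Unit₀ (f *ᴾ g)
  unit₀-* {f} {g} (c , e) (d , e′) = c ℤ.* d ,
    trans (cong (c ℤ.* d ℤ.*_) (coeff₀-* f g))
          (trans (interchange c d (coeff f 0) (coeff g 0)) (cong₂ ℤ._*_ e e′))
    where
    interchange : ∀ c d a b → c ℤ.* d ℤ.* (a ℤ.* b) ≡ c ℤ.* a ℤ.* (d ℤ.* b)
    interchange = ℤ-Solver.solve-∀

  unit₀-∏ : ∀ k F → (∀ i → i < k → Unit₀ (F i)) → Unit₀ (∏ k F)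
  unit₀-∏ zero    F h = 1ℤ , refl
  unit₀-∏ (suc k) F h =
    unit₀-* {∏ k F} (unit₀-∏ k F λ i i<k → h i (ℕₚ.m<n⇒m<1+n i<k)) (h k ℕₚ.≤-refl)

  unit₀-1-q^ : ∀ {k} → 1 ≤ k → Unit₀ (1-q^ k)
  unit₀-1-q^ (s≤s _) = 1ℤ , refl

  ·-cancel : ∀ k {x y} → k ≢ 0ℤ → k · x ≋ k · y → x ≋ y
  ·-cancel k {x} {y} k≢0 e = mk≋ λ i → ℤₚ.*-cancelˡ-≡ k _ _ {{ℤ.≢-nonZero k≢0}}
    (trans (sym (coeff-· k x i)) (trans (at e i) (coeff-· k y i)))

  -- As `f` has a unit constant coefficient, division by it proceeds from the lowest degree upwards.
  -- The lowest coefficient of the cofactor `h` is k times `c ℤ.* coeff x 0`, which is thus the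
  -- matching coefficient of the integral quotient; subtracting that multiple of `f` and shifting
  -- down reproduces the situation with a shorter cofactor.
  ∣ᴾ-·-cancel : ∀ k f x → k ≢ 0ℤ → Unit₀ f → f ∣ᴾ k · x → f ∣ᴾ x
  ∣ᴾ-·-cancel k f x k≢0 (c , c-inv) (h , e) = go h x e
    where
    tail : Poly → Poly
    tail []      = []
    tail (_ ∷ p) = p
    split : ∀ p → p ≋ coeff p 0 ∷ tail p
    split []      = ≋-sym 0∷-zero
    split (a ∷ p) = ≋-refl
    go : ∀ h x → h *ᴾ f ≋ k · x → f ∣ᴾ x
    go []      x e = 0ᴾ , ·-cancel k k≢0 (≋-trans ≋-refl e)
    go (b ∷ h) x e = b′ ∷ proj₁ rec , (begin
        b′ · f +ᴾ (0ℤ ∷ proj₁ rec *ᴾ f)   ≈⟨ +-cong (≋-refl {b′ · f}) (∷-cong refl (proj₂ rec)) ⟩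
        b′ · f +ᴾ (0ℤ ∷ tail x′)          ≈⟨ +-cong (≋-refl {b′ · f}) (≋-trans (∷-cong (sym x′₀) ≋-refl) (≋-sym (split x′))) ⟩
        b′ · f +ᴾ (x +ᴾ (-ᴾ (b′ · f)))    ≈⟨ uncancel (b′ · f) x ⟩
        x                                 ∎)
      where
      b′ : ℤ
      b′ = c ℤ.* coeff x 0
      x′ : Poly
      x′ = x +ᴾ (-ᴾ (b′ · f))
      b≡kb′ : b ≡ k ℤ.* b′
      b≡kb′ = ≡.begin
        b                             ≡.≡⟨ ℤₚ.*-identityˡ b ⟨
        1ℤ ℤ.* b                      ≡.≡⟨ cong (ℤ._* b) c-inv ⟨
        c ℤ.* coeff f 0 ℤ.* b         ≡.≡⟨ assoc-swap c (coeff f 0) b ⟩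
        c ℤ.* (b ℤ.* coeff f 0)       ≡.≡⟨ cong (c ℤ.*_) (trans (sym (coeff₀-* (b ∷ h) f)) (trans (at e 0) (coeff-· k x 0))) ⟩
        c ℤ.* (k ℤ.* coeff x 0)       ≡.≡⟨ swap c k (coeff x 0) ⟩
        k ℤ.* (c ℤ.* coeff x 0)       ≡.∎
        where
        module ≡ = Relation.Binary.PropositionalEquality.≡-Reasoning
        assoc-swap : ∀ c f b → c ℤ.* f ℤ.* b ≡ c ℤ.* (b ℤ.* f)
        assoc-swap = ℤ-Solver.solve-∀
        swap : ∀ c k x → c ℤ.* (k ℤ.* x) ≡ k ℤ.* (c ℤ.* x)
        swap = ℤ-Solver.solve-∀
      kx′ : k · x′ ≋ 0ℤ ∷ h *ᴾ f
      kx′ = begin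
        k · x′                                             ≈⟨ const-* k x′ ⟨
        const k *ᴾ x′                                      ≈⟨ expand (const k) x (b′ · f) ⟩
        const k *ᴾ x +ᴾ (-ᴾ (const k *ᴾ (b′ · f)))         ≈⟨ +-cong (const-* k x) (·-congʳ -1ℤ (≋-trans (const-* k (b′ · f)) (·-assoc k b′ f))) ⟩
        k · x +ᴾ (-ᴾ ((k ℤ.* b′) · f))                     ≡⟨ cong (λ a → k · x +ᴾ (-ᴾ (a · f))) b≡kb′ ⟨
        k · x +ᴾ (-ᴾ (b · f))                              ≈⟨ +-cong (≋-sym e) ≋-refl ⟩
        b · f +ᴾ (0ℤ ∷ h *ᴾ f) +ᴾ (-ᴾ (b · f))             ≈⟨ cancel (b · f) (0ℤ ∷ h *ᴾ f) ⟩
        0ℤ ∷ h *ᴾ f                                        ∎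
        where
        expand : ∀ k x y → k *ᴾ (x +ᴾ (-ᴾ y)) ≋ k *ᴾ x +ᴾ (-ᴾ (k *ᴾ y))
        expand = solve-∀ polyACR
        cancel : ∀ a b → a +ᴾ b +ᴾ (-ᴾ a) ≋ b
        cancel = solve-∀ polyACR
      x′₀ : coeff x′ 0 ≡ 0ℤ
      x′₀ = [ (λ k≡0 → contradiction k≡0 k≢0) , (λ z → z) ]′
        (ℤₚ.i*j≡0⇒i≡0∨j≡0 k (trans (sym (coeff-· k x′ 0)) (at kx′ 0)))
      rec : f ∣ᴾ tail x′
      rec = go h (tail x′) (mk≋ λ i → sym (trans (sym (at (·-congʳ k (split x′)) (suc i))) (at kx′ (suc i))))
      uncancel : ∀ a x → a +ᴾ (x +ᴾ (-ᴾ a)) ≋ x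
      uncancel = solve-∀ polyACR

  -- If c = y F k + z ∏ k F, then c x is divisible by ∏ k F · F k: in the first summand ∏ k F is
  -- taken from x, in the second F k. The integer c is cancelled because the product has a unit
  -- constant coefficient.
  ∏-coprime-∣ : ∀ k F x → (∀ i → i < k → Unit₀ (F i)) → (∀ i j → i < j → j < k → Coprime (F i) (F j)) →
                (∀ i → i < k → F i ∣ᴾ x) → ∏ k F ∣ᴾ x
  ∏-coprime-∣ zero    F x units coprimes divs = 1∣ᴾ
  ∏-coprime-∣ (suc k) F x units coprimes divs
    with ∏-coprime-∣ k F x (λ i i<k → units i (ℕₚ.m<n⇒m<1+n i<k))
           (λ i j i<j j<k → coprimes i j i<j (ℕₚ.m<n⇒m<1+n j<k)) (λ i i<k → divs i (ℕₚ.m<n⇒m<1+n i<k))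
       | divs k ℕₚ.≤-refl
       | coprime-∏ k F (λ i i<k → coprime-sym {F i} {F k} (coprimes i k i<k ℕₚ.≤-refl))
  ... | a , a-eq | b , b-eq | c , c≢0 , y , z , e =
    ∣ᴾ-·-cancel c _ x c≢0 (unit₀-∏ (suc k) F units) (y *ᴾ a +ᴾ z *ᴾ b , (begin
      (y *ᴾ a +ᴾ z *ᴾ b) *ᴾ (∏ k F *ᴾ F k)
        ≈⟨ regroup y a z b (∏ k F) (F k) ⟩
      y *ᴾ F k *ᴾ (a *ᴾ ∏ k F) +ᴾ z *ᴾ ∏ k F *ᴾ (b *ᴾ F k)
        ≈⟨ +-cong (*-congʳ (y *ᴾ F k) a-eq) (*-congʳ (z *ᴾ ∏ k F) b-eq) ⟩
      y *ᴾ F k *ᴾ x +ᴾ z *ᴾ ∏ k F *ᴾ x       ≈⟨ *-distribʳ x (y *ᴾ F k) (z *ᴾ ∏ k F) ⟨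
      (y *ᴾ F k +ᴾ z *ᴾ ∏ k F) *ᴾ x          ≈⟨ *-congˡ e ⟩
      const c *ᴾ x                           ≈⟨ const-* c x ⟩
      c · x                                  ∎))
    where
    regroup : ∀ y a z b p f → (y *ᴾ a +ᴾ z *ᴾ b) *ᴾ (p *ᴾ f) ≋ y *ᴾ f *ᴾ (a *ᴾ p) +ᴾ z *ᴾ p *ᴾ (b *ᴾ f)
    regroup = solve-∀ polyACR

-- Floor functions and their inequalities

module Floors where
  open import Data.Bool using (if_then_else_)
  open import Data.Nat as ℕ using (ℕ; zero; suc; _+_; _*_; _/_; _≤_; _<_; z≤n)
  open import Data.Nat.Divisibility using (_∣_; _∣?_; divides)
  open import Data.Nat.DivMod using (m≡m%n+[m/n]*n; m/n*n≤m; m%n<n)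
  import Data.Nat.Properties as ℕₚ
  import Data.Nat.Tactic.RingSolver as ℕ-Solver
  open import Relation.Binary.PropositionalEquality using (_≡_; sym; trans; cong; cong₂; subst)
  open import Relation.Nullary using (¬_; yes; no; does)
  open import Relation.Nullary.Decidable using (dec-true; dec-false)

  ⟦_∣_⟧ : ℕ → ℕ → ℕ
  ⟦ d ∣ k ⟧ = if does (d ∣? k) then 1 else 0

  ⟦∣⟧-yes : ∀ {d k} → d ∣ k → ⟦ d ∣ k ⟧ ≡ 1
  ⟦∣⟧-yes {d} {k} h = cong (if_then 1 else 0) (dec-true (d ∣? k) h)

  ⟦∣⟧-no : ∀ {d k} → ¬ d ∣ k → ⟦ d ∣ k ⟧ ≡ 0
  ⟦∣⟧-no {d} {k} h = cong (if_then 1 else 0) (dec-false (d ∣? k) h)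

  ⟦∣⟧-elim : ∀ {d k} (P : ℕ → Set) → (d ∣ k → P 1) → (¬ d ∣ k → P 0) → P ⟦ d ∣ k ⟧
  ⟦∣⟧-elim {d} {k} P p₁ p₀ with d ∣? k
  ... | yes h = p₁ h
  ... | no  h = p₀ h

  ⟦∣⟧-mono : ∀ {d k l} → (d ∣ k → d ∣ l) → ⟦ d ∣ k ⟧ ≤ ⟦ d ∣ l ⟧
  ⟦∣⟧-mono {d} {k} {l} h = ⟦∣⟧-elim {d} {k} (_≤ ⟦ d ∣ l ⟧) (λ d∣k → ℕₚ.≤-reflexive (sym (⟦∣⟧-yes (h d∣k)))) (λ _ → z≤n)

  m<[1+m/n]*n : ∀ m n .{{_ : ℕ.NonZero n}} → m < suc (m / n) * n
  m<[1+m/n]*n m n = subst (_< suc (m / n) * n) (sym (m≡m%n+[m/n]*n m n)) (ℕₚ.+-monoˡ-< (m / n * n) (m%n<n m n))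

  /-unique : ∀ {m n q} .{{_ : ℕ.NonZero n}} → q * n ≤ m → m < suc q * n → m / n ≡ q
  /-unique {m} {n} {q} lo hi = ℕₚ.≤-antisym
    (ℕₚ.≤-pred (ℕₚ.*-cancelʳ-< n (m / n) (suc q) (ℕₚ.≤-<-trans (m/n*n≤m m n) hi)))
    (ℕₚ.≤-pred (ℕₚ.*-cancelʳ-< n q (suc (m / n)) (ℕₚ.≤-<-trans lo (m<[1+m/n]*n m n))))

  -- The increment matches the exponents that the factor `1-q^ (suc m)` adds to `[ m ]!`; this
  -- drives the induction in `[]!-monomial`.
  suc-/ : ∀ m n .{{_ : ℕ.NonZero n}} → suc m / n ≡ m / n + ⟦ n ∣ suc m ⟧
  suc-/ m n = ⟦∣⟧-elim {n} {suc m} (λ e → suc m / n ≡ m / n + e)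
    (λ { (divides zero ())
       ; (divides (suc s) eq) →
           let s*n≤m = ℕₚ.≤-pred (subst (s * n <_) (sym eq) (ℕₚ.m<n+m _ (ℕ.>-nonZero⁻¹ n))) in
           trans (/-unique {q = suc s} (ℕₚ.≤-reflexive (sym eq))
                    (subst (_< suc (suc s) * n) (sym eq) (ℕₚ.m<n+m _ (ℕ.>-nonZero⁻¹ n))))
                 (trans (ℕₚ.+-comm 1 s)
                        (cong (_+ 1) (sym (/-unique {q = s} s*n≤m (subst (m <_) eq ℕₚ.≤-refl))))) })
    (λ n∤1+m → trans (/-unique {q = m / n} (ℕₚ.m≤n⇒m≤1+n (m/n*n≤m m n))
                        (ℕₚ.≤∧≢⇒< (m<[1+m/n]*n m n) λ eq → n∤1+m (divides (suc (m / n)) eq)))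
                     (sym (ℕₚ.+-identityʳ _)))

  /-superadditive : ∀ x y d .{{_ : ℕ.NonZero d}} → x / d + y / d ≤ (x + y) / d
  /-superadditive x y d = ℕₚ.≤-pred (ℕₚ.*-cancelʳ-< d (x / d + y / d) (suc ((x + y) / d)) (begin-strict
    (x / d + y / d) * d         ≡⟨ ℕₚ.*-distribʳ-+ d (x / d) (y / d) ⟩
    x / d * d + y / d * d       ≤⟨ ℕₚ.+-mono-≤ (m/n*n≤m x d) (m/n*n≤m y d) ⟩
    x + y                       <⟨ m<[1+m/n]*n (x + y) d ⟩
    suc ((x + y) / d) * d       ∎))
    where open ℕₚ.≤-Reasoning

  -- If x + z = s d and y + w + 1 = t d with d ∤ x, then x/d + z/d ≤ s - 1 and y/d + w/d ≤ t - 1,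
  -- whereas (x + y) + (z + w) + 1 = (s + t) d gives (x + y)/d + (z + w)/d ≥ s + t - 1.
  /-gain : ∀ x y z w d .{{_ : ℕ.NonZero d}} → d ∣ x + z → d ∣ suc (y + w) → ¬ d ∣ x →
           suc ((x / d + y / d) + (z / d + w / d)) ≤ (x + y) / d + (z + w) / d
  /-gain x y z w d (divides s x+z≡sd) (divides t 1+y+w≡td) d∤x = ℕₚ.≤-pred (begin
    suc (suc ((x / d + y / d) + (z / d + w / d)))    ≡⟨ shuffle (x / d) (y / d) (z / d) (w / d) ⟩
    suc (x / d + z / d) + suc (y / d + w / d)        ≤⟨ ℕₚ.+-mono-≤ xz<s yw<t ⟩
    s + t                                            ≤⟨ ℕₚ.≤-pred (ℕₚ.*-cancelʳ-< d (s + t) _ s+t<) ⟩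
    suc ((x + y) / d + (z + w) / d)                  ∎)
    where
    open ℕₚ.≤-Reasoning
    shuffle : ∀ a b c e → suc (suc ((a + b) + (c + e))) ≡ suc (a + c) + suc (b + e)
    shuffle = ℕ-Solver.solve-∀
    xz<s : x / d + z / d < s
    xz<s = ℕₚ.*-cancelʳ-< d (x / d + z / d) s (begin-strict
      (x / d + z / d) * d        ≡⟨ ℕₚ.*-distribʳ-+ d (x / d) (z / d) ⟩
      x / d * d + z / d * d      <⟨ ℕₚ.+-mono-<-≤ (ℕₚ.≤∧≢⇒< (m/n*n≤m x d) λ e → d∤x (divides (x / d) (sym e))) (m/n*n≤m z d) ⟩
      x + z                      ≡⟨ x+z≡sd ⟩
      s * d                      ∎)
    yw<t : y / d + w / d < t
    yw<t = ℕₚ.*-cancelʳ-< d (y / d + w / d) t (begin-strict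
      (y / d + w / d) * d        ≡⟨ ℕₚ.*-distribʳ-+ d (y / d) (w / d) ⟩
      y / d * d + w / d * d      ≤⟨ ℕₚ.+-mono-≤ (m/n*n≤m y d) (m/n*n≤m w d) ⟩
      y + w                      <⟨ ℕₚ.≤-refl ⟩
      suc (y + w)                ≡⟨ 1+y+w≡td ⟩
      t * d                      ∎)
    s+t< : (s + t) * d < suc (suc ((x + y) / d + (z + w) / d)) * d
    s+t< = begin-strict
      (s + t) * d                                          ≡⟨ ℕₚ.*-distribʳ-+ d s t ⟩
      s * d + t * d                                        ≡⟨ cong₂ _+_ x+z≡sd 1+y+w≡td ⟨
      (x + z) + suc (y + w)                                ≡⟨ shuffle′ x y z w ⟩
      suc (x + y) + (z + w)                                <⟨ ℕₚ.+-mono-≤-< (m<[1+m/n]*n (x + y) d) (m<[1+m/n]*n (z + w) d) ⟩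
      suc ((x + y) / d) * d + suc ((z + w) / d) * d        ≡⟨ collect ((x + y) / d) ((z + w) / d) d ⟩
      suc (suc ((x + y) / d + (z + w) / d)) * d            ∎
      where
      shuffle′ : ∀ x y z w → (x + z) + suc (y + w) ≡ suc (x + y) + (z + w)
      shuffle′ = ℕ-Solver.solve-∀
      collect : ∀ a b d → suc a * d + suc b * d ≡ suc (suc (a + b)) * d
      collect = ℕ-Solver.solve-∀

-- Cyclotomic factors of 1 - q^k and of the q-factorials

module Cyclotomic where
  open PolynomialRing
  open Divisibility
  open Floors
  open import Data.Bool using (if_then_else_)
  open import Data.Integer using (+_; 0ℤ; 1ℤ)
  open import Data.Nat as ℕ using (ℕ; zero; suc; _≤_; _<_; _∸_; z≤n; s≤s; _≟_; _/_; _+_; _*_)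
  import Data.Nat.Properties as ℕₚ
  open import Data.Nat.Divisibility as ∣ℕ using (_∣_; _∣?_; divides)
  open import Data.Nat.GCD using (gcd; gcd[m,n]∣m; gcd[m,n]∣n)
  open import Data.Product using (∃-syntax; _×_; _,_)
  open import Relation.Nullary using (¬_; yes; no; does)
  open import Relation.Nullary.Decidable using (dec-true; dec-false)
  open import Relation.Binary.PropositionalEquality using (_≡_; _≢_; refl; sym; cong; cong₂; subst)
  open import Tactic.RingSolver using (solve-∀)
  open import Relation.Binary.Reasoning.Setoid ≋-setoid

  infixr 8 _^ᴾ_
  _^ᴾ_ : Poly → ℕ → Poly
  f ^ᴾ zero  = 1ᴾ
  f ^ᴾ suc n = f *ᴾ f ^ᴾ n

  ^ᴾ-+ : ∀ f m n → f ^ᴾ (m + n) ≋ f ^ᴾ m *ᴾ f ^ᴾ n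
  ^ᴾ-+ f zero    n = ≋-sym (*-identityˡ _)
  ^ᴾ-+ f (suc m) n = ≋-trans (*-congʳ f (^ᴾ-+ f m n)) (≋-sym (*-assoc f (f ^ᴾ m) (f ^ᴾ n)))

  -- Exponent vectors and the families Φ below are indexed from 0: index i belongs to the divisor i + 1.
  monomial : (ℕ → Poly) → ℕ → (ℕ → ℕ) → Poly
  monomial Φ M e = ∏ M λ i → Φ i ^ᴾ e i

  monomial-+ : ∀ Φ M e e′ → monomial Φ M (λ i → e i + e′ i) ≋ monomial Φ M e *ᴾ monomial Φ M e′
  monomial-+ Φ M e e′ = ≋-trans (∏-cong M λ i _ → ^ᴾ-+ (Φ i) (e i) (e′ i))
                                (∏-* M (λ i → Φ i ^ᴾ e i) (λ i → Φ i ^ᴾ e′ i))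

  monomial-cong : ∀ Φ M {e e′} → (∀ i → e i ≡ e′ i) → monomial Φ M e ≋ monomial Φ M e′
  monomial-cong Φ M h = ∏-cong M λ i _ → ≋-reflexive (cong (Φ i ^ᴾ_) (h i))

  monomial-∸ : ∀ Φ M e e′ → (∀ i → e i ≤ e′ i) →
               monomial Φ M (λ i → e′ i ∸ e i) *ᴾ monomial Φ M e ≋ monomial Φ M e′
  monomial-∸ Φ M e e′ e≤e′ = ≋-trans (≋-sym (monomial-+ Φ M (λ i → e′ i ∸ e i) e))
                                         (monomial-cong Φ M λ i → ℕₚ.m∸n+n≡m (e≤e′ i))

  factor-∣-monomial : ∀ Φ M e {i} → i < M → e i ≡ 1 → Φ i ∣ᴾ monomial Φ M e
  factor-∣-monomial Φ M e {i} i<M ei≡1 = ∣ᴾ-trans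
    (∣ᴾ-respʳ (≋-trans (≋-sym (*-identityʳ (Φ i))) (≋-reflexive (cong (Φ i ^ᴾ_) (sym ei≡1)))) (∣ᴾ-refl {Φ i}))
    (factor-∣-∏ M (λ i → Φ i ^ᴾ e i) i<M)

  divisorsOf : ℕ → ℕ → ℕ
  divisorsOf k i = ⟦ suc i ∣ k ⟧

  -- The family is characterised by these factorisations. A common bound `M` lets every product
  -- range over the same indices, so that multiplication is addition of exponent vectors.
  Cyclotomic : (ℕ → Poly) → ℕ → Set
  Cyclotomic Φ M = ∀ k → 1 ≤ k → k ≤ M → 1-q^ k ≋ monomial Φ M (divisorsOf k)

  module _ {Φ M} (cyc : Cyclotomic Φ M) where

    Φ-∣-1-q^ : ∀ {i} → i < M → Φ i ∣ᴾ 1-q^ (suc i)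
    Φ-∣-1-q^ {i} i<M = ∣ᴾ-respʳ (≋-sym (cyc (suc i) (s≤s z≤n) i<M))
      (factor-∣-monomial Φ M (divisorsOf (suc i)) i<M (⟦∣⟧-yes (∣ℕ.∣-refl {suc i})))

    -- Division subtracts exponent vectors, and at index j this leaves 1 - 0, since j + 1 does not
    -- divide the smaller g.
    Φ-∣-quotient : ∀ {j g} → j < M → 1 ≤ g → g < suc j → g ∣ suc j →
                   ∃[ v ] v *ᴾ 1-q^ g ≋ 1-q^ (suc j) × Φ j ∣ᴾ v
    Φ-∣-quotient {j} {g} j<M 1≤g g≤j g∣j =
      monomial Φ M e , (begin
        monomial Φ M e *ᴾ 1-q^ g
          ≈⟨ *-congʳ (monomial Φ M e) (cyc g 1≤g (ℕₚ.≤-trans (ℕₚ.<⇒≤ g≤j) j<M)) ⟩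
        monomial Φ M e *ᴾ monomial Φ M (divisorsOf g)
          ≈⟨ monomial-∸ Φ M (divisorsOf g) (divisorsOf (suc j))
               (λ i → ⟦∣⟧-mono {suc i} λ h → ∣ℕ.∣-trans h g∣j) ⟩
        monomial Φ M (divisorsOf (suc j))
          ≈⟨ cyc (suc j) (s≤s z≤n) j<M ⟨
        1-q^ (suc j) ∎) ,
      factor-∣-monomial Φ M e j<M (cong₂ _∸_ (⟦∣⟧-yes (∣ℕ.∣-refl {suc j}))
                                             (⟦∣⟧-no λ h → ℕₚ.<⇒≱ g≤j (∣ℕ.∣⇒≤ {{ℕ.>-nonZero 1≤g}} h)))
      where
      e : ℕ → ℕ
      e i = divisorsOf (suc j) i ∸ divisorsOf g i

    -- With g = gcd(i + 1, j + 1) < j + 1, the factor Φ j divides v = (1 - q^{j+1}) / (1 - q^g).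
    -- If g = i + 1, then v is congruent to the integer (j + 1) / g modulo 1 - q^g, a multiple of Φ i.
    -- Otherwise Φ i divides w = (1 - q^{i+1}) / (1 - q^g), and v and w are comaximal by Bézout.
    Φ-coprime : ∀ {i j} → i < j → j < M → Coprime (Φ i) (Φ j)
    Φ-coprime {i} {j} i<j j<M with suc i ∣? suc j
    ... | yes (divides s eq) =
      let v , z , v-eq , v≋s+zu = geometric (suc i) s
          w , w-eq , Φj∣w = Φ-∣-quotient {g = suc i} j<M (s≤s z≤n) (s≤s i<j) (divides s eq)
          w≋v : w ≋ v
          w≋v = *-cancelʳ w v (1-q^-nonzero {suc i} (s≤s z≤n))
                  (≋-trans w-eq (≋-trans (≋-reflexive (cong 1-q^_ eq)) (≋-sym v-eq)))
      in coprime-∣ (Φ-∣-1-q^ (ℕₚ.<-trans i<j j<M)) (∣ᴾ-respʳ w≋v Φj∣w)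
           (+ s , nonzero s eq , -ᴾ z , 1ᴾ , (begin
             (-ᴾ z) *ᴾ 1-q^ (suc i) +ᴾ 1ᴾ *ᴾ v
               ≈⟨ +-cong (≋-refl {(-ᴾ z) *ᴾ 1-q^ (suc i)}) (*-congʳ 1ᴾ v≋s+zu) ⟩
             (-ᴾ z) *ᴾ 1-q^ (suc i) +ᴾ 1ᴾ *ᴾ (const (+ s) +ᴾ z *ᴾ 1-q^ (suc i))
               ≈⟨ cancel z (1-q^ (suc i)) (const (+ s)) ⟩
             const (+ s) ∎))
      where
      nonzero : ∀ s → suc j ≡ s * suc i → + s ≢ 0ℤ
      nonzero (suc s) _ ()
      cancel : ∀ z u c → (-ᴾ z) *ᴾ u +ᴾ 1ᴾ *ᴾ (c +ᴾ z *ᴾ u) ≋ c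
      cancel = solve-∀ polyACR
    ... | no i∤j =
      let g∣i = gcd[m,n]∣m (suc i) (suc j)
          g∣j = gcd[m,n]∣n (suc i) (suc j)
          1≤g = 1≤gcd g∣i
          g≤i = ℕₚ.≤∧≢⇒< (∣ℕ.∣⇒≤ g∣i) (λ g≡i → i∤j (subst (_∣ suc j) g≡i g∣j))
          v , v-eq , Φi∣v = Φ-∣-quotient (ℕₚ.<-trans i<j j<M) 1≤g g≤i g∣i
          w , w-eq , Φj∣w = Φ-∣-quotient j<M 1≤g (ℕₚ.<-trans g≤i (s≤s i<j)) g∣j
          x , y , xy-eq = 1-q^-Bézout (suc i) (suc j)
      in coprime-∣ Φi∣v Φj∣w (1ℤ , (λ ()) , x , y ,
           *-cancelʳ (x *ᴾ v +ᴾ y *ᴾ w) 1ᴾ (1-q^-nonzero 1≤g) (begin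
             (x *ᴾ v +ᴾ y *ᴾ w) *ᴾ 1-q^ (gcd (suc i) (suc j))
               ≈⟨ expand x v y w (1-q^ (gcd (suc i) (suc j))) ⟩
             x *ᴾ (v *ᴾ 1-q^ (gcd (suc i) (suc j))) +ᴾ y *ᴾ (w *ᴾ 1-q^ (gcd (suc i) (suc j)))
               ≈⟨ +-cong (*-congʳ x v-eq) (*-congʳ y w-eq) ⟩
             x *ᴾ 1-q^ (suc i) +ᴾ y *ᴾ 1-q^ (suc j)
               ≈⟨ xy-eq ⟩
             1-q^ (gcd (suc i) (suc j))
               ≈⟨ *-identityˡ _ ⟨
             1ᴾ *ᴾ 1-q^ (gcd (suc i) (suc j)) ∎))
      where
      1≤gcd : ∀ {g} → g ∣ suc i → 1 ≤ g
      1≤gcd {zero}  h with () ← ∣ℕ.0∣⇒≡0 h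
      1≤gcd {suc g} h = s≤s z≤n
      expand : ∀ x v y w u → (x *ᴾ v +ᴾ y *ᴾ w) *ᴾ u ≋ x *ᴾ (v *ᴾ u) +ᴾ y *ᴾ (w *ᴾ u)
      expand = solve-∀ polyACR

    -- Exponents are 0 or 1, so each factor divides `Φ i` and inherits pairwise coprimality through
    -- `coprime-∣`; its constant coefficient is a unit because it also divides `1-q^ (suc M)`.
    monomial-∣-next : monomial Φ M (divisorsOf (suc M)) ∣ᴾ 1-q^ (suc M)
    monomial-∣-next = ∏-coprime-∣ M _ (1-q^ suc M)
      (λ i i<M → unit₀-∣ {g = 1-q^ suc M} (divides-next i i<M) (unit₀-1-q^ {suc M} (s≤s z≤n)))
      (λ i j i<j j<M → coprime-∣ (power-∣ i) (power-∣ j) (Φ-coprime i<j j<M))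
      divides-next
      where
      power-∣ : ∀ i → Φ i ^ᴾ divisorsOf (suc M) i ∣ᴾ Φ i
      power-∣ i = ⟦∣⟧-elim {suc i} {suc M} (λ e → Φ i ^ᴾ e ∣ᴾ Φ i)
        (λ _ → ∣ᴾ-respˡ (≋-sym (*-identityʳ (Φ i))) (∣ᴾ-refl {Φ i})) (λ _ → 1∣ᴾ)
      divides-next : ∀ i → i < M → Φ i ^ᴾ divisorsOf (suc M) i ∣ᴾ 1-q^ (suc M)
      divides-next i i<M = ⟦∣⟧-elim {suc i} {suc M} (λ e → Φ i ^ᴾ e ∣ᴾ 1-q^ (suc M))
        (λ h → ∣ᴾ-respˡ (≋-sym (*-identityʳ (Φ i))) (∣ᴾ-trans {h = 1-q^ suc M} (Φ-∣-1-q^ i<M) (1-q^-∣ h))) (λ _ → 1∣ᴾ)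

  cyclotomic : ∀ M → ∃[ Φ ] Cyclotomic Φ M
  -- A default value: products over 0 indices never read the family.
  cyclotomic zero    = (λ _ → 0ᴾ) , λ { (suc k) _ () }
  cyclotomic (suc M) with cyclotomic M
  ... | Φ , cyc with monomial-∣-next {Φ} {M} cyc
  ...   | φ , φ-eq = Φ′ , cyc′
    where
    -- The cofactor φ of the product of the earlier factors in `1-q^ (suc M)` becomes the factor
    -- with index M. The earlier factorisations persist, as M + 1 divides no positive k ≤ M.
    Φ′ : ℕ → Poly
    Φ′ i = if does (i ≟ M) then φ else Φ i

    Φ′-old : ∀ e → monomial Φ′ M e ≋ monomial Φ M e
    Φ′-old e = ∏-cong M λ i i<M → ≋-reflexive (cong (λ b → (if b then φ else Φ i) ^ᴾ e i)
                                                (dec-false (i ≟ M) (ℕₚ.<⇒≢ i<M)))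

    Φ′-new : Φ′ M ≡ φ
    Φ′-new = cong (if_then φ else Φ M) (dec-true (M ≟ M) refl)

    cyc′ : Cyclotomic Φ′ (suc M)
    cyc′ k 1≤k k≤1+M with k ≟ suc M
    ... | yes refl = begin
      1-q^ (suc M)
        ≈⟨ φ-eq ⟨
      φ *ᴾ monomial Φ M (divisorsOf (suc M))
        ≈⟨ *-comm φ _ ⟩
      monomial Φ M (divisorsOf (suc M)) *ᴾ φ
        ≈⟨ *-cong (Φ′-old (divisorsOf (suc M))) (*-identityʳ φ) ⟨
      monomial Φ′ M (divisorsOf (suc M)) *ᴾ φ ^ᴾ 1
        ≡⟨ cong₂ (λ f e → monomial Φ′ M (divisorsOf (suc M)) *ᴾ f ^ᴾ e) Φ′-new (⟦∣⟧-yes (∣ℕ.∣-refl {suc M})) ⟨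
      monomial Φ′ (suc M) (divisorsOf (suc M)) ∎
    ... | no k≢1+M = begin
      1-q^ k
        ≈⟨ cyc k 1≤k (ℕₚ.≤-pred k<1+M) ⟩
      monomial Φ M (divisorsOf k)
        ≈⟨ ≋-trans (*-identityʳ _) (Φ′-old (divisorsOf k)) ⟨
      monomial Φ′ M (divisorsOf k) *ᴾ Φ′ M ^ᴾ 0
        ≡⟨ cong (λ e → monomial Φ′ M (divisorsOf k) *ᴾ Φ′ M ^ᴾ e)
                (⟦∣⟧-no λ h → ℕₚ.<⇒≱ k<1+M (∣ℕ.∣⇒≤ {{ℕ.>-nonZero 1≤k}} h)) ⟨
      monomial Φ′ (suc M) (divisorsOf k) ∎
      where
      k<1+M : k < suc M
      k<1+M = ℕₚ.≤∧≢⇒< k≤1+M k≢1+M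

  [_]! : ℕ → Poly
  [ k ]! = ∏ k λ i → 1-q^ (suc i)

  []!-nonzero : ∀ k → ¬ [ k ]! ≈ 0ᴾ
  []!-nonzero k = ∏-nonzero k λ i → 1-q^-nonzero (s≤s z≤n)

  []!-monomial : ∀ {Φ M} → Cyclotomic Φ M → ∀ k → k ≤ M → [ k ]! ≋ monomial Φ M (λ i → k / suc i)
  []!-monomial {Φ} {M} cyc zero    _   = ≋-sym (monomial-0 M)
    where
    monomial-0 : ∀ k → monomial Φ k (λ i → 0 / suc i) ≋ 1ᴾ
    monomial-0 zero    = ≋-refl
    monomial-0 (suc k) = ≋-trans (*-congˡ (monomial-0 k)) (*-identityʳ 1ᴾ)
  []!-monomial {Φ} {M} cyc (suc k) k<M = begin
    [ k ]! *ᴾ 1-q^ (suc k)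
      ≈⟨ *-cong ([]!-monomial cyc k (ℕₚ.<⇒≤ k<M)) (cyc (suc k) (s≤s z≤n) k<M) ⟩
    monomial Φ M (λ i → k / suc i) *ᴾ monomial Φ M (divisorsOf (suc k))
      ≈⟨ monomial-+ Φ M (λ i → k / suc i) (divisorsOf (suc k)) ⟨
    monomial Φ M (λ i → k / suc i + divisorsOf (suc k) i)
      ≈⟨ monomial-cong Φ M (λ i → suc-/ k (suc i)) ⟨
    monomial Φ M (λ i → suc k / suc i) ∎

-- Finite sums, linear forms and elimination over ℤ

module FormalSums where
  open import Data.Integer as ℤ using (ℤ; +_; 0ℤ; 1ℤ; _+_; _*_; -_)
  import Data.Integer.Properties as ℤₚ
  import Data.Integer.Tactic.RingSolver as ℤ-Solver
  open import Data.List using (List; []; _∷_; map; _++_; length; cartesianProduct)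
  open import Data.List.Properties using (length-map)
  open import Data.List.Membership.Propositional using (_∈_; _∉_)
  open import Data.List.Relation.Unary.All as All using (All; []; _∷_)
  open import Data.List.Relation.Unary.All.Properties using (All¬⇒¬Any)
  open import Data.List.Relation.Unary.Any using (here; there)
  open import Data.List.Relation.Unary.Unique.Propositional using (Unique; []; _∷_)
  open import Data.Nat using (suc; _<_; _≤_; s≤s)
  open import Data.Product using (∃-syntax; _×_; _,_; map₁; map₂)
  open import Data.Sum using (_⊎_; inj₁; inj₂; [_,_]′)
  open import Function using (_∘_)
  open import Relation.Nullary using (yes; no; contradiction)
  open import Relation.Binary using (DecidableEquality)
  open import Relation.Binary.PropositionalEquality
  open ≡-Reasoning

  private variable
    A B : Set

  ∑ : List A → (A → ℤ) → ℤ
  ∑ []       f = 0ℤ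
  ∑ (x ∷ xs) f = f x + ∑ xs f

  ∑-cong : ∀ (xs : List A) {f g} → (∀ x → f x ≡ g x) → ∑ xs f ≡ ∑ xs g
  ∑-cong []       h = refl
  ∑-cong (x ∷ xs) h = cong₂ _+_ (h x) (∑-cong xs h)

  ∑-++ : ∀ (xs ys : List A) f → ∑ (xs ++ ys) f ≡ ∑ xs f + ∑ ys f
  ∑-++ []       ys f = sym (ℤₚ.+-identityˡ _)
  ∑-++ (x ∷ xs) ys f = trans (cong (_+_ (f x)) (∑-++ xs ys f)) (sym (ℤₚ.+-assoc (f x) _ _))

  ∑-map : ∀ (xs : List A) (h : A → B) f → ∑ (map h xs) f ≡ ∑ xs (f ∘ h)
  ∑-map []       h f = refl
  ∑-map (x ∷ xs) h f = cong (_+_ (f (h x))) (∑-map xs h f)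

  ∑-linear : ∀ (xs : List A) a b f g → ∑ xs (λ x → a * f x + b * g x) ≡ a * ∑ xs f + b * ∑ xs g
  ∑-linear []       a b f g = sym (cong₂ _+_ (ℤₚ.*-zeroʳ a) (ℤₚ.*-zeroʳ b))
  ∑-linear (x ∷ xs) a b f g = trans (cong (_+_ (a * f x + b * g x)) (∑-linear xs a b f g))
                                    (regroup a b (f x) (g x) (∑ xs f) (∑ xs g))
    where
    regroup : ∀ a b p q s t → (a * p + b * q) + (a * s + b * t) ≡ a * (p + s) + b * (q + t)
    regroup = ℤ-Solver.solve-∀

  ∑-+ : ∀ (xs : List A) f g → ∑ xs (λ x → f x + g x) ≡ ∑ xs f + ∑ xs g
  ∑-+ xs f g = begin
    ∑ xs (λ x → f x + g x)               ≡⟨ ∑-cong xs (λ x → cong₂ _+_ (ℤₚ.*-identityˡ (f x)) (ℤₚ.*-identityˡ (g x))) ⟨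
    ∑ xs (λ x → 1ℤ * f x + 1ℤ * g x)     ≡⟨ ∑-linear xs 1ℤ 1ℤ f g ⟩
    1ℤ * ∑ xs f + 1ℤ * ∑ xs g            ≡⟨ cong₂ _+_ (ℤₚ.*-identityˡ (∑ xs f)) (ℤₚ.*-identityˡ (∑ xs g)) ⟩
    ∑ xs f + ∑ xs g                      ∎

  ∑-* : ∀ (xs : List A) a f → ∑ xs (λ x → a * f x) ≡ a * ∑ xs f
  ∑-* xs a f = begin
    ∑ xs (λ x → a * f x)                 ≡⟨ ∑-cong xs (λ x → ℤₚ.+-identityʳ (a * f x)) ⟨
    ∑ xs (λ x → a * f x + 0ℤ * f x)      ≡⟨ ∑-linear xs a 0ℤ f f ⟩
    a * ∑ xs f + 0ℤ                      ≡⟨ ℤₚ.+-identityʳ _ ⟩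
    a * ∑ xs f                           ∎

  ∑-0 : ∀ (xs : List A) → ∑ xs (λ _ → 0ℤ) ≡ 0ℤ
  ∑-0 []       = refl
  ∑-0 (x ∷ xs) = trans (ℤₚ.+-identityˡ _) (∑-0 xs)

  ∑-comm : ∀ (xs : List A) (ys : List B) (f : A → B → ℤ) →
           ∑ xs (λ x → ∑ ys (f x)) ≡ ∑ ys (λ y → ∑ xs (λ x → f x y))
  ∑-comm []       ys f = sym (∑-0 ys)
  ∑-comm (x ∷ xs) ys f = trans (cong (_+_ (∑ ys (f x))) (∑-comm xs ys f))
                               (sym (∑-+ ys (f x) λ y → ∑ xs λ x → f x y))

  ∑-cartesianProduct : ∀ (xs : List A) (ys : List B) f →
                       ∑ (cartesianProduct xs ys) f ≡ ∑ xs (λ x → ∑ ys (λ y → f (x , y)))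
  ∑-cartesianProduct []       ys f = refl
  ∑-cartesianProduct (x ∷ xs) ys f =
    trans (∑-++ (map (x ,_) ys) (cartesianProduct xs ys) f)
          (cong₂ _+_ (∑-map ys (x ,_) f) (∑-cartesianProduct xs ys f))

  ∑-nonneg : ∀ (xs : List A) {f} → (∀ x → 0ℤ ℤ.≤ f x) → 0ℤ ℤ.≤ ∑ xs f
  ∑-nonneg []       h = ℤₚ.≤-refl
  ∑-nonneg (x ∷ xs) h = ℤₚ.+-mono-≤ (h x) (∑-nonneg xs h)

  ∑-positive : ∀ {xs : List A} {f y} → (∀ x → 0ℤ ℤ.≤ f x) → y ∈ xs → 0ℤ ℤ.< f y → 0ℤ ℤ.< ∑ xs f
  ∑-positive {xs = x ∷ xs} h (here refl)  0<fy = ℤₚ.+-mono-<-≤ 0<fy (∑-nonneg xs h)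
  ∑-positive {xs = x ∷ xs} h (there y∈xs) 0<fy = ℤₚ.+-mono-≤-< (h x) (∑-positive h y∈xs 0<fy)

  -- A finite formal combination of points, acting on functions by evaluation.
  Form : Set → Set
  Form A = List (ℤ × A)

  ⟦_⟧ : Form A → (A → ℤ) → ℤ
  ⟦ L ⟧ f = ∑ L λ (c , y) → c * f y

  ⟦⟧-cong : ∀ (L : Form A) {f g} → (∀ x → f x ≡ g x) → ⟦ L ⟧ f ≡ ⟦ L ⟧ g
  ⟦⟧-cong L h = ∑-cong L λ (c , y) → cong (c *_) (h y)

  ⟦⟧-linear : ∀ (L : Form A) a b f g → ⟦ L ⟧ (λ x → a * f x + b * g x) ≡ a * ⟦ L ⟧ f + b * ⟦ L ⟧ g
  ⟦⟧-linear L a b f g = trans (∑-cong L λ (c , y) → regroup c a b (f y) (g y)) (∑-linear L a b _ _)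
    where
    regroup : ∀ c a b p q → c * (a * p + b * q) ≡ a * (c * p) + b * (c * q)
    regroup = ℤ-Solver.solve-∀

  ⟦⟧-+ : ∀ (L : Form A) f g → ⟦ L ⟧ (λ x → f x + g x) ≡ ⟦ L ⟧ f + ⟦ L ⟧ g
  ⟦⟧-+ L f g = trans (∑-cong L λ (c , y) → ℤₚ.*-distribˡ-+ c (f y) (g y)) (∑-+ L _ _)

  ⟦⟧-* : ∀ (L : Form A) a f → ⟦ L ⟧ (λ x → a * f x) ≡ a * ⟦ L ⟧ f
  ⟦⟧-* L a f = trans (∑-cong L λ (c , y) → regroup c a (f y)) (∑-* L a _)
    where
    regroup : ∀ c a p → c * (a * p) ≡ a * (c * p)
    regroup = ℤ-Solver.solve-∀

  ⟦⟧-++ : ∀ (L M : Form A) f → ⟦ L ++ M ⟧ f ≡ ⟦ L ⟧ f + ⟦ M ⟧ f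
  ⟦⟧-++ L M f = ∑-++ L M _

  push : (A → B) → Form A → Form B
  push h = map (map₂ h)

  ⟦⟧-push : ∀ (L : Form A) (h : A → B) f → ⟦ push h L ⟧ f ≡ ⟦ L ⟧ (f ∘ h)
  ⟦⟧-push L h f = ∑-map L (map₂ h) _

  -- Operators on different factors of a tensor product commute; this settles the mixed terms of the
  -- commutator in `_⊗_`.
  ⟦⟧-comm : ∀ (L : Form A) (M : Form B) (f : A → B → ℤ) →
            ⟦ L ⟧ (λ x → ⟦ M ⟧ (f x)) ≡ ⟦ M ⟧ (λ y → ⟦ L ⟧ (λ x → f x y))
  ⟦⟧-comm L M f = begin
    ∑ L (λ (c , x) → c * ∑ M (λ (d , y) → d * f x y))
      ≡⟨ ∑-cong L (λ (c , x) → ∑-* M c (λ (d , y) → d * f x y)) ⟨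
    ∑ L (λ (c , x) → ∑ M (λ (d , y) → c * (d * f x y)))
      ≡⟨ ∑-comm L M (λ (c , x) (d , y) → c * (d * f x y)) ⟩
    ∑ M (λ (d , y) → ∑ L (λ (c , x) → c * (d * f x y)))
      ≡⟨ ∑-cong M (λ (d , y) → ⟦⟧-* L d (λ x → f x y)) ⟩
    ∑ M (λ (d , y) → d * ∑ L (λ (c , x) → c * f x y)) ∎

  ⟦⟧-vanish : ∀ {L : Form A} {f} → All (λ (c , y) → f y ≡ 0ℤ) L → ⟦ L ⟧ f ≡ 0ℤ
  ⟦⟧-vanish []                       = refl
  ⟦⟧-vanish {L = (c , _) ∷ _} (e ∷ h) = cong₂ _+_ (trans (cong (c *_) e) (ℤₚ.*-zeroʳ c)) (⟦⟧-vanish h)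

  combine : ℤ → Form A → ℤ → Form A → Form A
  combine a L b M = map (map₁ (a *_)) L ++ map (map₁ (b *_)) M

  ⟦⟧-combine : ∀ a (L : Form A) b M f → ⟦ combine a L b M ⟧ f ≡ a * ⟦ L ⟧ f + b * ⟦ M ⟧ f
  ⟦⟧-combine a L b M f = trans (⟦⟧-++ (map (map₁ (a *_)) L) _ f) (cong₂ _+_ (scaled a L) (scaled b M))
    where
    scaled : ∀ a L → ⟦ map (map₁ (a *_)) L ⟧ f ≡ a * ⟦ L ⟧ f
    scaled a L = trans (∑-map L _ _) (trans (∑-cong L λ (c , y) → ℤₚ.*-assoc a c (f y)) (∑-* L a _))

  module Elimination {A : Set} (_≟_ : DecidableEquality A) where

    δ : A → A → ℤ
    δ x y with x ≟ y
    ... | yes _ = 1ℤ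
    ... | no  _ = 0ℤ

    δ-same : ∀ x → δ x x ≡ 1ℤ
    δ-same x with x ≟ x
    ... | yes _   = refl
    ... | no  x≢x = contradiction refl x≢x

    δ-diff : ∀ {x y} → x ≢ y → δ x y ≡ 0ℤ
    δ-diff {x} {y} x≢y with x ≟ y
    ... | yes x≡y = contradiction x≡y x≢y
    ... | no  _   = refl

    -- The position of the pivot in the list is forgotten; `recover` reassembles a property of the
    -- whole list from the pivot and the remaining forms.
    record Pivot (x : A) (Ls : List (Form A)) : Set₁ where
      field
        form    : Form A
        others  : List (Form A)
        nonzero : ⟦ form ⟧ (δ x) ≢ 0ℤ
        len     : length Ls ≡ suc (length others)
        recover : ∀ {P : Form A → Set} → P form → All P others → All P Ls

    findPivot : ∀ x Ls → All (λ L → ⟦ L ⟧ (δ x) ≡ 0ℤ) Ls ⊎ Pivot x Ls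
    findPivot x []       = inj₁ []
    findPivot x (L ∷ Ls) with ⟦ L ⟧ (δ x) ℤ.≟ 0ℤ | findPivot x Ls
    ... | no ≢0  | _      = inj₂ record { form = L ; others = Ls ; nonzero = ≢0 ; len = refl ; recover = _∷_ }
    ... | yes ≡0 | inj₁ h = inj₁ (≡0 ∷ h)
    ... | yes ≡0 | inj₂ p = inj₂ record
      { form = form ; others = L ∷ others ; nonzero = nonzero ; len = cong suc len
      ; recover = λ { Pf (PL ∷ h) → PL ∷ recover Pf h } }
      where open Pivot p

    -- A pivot L, with L(δ x) ≠ 0, is used to eliminate x from the other forms; a solution g of the
    -- reduced system on xs extends to L(δ x) g - L(g) δ x.
    kernel : ∀ {xs : List A} → Unique xs → ∀ (Ls : List (Form A)) → length Ls < length xs →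
             ∃[ f ] (∃[ y ] y ∈ xs × f y ≢ 0ℤ) × (∀ y → y ∉ xs → f y ≡ 0ℤ) × All (λ (L : Form A) → ⟦ L ⟧ f ≡ 0ℤ) Ls
    kernel {x ∷ xs} (x∉xs ∷ u) Ls (s≤s lt) with findPivot x Ls
    ... | inj₁ zeros =
      δ x , (x , here refl , λ e → contradiction (trans (sym (δ-same x)) e) λ ()) ,
      (λ y y∉ → δ-diff λ { refl → y∉ (here refl) }) , zeros
    ... | inj₂ p with kernel u (map (λ L → combine (⟦ Pivot.form p ⟧ (δ x)) L (- ⟦ L ⟧ (δ x)) (Pivot.form p)) (Pivot.others p))
                     (subst (_< length xs) (sym (length-map _ (Pivot.others p))) (subst (_≤ length xs) (Pivot.len p) lt))
    ...   | g , (y , y∈xs , gy≢0) , g-supp , g-zeros =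
      f , (y , there y∈xs , fy≢0) , f-supp , recover form-zero (All.map (λ {L} → other-zero {L}) (unmap others g-zeros))
      where
      open Pivot p
      a b : ℤ
      a = ⟦ form ⟧ (δ x)
      b = ⟦ form ⟧ g
      f : A → ℤ
      f z = a * g z + (- b) * δ x z
      unmap : ∀ {P : Form A → Set} {h : Form A → Form A} Ls → All P (map h Ls) → All (P ∘ h) Ls
      unmap []       []      = []
      unmap (_ ∷ Ls) (q ∷ h) = q ∷ unmap Ls h
      -- As y lies in xs and x does not, δ x y vanishes, and f y is the product a g y of non-zero
      -- integers.
      fy≢0 : f y ≢ 0ℤ
      fy≢0 e = [ nonzero , gy≢0 ]′ (ℤₚ.i*j≡0⇒i≡0∨j≡0 a (begin
        a * g y                      ≡⟨ ℤₚ.+-identityʳ _ ⟨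
        a * g y + 0ℤ                 ≡⟨ cong (_+_ (a * g y)) (ℤₚ.*-zeroʳ (- b)) ⟨
        a * g y + (- b) * 0ℤ         ≡⟨ cong (λ d → a * g y + (- b) * d) (δ-diff λ { refl → All¬⇒¬Any x∉xs y∈xs }) ⟨
        f y                          ≡⟨ e ⟩
        0ℤ                           ∎))
      f-supp : ∀ z → z ∉ x ∷ xs → f z ≡ 0ℤ
      f-supp z z∉ = begin
        a * g z + (- b) * δ x z    ≡⟨ cong₂ (λ s t → a * s + (- b) * t) (g-supp z (z∉ ∘ there)) (δ-diff λ { refl → z∉ (here refl) }) ⟩
        a * 0ℤ + (- b) * 0ℤ        ≡⟨ cong₂ _+_ (ℤₚ.*-zeroʳ a) (ℤₚ.*-zeroʳ (- b)) ⟩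
        0ℤ                         ∎
      form-zero : ⟦ form ⟧ f ≡ 0ℤ
      form-zero = trans (⟦⟧-linear form a (- b) g (δ x)) (cancel a b)
        where
        cancel : ∀ a b → a * b + (- b) * a ≡ 0ℤ
        cancel = ℤ-Solver.solve-∀
      other-zero : ∀ {L} → ⟦ combine a L (- ⟦ L ⟧ (δ x)) form ⟧ g ≡ 0ℤ → ⟦ L ⟧ f ≡ 0ℤ
      other-zero {L} e = begin
        ⟦ L ⟧ f                                          ≡⟨ ⟦⟧-linear L a (- b) g (δ x) ⟩
        a * ⟦ L ⟧ g + (- b) * ⟦ L ⟧ (δ x)                ≡⟨ cong (_+_ (a * ⟦ L ⟧ g)) (swap b (⟦ L ⟧ (δ x))) ⟩
        a * ⟦ L ⟧ g + (- ⟦ L ⟧ (δ x)) * b                ≡⟨ ⟦⟧-combine a L (- ⟦ L ⟧ (δ x)) form g ⟨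
        ⟦ combine a L (- ⟦ L ⟧ (δ x)) form ⟧ g           ≡⟨ e ⟩
        0ℤ                                               ∎
        where
        swap : ∀ b c → (- b) * c ≡ (- c) * b
        swap = ℤ-Solver.solve-∀

-- Representations of sl₂, their tensor products, and monotonicity of weight multiplicities

module Ladders where
  open FormalSums
  open import Data.Integer as ℤ using (ℤ; +_; 0ℤ; _+_; _*_; -_)
  import Data.Integer.Properties as ℤₚ
  import Data.Integer.Tactic.RingSolver as ℤ-Solver
  open import Data.List using (List; map; _++_; length; cartesianProduct; filter)
  open import Data.List.Properties using (length-map)
  open import Data.List.Membership.Propositional using (_∈_)
  open import Data.List.Membership.Propositional.Properties
    using (∈-filter⁺; ∈-filter⁻; ∈-cartesianProduct⁺)
  open import Data.List.Relation.Unary.All as All using (All)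
  import Data.List.Relation.Unary.All.Properties as Allₚ
  open import Data.List.Relation.Unary.Unique.Propositional using (Unique)
  import Data.List.Relation.Unary.Unique.Propositional.Properties as Uniqueₚ
  open import Data.Nat as ℕ using (ℕ; suc; _<_; _≤_; z≤n)
  import Data.Nat.Properties as ℕₚ
  open import Data.Product using (_×_; _,_; proj₁; proj₂)
  open import Data.Product.Properties using (≡-dec)
  open import Data.Sum using (inj₁; inj₂; [_,_]′)
  open import Relation.Nullary using (yes; no; contradiction)
  open import Relation.Binary using (DecidableEquality)
  open import Relation.Binary.PropositionalEquality

  square-nonneg : ∀ a → 0ℤ ℤ.≤ a * a
  square-nonneg (+ n)      = subst (0ℤ ℤ.≤_) (ℤₚ.pos-* n n) (ℤ.+≤+ z≤n)
  square-nonneg ℤ.-[1+ n ] = ℤ.+≤+ z≤n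

  square-positive : ∀ {a} → a ≢ 0ℤ → 0ℤ ℤ.< a * a
  square-positive {a} a≢0 = ℤₚ.≤∧≢⇒< (square-nonneg a) λ e → [ a≢0 , a≢0 ]′ (ℤₚ.i*j≡0⇒i≡0∨j≡0 a (sym e))

  *-positive : ∀ {a b} → 0ℤ ℤ.< a → 0ℤ ℤ.< b → 0ℤ ℤ.< a * b
  *-positive {a} {b} 0<a 0<b = subst (ℤ._< a * b) (ℤₚ.*-zeroʳ a) (ℤₚ.*-monoˡ-<-pos a {{ℤ.positive 0<a}} 0<b)

  *-nonneg : ∀ {a b} → 0ℤ ℤ.≤ a → 0ℤ ℤ.≤ b → 0ℤ ℤ.≤ a * b
  *-nonneg {a} {b} 0≤a 0≤b = subst (ℤ._≤ a * b) (ℤₚ.*-zeroʳ a) (ℤₚ.*-monoˡ-≤-nonNeg a {{ℤ.nonNegative 0≤a}} 0≤b)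

  -- A representation of sl₂ on the functions A → ℤ: up and down are the raising and
  -- lowering operators, given by their rows and adjoint for a positive diagonal inner
  -- product, and rank - degree / 2 is half the weight.
  record Ladder (A : Set) : Set where
    field
      _≟_        : DecidableEquality A
      elements   : List A
      unique     : Unique elements
      complete   : ∀ x → x ∈ elements
      weight     : A → ℤ
      weight-pos : ∀ x → 0ℤ ℤ.< weight x
      rank       : A → ℕ
      degree     : ℕ
      up down    : A → Form A
      up-rank    : ∀ x → All (λ (_ , y) → suc (rank y) ≡ rank x) (up x)
      down-rank  : ∀ x → All (λ (_ , y) → rank y ≡ suc (rank x)) (down x)
      adjoint    : ∀ f g → ∑ elements (λ x → weight x * (g x * ⟦ up x ⟧ f)) ≡
                           ∑ elements (λ x → weight x * (f x * ⟦ down x ⟧ g))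
      commutator : ∀ f x → ⟦ up x ⟧ (λ y → ⟦ down y ⟧ f) ≡
                           ⟦ down x ⟧ (λ y → ⟦ up y ⟧ f) + (+ 2 * + rank x + - + degree) * f x

    level : ℕ → List A
    level r = filter (λ x → rank x ℕ.≟ r) elements

    count : ℕ → ℕ
    count r = length (level r)

    inner : (A → ℤ) → (A → ℤ) → ℤ
    inner f g = ∑ elements λ x → weight x * (f x * g x)

    inner-nonneg : ∀ f → 0ℤ ℤ.≤ inner f f
    inner-nonneg f = ∑-nonneg elements λ x → *-nonneg (ℤₚ.<⇒≤ (weight-pos x)) (square-nonneg (f x))

    inner-positive : ∀ {f y} → f y ≢ 0ℤ → 0ℤ ℤ.< inner f f
    inner-positive {f} {y} fy≢0 = ∑-positive
      (λ x → *-nonneg (ℤₚ.<⇒≤ (weight-pos x)) (square-nonneg (f x)))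
      (complete y) (*-positive (weight-pos y) (square-positive fy≢0))

    raise lower : (A → ℤ) → A → ℤ
    raise f x = ⟦ up x ⟧ f
    lower f x = ⟦ down x ⟧ f

    Supported : ℕ → (A → ℤ) → Set
    Supported r f = ∀ y → rank y ≢ r → f y ≡ 0ℤ

    -- By adjointness the two norms are ⟨f, raise (lower f)⟩ and ⟨f, lower (raise f)⟩; the
    -- commutator acts on functions of rank r as the scalar 2r - degree.
    energy : ∀ {r f} → Supported r f →
             inner (lower f) (lower f) ≡ inner (raise f) (raise f) + (+ 2 * + r + - + degree) * inner f f
    energy {r} {f} supp = begin
      inner (lower f) (lower f)                      ≡⟨ adjoint (lower f) f ⟨
      inner f (raise (lower f))                      ≡⟨ ∑-cong elements termwise ⟩
      ∑ elements (λ x → weight x * (f x * lower (raise f) x) + h * (weight x * (f x * f x)))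
        ≡⟨ ∑-+ elements _ (λ x → h * (weight x * (f x * f x))) ⟩
      inner f (lower (raise f)) + ∑ elements (λ x → h * (weight x * (f x * f x)))
        ≡⟨ cong₂ _+_ (sym (adjoint f (raise f))) (∑-* elements h _) ⟩
      inner (raise f) (raise f) + h * inner f f      ∎
      where
      open ≡-Reasoning
      h : ℤ
      h = + 2 * + r + - + degree
      expand : ∀ w a b h → w * (a * (b + h * a)) ≡ w * (a * b) + h * (w * (a * a))
      expand = ℤ-Solver.solve-∀
      -- Off rank r the function vanishes, so the scalar belonging to `rank x` may be replaced by
      -- the one belonging to r.
      eigen : ∀ x → (+ 2 * + rank x + - + degree) * f x ≡ h * f x
      eigen x with rank x ℕ.≟ r
      ... | yes refl = refl
      ... | no  ≢r   = trans (annihilate (+ 2 * + rank x + - + degree)) (sym (annihilate h))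
        where
        annihilate : ∀ a → a * f x ≡ 0ℤ
        annihilate a = trans (cong (a *_) (supp x ≢r)) (ℤₚ.*-zeroʳ a)
      termwise : ∀ x → weight x * (f x * raise (lower f) x) ≡
                       weight x * (f x * lower (raise f) x) + h * (weight x * (f x * f x))
      termwise x = trans (cong (λ c → weight x * (f x * c)) (trans (commutator f x) (cong (_+_ (lower (raise f) x)) (eigen x))))
                         (expand (weight x) (f x) (lower (raise f) x) h)

    inner-zero : ∀ {f} → (∀ x → f x ≡ 0ℤ) → inner f f ≡ 0ℤ
    inner-zero {f} f≡0 = trans (∑-cong elements λ x →
        trans (cong (λ c → weight x * (c * f x)) (f≡0 x)) (ℤₚ.*-zeroʳ (weight x))) (∑-0 elements)

    -- A non-zero f in the kernel would satisfy ‖lower f‖² = (2r - degree) ‖f‖² < 0.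
    raise-injective : ∀ {r f} → 2 ℕ.* r < degree → Supported r f → (∀ x → raise f x ≡ 0ℤ) → ∀ y → f y ≡ 0ℤ
    raise-injective {r} {f} 2r<deg supp raise≡0 y with f y ℤ.≟ 0ℤ
    ... | yes e = e
    ... | no  fy≢0 = contradiction (inner-nonneg (lower f)) (ℤₚ.<⇒≱ (begin-strict
      inner (lower f) (lower f)                    ≡⟨ energy supp ⟩
      inner (raise f) (raise f) + h * inner f f    ≡⟨ cong (_+ (h * inner f f)) (inner-zero raise≡0) ⟩
      0ℤ + h * inner f f                           ≡⟨ ℤₚ.+-identityˡ _ ⟩
      h * inner f f                                <⟨ ℤₚ.*-monoʳ-<-pos (inner f f) {{ℤ.positive (inner-positive {f} fy≢0)}} h<0 ⟩
      0ℤ * inner f f                               ≡⟨⟩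
      0ℤ                                           ∎))
      where
      open ℤₚ.≤-Reasoning
      h : ℤ
      h = + 2 * + r + - + degree
      h<0 : h ℤ.< 0ℤ
      h<0 = subst (h ℤ.<_) (ℤₚ.+-inverseʳ (+ degree))
              (ℤₚ.+-monoˡ-< (- + degree) (subst (ℤ._< + degree) (ℤₚ.pos-* 2 r) (ℤ.+<+ 2r<deg)))

    -- A non-zero f in the kernel would satisfy 0 = ‖raise f‖² + (2r - degree) ‖f‖², where the
    -- second term is positive and the first non-negative.
    lower-injective : ∀ {r f} → degree < 2 ℕ.* r → Supported r f → (∀ x → lower f x ≡ 0ℤ) → ∀ y → f y ≡ 0ℤ
    lower-injective {r} {f} deg<2r supp lower≡0 y with f y ℤ.≟ 0ℤ
    ... | yes e = e
    ... | no  fy≢0 = contradiction (trans (sym (energy supp)) (inner-zero lower≡0))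
      (≢-sym (ℤₚ.<⇒≢ (ℤₚ.+-mono-≤-< (inner-nonneg (raise f)) (*-positive 0<h (inner-positive {f} fy≢0)))))
      where
      h : ℤ
      h = + 2 * + r + - + degree
      0<h : 0ℤ ℤ.< h
      0<h = subst (ℤ._< h) (ℤₚ.+-inverseʳ (+ degree))
              (ℤₚ.+-monoˡ-< (- + degree) (subst (+ degree ℤ.<_) (ℤₚ.pos-* 2 r) (ℤ.+<+ deg<2r)))

    level-unique : ∀ r → Unique (level r)
    level-unique r = Uniqueₚ.filter⁺ (λ x → rank x ℕ.≟ r) unique

    ∈-level : ∀ {x r} → rank x ≡ r → x ∈ level r
    ∈-level {x} {r} e = ∈-filter⁺ (λ x → rank x ℕ.≟ r) (complete x) e

    -- An operator T from rank r to rank s that is injective on rank r shows count r ≤ count s,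
    -- since fewer than count r linear conditions on functions of rank r have a common non-zero solution.
    injective⇒count≤ : ∀ r s (T : A → Form A) →
      (∀ x → rank x ≢ s → All (λ (_ , z) → rank z ≢ r) (T x)) →
      (∀ {f} → Supported r f → (∀ x → ⟦ T x ⟧ f ≡ 0ℤ) → ∀ y → f y ≡ 0ℤ) →
      count r ≤ count s
    injective⇒count≤ r s T T-rank injective with ℕₚ.≤-<-connex (count r) (count s)
    ... | inj₁ ≤ = ≤
    ... | inj₂ > with Elimination.kernel _≟_ (level-unique r) (map T (level s))
                        (subst (_< count r) (sym (length-map T (level s))) >)
    ...   | f , (y , _ , fy≢0) , f-supp , zeros = contradiction (injective {f} supp Tf≡0 y) fy≢0
      where
      supp : Supported r f
      supp y ≢r = f-supp y λ y∈ → ≢r (proj₂ (∈-filter⁻ (λ x → rank x ℕ.≟ r) {xs = elements} y∈))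
      Tf≡0 : ∀ x → ⟦ T x ⟧ f ≡ 0ℤ
      Tf≡0 x with rank x ℕ.≟ s
      ... | yes e  = All.lookup (Allₚ.map⁻ zeros) (∈-level e)
      ... | no  ≢s = ⟦⟧-vanish (All.map (λ {(_ , z)} → supp z) (T-rank x ≢s))

    count-increasing : ∀ r → 2 ℕ.* r < degree → count r ≤ count (suc r)
    count-increasing r 2r<deg = injective⇒count≤ r (suc r) up
      (λ x ≢s → All.map (λ e e′ → ≢s (trans (sym e) (cong suc e′))) (up-rank x))
      (raise-injective 2r<deg)

    count-decreasing : ∀ r → degree < 2 ℕ.* suc r → count (suc r) ≤ count r
    count-decreasing r deg<2r = injective⇒count≤ (suc r) r down
      (λ x ≢s → All.map (λ e e′ → ≢s (ℕₚ.suc-injective (trans (sym e) e′))) (down-rank x))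
      (lower-injective deg<2r)

  push⁺ : ∀ {A B : Set} {P : ℤ × B → Set} {h : A → B} {L} → All (λ (c , y) → P (c , h y)) L → All P (push h L)
  push⁺ = Allₚ.map⁺

  infixr 7 _⊗_
  -- The operators act by the Leibniz rule, E ⊗ 1 + 1 ⊗ E, and the inner product is the product one.
  -- Each factor is centred at half its degree, so the tensor product is centred at half the sum of
  -- the degrees.
  _⊗_ : ∀ {A B} → Ladder A → Ladder B → Ladder (A × B)
  _⊗_ {A} {B} V W = record
    { _≟_        = ≡-dec V._≟_ W._≟_
    ; elements   = cartesianProduct V.elements W.elements
    ; unique     = Uniqueₚ.cartesianProduct⁺ V.unique W.unique
    ; complete   = λ (x , y) → ∈-cartesianProduct⁺ (V.complete x) (W.complete y)
    ; weight     = λ (x , y) → V.weight x * W.weight y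
    ; weight-pos = λ (x , y) → *-positive (V.weight-pos x) (W.weight-pos y)
    ; rank       = λ (x , y) → V.rank x ℕ.+ W.rank y
    ; degree     = V.degree ℕ.+ W.degree
    ; up         = up
    ; down       = down
    ; up-rank    = λ (x , y) → Allₚ.++⁺
        (push⁺ (All.map (cong (ℕ._+ W.rank y)) (V.up-rank x)))
        (push⁺ (All.map (λ {(_ , z)} e → trans (sym (ℕₚ.+-suc (V.rank x) (W.rank z))) (cong (V.rank x ℕ.+_) e)) (W.up-rank y)))
    ; down-rank  = λ (x , y) → Allₚ.++⁺
        (push⁺ (All.map (cong (ℕ._+ W.rank y)) (V.down-rank x)))
        (push⁺ (All.map (λ {(_ , z)} e → trans (cong (V.rank x ℕ.+_) e) (ℕₚ.+-suc (V.rank x) (W.rank y))) (W.down-rank y)))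
    ; adjoint    = adjoint
    ; commutator = λ { f (x , y) → commutator f x y }
    }
    where
    open ≡-Reasoning
    module V = Ladder V
    module W = Ladder W

    extend : (A → Form A) → (B → Form B) → A × B → Form (A × B)
    extend S T (x , y) = push (_, y) (S x) ++ push (x ,_) (T y)

    up down : A × B → Form (A × B)
    up   = extend V.up W.up
    down = extend V.down W.down

    extend-apply : ∀ S T x y f →
      ⟦ extend S T (x , y) ⟧ f ≡ ⟦ S x ⟧ (λ x → f (x , y)) + ⟦ T y ⟧ (λ y → f (x , y))
    extend-apply S T x y f = trans (⟦⟧-++ (push (_, y) (S x)) (push (x ,_) (T y)) f)
                                   (cong₂ _+_ (⟦⟧-push (S x) (_, y) f) (⟦⟧-push (T y) (x ,_) f))

    compose : ∀ S T S′ T′ x y f →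
      ⟦ extend S T (x , y) ⟧ (λ z → ⟦ extend S′ T′ z ⟧ f) ≡
      (⟦ S x ⟧ (λ x → ⟦ S′ x ⟧ (λ x → f (x , y))) + ⟦ S x ⟧ (λ x → ⟦ T′ y ⟧ (λ y → f (x , y)))) +
      (⟦ T y ⟧ (λ y → ⟦ S′ x ⟧ (λ x → f (x , y))) + ⟦ T y ⟧ (λ y → ⟦ T′ y ⟧ (λ y → f (x , y))))
    compose S T S′ T′ x y f = trans (extend-apply S T x y _) (cong₂ _+_
      (trans (⟦⟧-cong (S x) (λ x → extend-apply S′ T′ x y f)) (⟦⟧-+ (S x) _ _))
      (trans (⟦⟧-cong (T y) (λ y → extend-apply S′ T′ x y f)) (⟦⟧-+ (T y) _ _)))

    -- Of the four composites on either side, the two within one factor differ by that factor's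
    -- commutator, while the two mixed ones are interchanged by `⟦⟧-comm`. The two scalars add up to
    -- the one of the total rank and degree.
    commutator : ∀ f x y → ⟦ up (x , y) ⟧ (λ z → ⟦ down z ⟧ f) ≡
      ⟦ down (x , y) ⟧ (λ z → ⟦ up z ⟧ f) +
      (+ 2 * + (V.rank x ℕ.+ W.rank y) + - + (V.degree ℕ.+ W.degree)) * f (x , y)
    commutator f x y = begin
      ⟦ up (x , y) ⟧ (λ z → ⟦ down z ⟧ f)
        ≡⟨ compose V.up W.up V.down W.down x y f ⟩
      _ ≡⟨ cong₂ _+_
             (cong₂ _+_ (V.commutator (λ x → f (x , y)) x) (⟦⟧-comm (V.up x) (W.down y) λ x y → f (x , y)))
             (cong₂ _+_ (⟦⟧-comm (W.up y) (V.down x) λ y x → f (x , y)) (W.commutator (λ y → f (x , y)) y)) ⟩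
      _ ≡⟨ regroup VV WV VW WW (+ V.rank x) (+ W.rank y) (+ V.degree) (+ W.degree) (f (x , y)) ⟩
      _ ≡⟨ cong (λ c → VV + VW + (WV + WW) + c * f (x , y)) (sym (cong₂ (λ r d → + 2 * r + - d)
             (ℤₚ.pos-+ (V.rank x) (W.rank y)) (ℤₚ.pos-+ V.degree W.degree))) ⟩
      _ ≡⟨ cong (_+ ((+ 2 * + (V.rank x ℕ.+ W.rank y) + - + (V.degree ℕ.+ W.degree)) * f (x , y))) (sym (compose V.down W.down V.up W.up x y f)) ⟩
      ⟦ down (x , y) ⟧ (λ z → ⟦ up z ⟧ f) +
        (+ 2 * + (V.rank x ℕ.+ W.rank y) + - + (V.degree ℕ.+ W.degree)) * f (x , y) ∎
      where
      VV VW WV WW : ℤ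
      VV = ⟦ V.down x ⟧ (λ x → ⟦ V.up x ⟧ (λ x → f (x , y)))
      VW = ⟦ V.down x ⟧ (λ x → ⟦ W.up y ⟧ (λ y → f (x , y)))
      WV = ⟦ W.down y ⟧ (λ y → ⟦ V.up x ⟧ (λ x → f (x , y)))
      WW = ⟦ W.down y ⟧ (λ y → ⟦ W.up y ⟧ (λ y → f (x , y)))
      regroup : ∀ a b c d r s D E t →
        ((a + (+ 2 * r + - D) * t) + b) + (c + (d + (+ 2 * s + - E) * t)) ≡
        ((a + c) + (b + d)) + (+ 2 * (r + s) + - (D + E)) * t
      regroup = ℤ-Solver.solve-∀

    -- Summed along one factor, with the other one fixed, this is the adjointness of V or W.
    adjoint : ∀ f g →
      ∑ (cartesianProduct V.elements W.elements) (λ z → V.weight (proj₁ z) * W.weight (proj₂ z) * (g z * ⟦ up z ⟧ f)) ≡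
      ∑ (cartesianProduct V.elements W.elements) (λ z → V.weight (proj₁ z) * W.weight (proj₂ z) * (f z * ⟦ down z ⟧ g))
    adjoint f g = begin
      _ ≡⟨ split V.up W.up g f ⟩
      _ ≡⟨ cong₂ _+_
             (∑-cong W.elements λ y → cong (W.weight y *_) (V.adjoint (λ x → f (x , y)) (λ x → g (x , y))))
             (∑-cong V.elements λ x → cong (V.weight x *_) (W.adjoint (λ y → f (x , y)) (λ y → g (x , y)))) ⟩
      _ ≡⟨ split V.down W.down f g ⟨
      _ ∎
      where
      split : ∀ S T (g f : A × B → ℤ) →
        ∑ (cartesianProduct V.elements W.elements)
          (λ z → V.weight (proj₁ z) * W.weight (proj₂ z) * (g z * ⟦ extend S T z ⟧ f)) ≡
        ∑ W.elements (λ y → W.weight y * ∑ V.elements (λ x → V.weight x * (g (x , y) * ⟦ S x ⟧ (λ x → f (x , y))))) +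
        ∑ V.elements (λ x → V.weight x * ∑ W.elements (λ y → W.weight y * (g (x , y) * ⟦ T y ⟧ (λ y → f (x , y)))))
      split S T g f = begin
        _ ≡⟨ ∑-cartesianProduct V.elements W.elements _ ⟩
        _ ≡⟨ ∑-cong V.elements (λ x → trans (∑-cong W.elements λ y →
               trans (cong (λ c → V.weight x * W.weight y * (g (x , y) * c)) (extend-apply S T x y f))
                     (distribute (V.weight x) (W.weight y) (g (x , y)) (⟦ S x ⟧ λ x → f (x , y)) (⟦ T y ⟧ λ y → f (x , y))))
               (trans (∑-+ W.elements (λ y → W.weight y * s x y) (λ y → V.weight x * t x y))
                      (cong (_+_ (∑ W.elements λ y → W.weight y * s x y)) (∑-* W.elements (V.weight x) (t x))))) ⟩
        _ ≡⟨ ∑-+ V.elements (λ x → ∑ W.elements λ y → W.weight y * s x y) (λ x → V.weight x * ∑ W.elements (t x)) ⟩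
        _ ≡⟨ cong (_+ (∑ V.elements λ x → V.weight x * ∑ W.elements (t x)))
               (trans (∑-comm V.elements W.elements (λ x y → W.weight y * s x y))
                      (∑-cong W.elements λ y → ∑-* V.elements (W.weight y) (λ x → s x y))) ⟩
        _ ∎
        where
        s t : A → B → ℤ
        s x y = V.weight x * (g (x , y) * ⟦ S x ⟧ (λ x → f (x , y)))
        t x y = W.weight y * (g (x , y) * ⟦ T y ⟧ (λ y → f (x , y)))
        distribute : ∀ v w g a b → v * w * (g * (a + b)) ≡ w * (v * (g * a)) + v * (w * (g * b))
        distribute = ℤ-Solver.solve-∀

-- Exterior powers of irreducible representations, in a basis of words

module Words where
  open FormalSums
  open Ladders
  open import Data.Integer as ℤ using (ℤ; +_; 0ℤ; 1ℤ; _+_; _*_; -_)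
  import Data.Integer.Properties as ℤₚ
  import Data.Integer.Tactic.RingSolver as ℤ-Solver
  open import Data.List using (List; []; _∷_; map; _++_)
  open import Data.List.Membership.Propositional using (_∈_)
  open import Data.List.Membership.Propositional.Properties using (∈-map⁺; ∈-map⁻; ∈-++⁺ˡ; ∈-++⁺ʳ)
  open import Data.List.Relation.Unary.All as All using (All; []; _∷_)
  import Data.List.Relation.Unary.All.Properties as Allₚ
  open import Data.List.Relation.Unary.AllPairs using ([]; _∷_)
  open import Data.List.Relation.Unary.Any using (here)
  open import Data.List.Relation.Unary.Unique.Propositional using (Unique)
  import Data.List.Relation.Unary.Unique.Propositional.Properties as Uniqueₚ
  open import Data.Nat as ℕ using (ℕ; zero; suc; _<_; z≤n; s≤s)
  import Data.Nat.Properties as ℕₚ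
  open import Data.Product using (∃-syntax; _×_; _,_)
  open import Function using (_∘_)
  open import Relation.Nullary using (¬_; yes; no)
  open import Relation.Nullary.Decidable using (map′)
  open import Relation.Binary using (DecidableEquality)
  open import Relation.Binary.PropositionalEquality
  open ≡-Reasoning

  infixr 5 I∷_ O∷_
  -- Words with k letters I and l letters O, that is, k-subsets of k + l positions. The indices make
  -- the number of remaining letters of each kind available to later formulas.
  data Word : ℕ → ℕ → Set where
    []  : Word 0 0
    I∷_ : ∀ {k l} → Word k l → Word (suc k) l
    O∷_ : ∀ {k l} → Word k l → Word k (suc l)

  private variable
    k l : ℕ

  I-injective : ∀ {S T : Word k l} → I∷ S ≡ I∷ T → S ≡ T
  I-injective refl = refl

  O-injective : ∀ {S T : Word k l} → O∷ S ≡ O∷ T → S ≡ T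
  O-injective refl = refl

  _≟ʷ_ : DecidableEquality (Word k l)
  []     ≟ʷ []     = yes refl
  (I∷ S) ≟ʷ (I∷ T) = map′ (cong I∷_) I-injective (S ≟ʷ T)
  (I∷ S) ≟ʷ (O∷ T) = no λ ()
  (O∷ S) ≟ʷ (I∷ T) = no λ ()
  (O∷ S) ≟ʷ (O∷ T) = map′ (cong O∷_) O-injective (S ≟ʷ T)

  words : ∀ k l → List (Word k l)
  words zero    zero    = [] ∷ []
  words (suc k) zero    = map I∷_ (words k zero)
  words zero    (suc l) = map O∷_ (words zero l)
  words (suc k) (suc l) = map I∷_ (words k (suc l)) ++ map O∷_ (words (suc k) l)

  words-complete : ∀ (S : Word k l) → S ∈ words k l
  words-complete []                   = here refl
  words-complete {l = zero}  (I∷ S)   = ∈-map⁺ I∷_ (words-complete S)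
  words-complete {l = suc _} (I∷ S)   = ∈-++⁺ˡ (∈-map⁺ I∷_ (words-complete S))
  words-complete {k = zero}  (O∷ S)   = ∈-map⁺ O∷_ (words-complete S)
  words-complete {k = suc _} (O∷ S)   = ∈-++⁺ʳ _ (∈-map⁺ O∷_ (words-complete S))

  words-unique : ∀ k l → Unique (words k l)
  words-unique zero    zero    = [] ∷ []
  words-unique (suc k) zero    = Uniqueₚ.map⁺ I-injective (words-unique k zero)
  words-unique zero    (suc l) = Uniqueₚ.map⁺ O-injective (words-unique zero l)
  words-unique (suc k) (suc l) = Uniqueₚ.++⁺
    (Uniqueₚ.map⁺ I-injective (words-unique k (suc l)))
    (Uniqueₚ.map⁺ O-injective (words-unique (suc k) l))
    λ (S∈I , S∈O) → disjoint (∈-map⁻ I∷_ S∈I) (∈-map⁻ O∷_ S∈O)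
    where
    disjoint : ∀ {S} → (∃[ T ] T ∈ words k (suc l) × S ≡ I∷ T) → ¬ (∃[ T ] T ∈ words (suc k) l × S ≡ O∷ T)
    disjoint (_ , _ , refl) (_ , _ , ())

  -- Counts the pairs of an O and a later I: the index `k` is the number of letters I behind the
  -- leading O.
  inversions : Word k l → ℕ
  inversions []               = 0
  inversions (I∷ S)           = inversions S
  inversions (O∷_ {k = k} S)  = k ℕ.+ inversions S

  -- The k-th exterior power of the irreducible representation of dimension k + l. A word
  -- is a wedge of basis vectors, with I at the positions that occur; since operators move
  -- one I to a neighbouring position, no signs arise. The parameter t is the position of
  -- the first letter; of t + n + 2 positions, t and t + 1 are linked by (t + 1) (n + 1).
  swapUp : Word k l → Form (Word k (suc l))
  swapUp (I∷ S) = (1ℤ , I∷ O∷ S) ∷ []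
  swapUp _      = []

  up : Word k l → Form (Word k l)
  up []     = []
  up (I∷ S) = push I∷_ (up S)
  up (O∷ S) = swapUp S ++ push O∷_ (up S)

  -- As `up` has coefficients 1, the commutator on a single basis vector is a difference of
  -- neighbouring links. Here (t + 1)(n + 1) - t (n + 2) = n + 1 - t is linear in the position t, as
  -- weights are.
  link : ℕ → ℕ → ℤ
  link t n = + suc t * + suc n

  swapDown : ℕ → Word k l → Form (Word (suc k) l)
  swapDown t (O∷_ {k} {l} S) = (link t (k ℕ.+ l) , O∷ I∷ S) ∷ []
  swapDown t _               = []

  down : ℕ → Word k l → Form (Word k l)
  down t []     = []
  down t (I∷ S) = swapDown t S ++ push I∷_ (down (suc t) S)
  down t (O∷ S) = push O∷_ (down (suc t) S)

  up-inversions : ∀ (S : Word k l) → All (λ (_ , T) → suc (inversions T) ≡ inversions S) (up S)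
  up-inversions []     = []
  up-inversions (I∷ S) = push⁺ (up-inversions S)
  up-inversions (O∷_ {k} S) = Allₚ.++⁺ (swap S) (push⁺ (All.map
      (λ {(_ , T)} e → trans (sym (ℕₚ.+-suc k (inversions T))) (cong (k ℕ.+_) e)) (up-inversions S)))
    where
    swap : ∀ {k l} (S : Word k l) → All (λ (_ , T) → suc (inversions T) ≡ k ℕ.+ inversions S) (swapUp S)
    swap []     = []
    swap (I∷ S) = refl ∷ []
    swap (O∷ S) = []

  down-inversions : ∀ t (S : Word k l) → All (λ (_ , T) → inversions T ≡ suc (inversions S)) (down t S)
  down-inversions t []     = []
  down-inversions t (I∷ S) = Allₚ.++⁺ (swap S) (push⁺ (down-inversions (suc t) S))
    where
    swap : ∀ {k l} (S : Word k l) → All (λ (_ , T) → inversions T ≡ suc (inversions S)) (swapDown t S)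
    swap []     = []
    swap (I∷ S) = []
    swap (O∷ S) = refl ∷ []
  down-inversions t (O∷_ {k} S) = push⁺ (All.map
    (λ e → trans (cong (k ℕ.+_) e) (ℕₚ.+-suc k (inversions S))) (down-inversions (suc t) S))

  up-I : ∀ (S : Word k l) f → ⟦ up (I∷ S) ⟧ f ≡ ⟦ up S ⟧ (f ∘ I∷_)
  up-I S f = ⟦⟧-push (up S) I∷_ f

  up-O : ∀ (S : Word k l) f → ⟦ up (O∷ S) ⟧ f ≡ ⟦ swapUp S ⟧ f + ⟦ up S ⟧ (f ∘ O∷_)
  up-O S f = trans (⟦⟧-++ (swapUp S) _ f) (cong (_+_ (⟦ swapUp S ⟧ f)) (⟦⟧-push (up S) O∷_ f))

  down-I : ∀ t (S : Word k l) f → ⟦ down t (I∷ S) ⟧ f ≡ ⟦ swapDown t S ⟧ f + ⟦ down (suc t) S ⟧ (f ∘ I∷_)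
  down-I t S f = trans (⟦⟧-++ (swapDown t S) _ f) (cong (_+_ (⟦ swapDown t S ⟧ f)) (⟦⟧-push (down (suc t) S) I∷_ f))

  down-O : ∀ t (S : Word k l) f → ⟦ down t (O∷ S) ⟧ f ≡ ⟦ down (suc t) S ⟧ (f ∘ O∷_)
  down-O t S f = ⟦⟧-push (down (suc t) S) O∷_ f

  ⟦⟧-zero : ∀ {A : Set} (L : Form A) {f} → (∀ x → f x ≡ 0ℤ) → ⟦ L ⟧ f ≡ 0ℤ
  ⟦⟧-zero L h = ⟦⟧-vanish {L = L} (All.universal (λ (_ , y) → h y) L)

  -- The diagonal coefficient left when a swap of the letter at position t with the first letter of
  -- the word is undone; it is non-zero only if that first letter is I, respectively O.
  linkI linkO : ℕ → Word k l → ℤ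
  linkI t (I∷_ {k} {l} _) = link t (k ℕ.+ l)
  linkI t _               = 0ℤ
  linkO t (O∷_ {k} {l} _) = link t (k ℕ.+ l)
  linkO t _               = 0ℤ

  -- A swap of the two leading letters O I commutes with lowerings further right, and lowering away
  -- the I leaves nothing to swap. The one term without a partner undoes the swap and contributes
  -- `linkI`.
  swapUp-down : ∀ t (S : Word k l) f →
    ⟦ swapUp S ⟧ (λ T → ⟦ down t T ⟧ f) ≡
    ⟦ down (suc t) S ⟧ (λ T → ⟦ swapUp T ⟧ f) + linkI t S * f (O∷ S)
  swapUp-down t []     f = refl
  swapUp-down t (O∷ S) f = sym (trans (ℤₚ.+-identityʳ _)
    (trans (down-O (suc t) S (λ T → ⟦ swapUp T ⟧ f)) (⟦⟧-zero (down (suc (suc t)) S) λ _ → refl)))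
  swapUp-down t (I∷_ {k} {l} S) f = begin
    1ℤ * ⟦ down t (I∷ O∷ S) ⟧ f + 0ℤ
      ≡⟨ cong (λ c → 1ℤ * c + 0ℤ) (trans (down-I t (O∷ S) f) (cong (_+_ (⟦ swapDown t (O∷ S) ⟧ f)) (down-O (suc t) S (f ∘ I∷_)))) ⟩
    1ℤ * (link t (k ℕ.+ l) * f (O∷ I∷ S) + 0ℤ + ⟦ down (suc (suc t)) S ⟧ (λ T → f (I∷ O∷ T))) + 0ℤ
      ≡⟨ regroup (link t (k ℕ.+ l) * f (O∷ I∷ S)) _ ⟩
    0ℤ + ⟦ down (suc (suc t)) S ⟧ (λ T → f (I∷ O∷ T)) + link t (k ℕ.+ l) * f (O∷ I∷ S)
      ≡⟨ cong (_+ (link t (k ℕ.+ l) * f (O∷ I∷ S))) (cong₂ _+_ (no-double S)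
           (⟦⟧-cong (down (suc (suc t)) S) λ T → singleton (f (I∷ O∷ T)))) ⟨
    ⟦ swapDown (suc t) S ⟧ (λ T → ⟦ swapUp T ⟧ f) +
    ⟦ down (suc (suc t)) S ⟧ (λ T → ⟦ swapUp (I∷ T) ⟧ f) + link t (k ℕ.+ l) * f (O∷ I∷ S)
      ≡⟨ cong (_+ (link t (k ℕ.+ l) * f (O∷ I∷ S))) (down-I (suc t) S λ T → ⟦ swapUp T ⟧ f) ⟨
    ⟦ down (suc t) (I∷ S) ⟧ (λ T → ⟦ swapUp T ⟧ f) + link t (k ℕ.+ l) * f (O∷ I∷ S) ∎
    where
    regroup : ∀ a b → 1ℤ * (a + 0ℤ + b) + 0ℤ ≡ 0ℤ + b + a
    regroup = ℤ-Solver.solve-∀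
    singleton : ∀ a → 1ℤ * a + 0ℤ ≡ a
    singleton = ℤ-Solver.solve-∀
    no-double : ∀ {k l} {f : Word (suc k) (suc l) → ℤ} (S : Word k l) →
                ⟦ swapDown (suc t) S ⟧ (λ T → ⟦ swapUp T ⟧ f) ≡ 0ℤ
    no-double []     = refl
    no-double (I∷ S) = refl
    no-double (O∷_ {k} {l} S) = trans (ℤₚ.+-identityʳ _) (ℤₚ.*-zeroʳ (link (suc t) (k ℕ.+ l)))

  -- The mirror image of `swapUp-down` for leading letters I O; the undone swap now occurs on the
  -- other side, whence the sign.
  up-swapDown : ∀ t (S : Word k l) f →
    ⟦ up S ⟧ (λ T → ⟦ swapDown t T ⟧ f) ≡
    ⟦ swapDown t S ⟧ (λ T → ⟦ up T ⟧ f) + - linkO t S * f (I∷ S)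
  up-swapDown t []     f = refl
  up-swapDown t (I∷ S) f = trans (up-I S (λ T → ⟦ swapDown t T ⟧ f)) (⟦⟧-zero (up S) λ _ → refl)
  up-swapDown t (O∷_ {k} {l} S) f = begin
    ⟦ up (O∷ S) ⟧ (λ T → ⟦ swapDown t T ⟧ f)
      ≡⟨ up-O S (λ T → ⟦ swapDown t T ⟧ f) ⟩
    ⟦ swapUp S ⟧ (λ T → ⟦ swapDown t T ⟧ f) + ⟦ up S ⟧ (λ T → ⟦ swapDown t (O∷ T) ⟧ f)
      ≡⟨ cong₂ _+_ (no-double S) (trans (⟦⟧-cong (up S) λ T → ℤₚ.+-identityʳ (c * f (O∷ I∷ T)))
                                        (⟦⟧-* (up S) c (λ T → f (O∷ I∷ T)))) ⟩
    0ℤ + c * ⟦ up S ⟧ (λ T → f (O∷ I∷ T))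
      ≡⟨ regroup c (f (I∷ O∷ S)) _ ⟩
    c * (1ℤ * f (I∷ O∷ S) + 0ℤ + ⟦ up S ⟧ (λ T → f (O∷ I∷ T))) + 0ℤ + - c * f (I∷ O∷ S)
      ≡⟨ cong (λ d → c * d + 0ℤ + - c * f (I∷ O∷ S))
           (trans (up-O (I∷ S) f) (cong (_+_ (⟦ swapUp (I∷ S) ⟧ f)) (up-I S (f ∘ O∷_)))) ⟨
    c * ⟦ up (O∷ I∷ S) ⟧ f + 0ℤ + - c * f (I∷ O∷ S) ∎
    where
    c : ℤ
    c = link t (k ℕ.+ l)
    regroup : ∀ c a b → 0ℤ + c * b ≡ c * (1ℤ * a + 0ℤ + b) + 0ℤ + - c * a
    regroup = ℤ-Solver.solve-∀
    no-double : ∀ {k l} {f : Word (suc k) (suc l) → ℤ} (S : Word k l) →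
                ⟦ swapUp S ⟧ (λ T → ⟦ swapDown t T ⟧ f) ≡ 0ℤ
    no-double []     = refl
    no-double (I∷ S) = refl
    no-double (O∷ S) = refl

  -- The diagonal of the commutator: each adjacent pair contributes its link, positively for O I and
  -- negatively for I O.
  eigenvalue : ℕ → Word k l → ℤ
  eigenvalue t []     = 0ℤ
  eigenvalue t (I∷ S) = - linkO t S + eigenvalue (suc t) S
  eigenvalue t (O∷ S) = linkI t S + eigenvalue (suc t) S

  up-down-commutator : ∀ t (S : Word k l) f →
    ⟦ up S ⟧ (λ T → ⟦ down t T ⟧ f) ≡ ⟦ down t S ⟧ (λ T → ⟦ up T ⟧ f) + eigenvalue t S * f S
  up-down-commutator t []     f = refl
  up-down-commutator t (I∷ S) f = begin
    ⟦ up (I∷ S) ⟧ (λ T → ⟦ down t T ⟧ f)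
      ≡⟨ up-I S (λ T → ⟦ down t T ⟧ f) ⟩
    ⟦ up S ⟧ (λ T → ⟦ down t (I∷ T) ⟧ f)
      ≡⟨ ⟦⟧-cong (up S) (λ T → down-I t T f) ⟩
    ⟦ up S ⟧ (λ T → ⟦ swapDown t T ⟧ f + ⟦ down (suc t) T ⟧ (f ∘ I∷_))
      ≡⟨ ⟦⟧-+ (up S) (λ T → ⟦ swapDown t T ⟧ f) (λ T → ⟦ down (suc t) T ⟧ (f ∘ I∷_)) ⟩
    ⟦ up S ⟧ (λ T → ⟦ swapDown t T ⟧ f) + ⟦ up S ⟧ (λ T → ⟦ down (suc t) T ⟧ (f ∘ I∷_))
      ≡⟨ cong₂ _+_ (up-swapDown t S f) (up-down-commutator (suc t) S (f ∘ I∷_)) ⟩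
    (⟦ swapDown t S ⟧ (λ T → ⟦ up T ⟧ f) + - linkO t S * f (I∷ S)) +
    (⟦ down (suc t) S ⟧ (λ T → ⟦ up T ⟧ (f ∘ I∷_)) + eigenvalue (suc t) S * f (I∷ S))
      ≡⟨ collect (⟦ swapDown t S ⟧ (λ T → ⟦ up T ⟧ f)) (- linkO t S) _ (eigenvalue (suc t) S) (f (I∷ S)) ⟩
    (⟦ swapDown t S ⟧ (λ T → ⟦ up T ⟧ f) + ⟦ down (suc t) S ⟧ (λ T → ⟦ up T ⟧ (f ∘ I∷_))) +
    eigenvalue t (I∷ S) * f (I∷ S)
      ≡⟨ cong (λ c → ⟦ swapDown t S ⟧ (λ T → ⟦ up T ⟧ f) + c + eigenvalue t (I∷ S) * f (I∷ S))
           (⟦⟧-cong (down (suc t) S) (λ T → up-I T f)) ⟨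
    (⟦ swapDown t S ⟧ (λ T → ⟦ up T ⟧ f) + ⟦ down (suc t) S ⟧ (λ T → ⟦ up (I∷ T) ⟧ f)) +
    eigenvalue t (I∷ S) * f (I∷ S)
      ≡⟨ cong (_+ (eigenvalue t (I∷ S) * f (I∷ S))) (down-I t S (λ T → ⟦ up T ⟧ f)) ⟨
    ⟦ down t (I∷ S) ⟧ (λ T → ⟦ up T ⟧ f) + eigenvalue t (I∷ S) * f (I∷ S) ∎
    where
    collect : ∀ a p b e c → (a + p * c) + (b + e * c) ≡ (a + b) + (p + e) * c
    collect = ℤ-Solver.solve-∀
  up-down-commutator t (O∷ S) f = begin
    ⟦ up (O∷ S) ⟧ (λ T → ⟦ down t T ⟧ f)
      ≡⟨ up-O S (λ T → ⟦ down t T ⟧ f) ⟩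
    ⟦ swapUp S ⟧ (λ T → ⟦ down t T ⟧ f) + ⟦ up S ⟧ (λ T → ⟦ down t (O∷ T) ⟧ f)
      ≡⟨ cong (_+_ (⟦ swapUp S ⟧ (λ T → ⟦ down t T ⟧ f))) (⟦⟧-cong (up S) (λ T → down-O t T f)) ⟩
    ⟦ swapUp S ⟧ (λ T → ⟦ down t T ⟧ f) + ⟦ up S ⟧ (λ T → ⟦ down (suc t) T ⟧ (f ∘ O∷_))
      ≡⟨ cong₂ _+_ (swapUp-down t S f) (up-down-commutator (suc t) S (f ∘ O∷_)) ⟩
    (⟦ down (suc t) S ⟧ (λ T → ⟦ swapUp T ⟧ f) + linkI t S * f (O∷ S)) +
    (⟦ down (suc t) S ⟧ (λ T → ⟦ up T ⟧ (f ∘ O∷_)) + eigenvalue (suc t) S * f (O∷ S))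
      ≡⟨ collect (⟦ down (suc t) S ⟧ (λ T → ⟦ swapUp T ⟧ f)) (linkI t S) _ (eigenvalue (suc t) S) (f (O∷ S)) ⟩
    (⟦ down (suc t) S ⟧ (λ T → ⟦ swapUp T ⟧ f) + ⟦ down (suc t) S ⟧ (λ T → ⟦ up T ⟧ (f ∘ O∷_))) +
    eigenvalue t (O∷ S) * f (O∷ S)
      ≡⟨ cong (_+ (eigenvalue t (O∷ S) * f (O∷ S)))
           (trans (down-O t S (λ T → ⟦ up T ⟧ f))
           (trans (⟦⟧-cong (down (suc t) S) (λ T → up-O T f))
                  (⟦⟧-+ (down (suc t) S) (λ T → ⟦ swapUp T ⟧ f) (λ T → ⟦ up T ⟧ (f ∘ O∷_))))) ⟨
    ⟦ down t (O∷ S) ⟧ (λ T → ⟦ up T ⟧ f) + eigenvalue t (O∷ S) * f (O∷ S) ∎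
    where
    collect : ∀ a p b e c → (a + p * c) + (b + e * c) ≡ (a + b) + (p + e) * c
    collect = ℤ-Solver.solve-∀

  -- The correction term accounts for the missing link between positions t - 1 and t.
  boundary : Word k l → ℤ
  boundary (I∷_ {k} {l} _) = + suc (k ℕ.+ l)
  boundary _               = 0ℤ

  -- Adding and subtracting the link of each adjacent pair I I turns the eigenvalue into a sum over
  -- the letters I, each contributing the difference of the links on its two sides, which is linear
  -- in its position. The case split reads two letters because `eigenvalue` inspects neighbours.
  eigenvalue-closed : ∀ t (S : Word k l) →
    eigenvalue t S ≡ + 2 * + inversions S + + t * + k + - (+ k * + l) + - (+ t * boundary S)
  eigenvalue-closed t [] = identity (+ t)
    where
    identity : ∀ t → 0ℤ ≡ + 2 * 0ℤ + t * 0ℤ + - (0ℤ * 0ℤ) + - (t * 0ℤ)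
    identity = ℤ-Solver.solve-∀
  eigenvalue-closed t (I∷ []) = identity (+ t)
    where
    identity : ∀ t → 0ℤ ≡ + 2 * 0ℤ + t * 1ℤ + - (1ℤ * 0ℤ) + - (t * 1ℤ)
    identity = ℤ-Solver.solve-∀
  eigenvalue-closed t (I∷_ {suc k} {l} (I∷ S)) = trans (cong (_+_ 0ℤ) (eigenvalue-closed (suc t) (I∷ S)))
    (identity (+ t) (+ k) (+ l) (+ inversions S))
    where
    identity : ∀ t k l r →
      0ℤ + (+ 2 * r + (1ℤ + t) * (1ℤ + k) + - ((1ℤ + k) * l) + - ((1ℤ + t) * (1ℤ + (k + l)))) ≡
      + 2 * r + t * (1ℤ + (1ℤ + k)) + - ((1ℤ + (1ℤ + k)) * l) + - (t * (1ℤ + (1ℤ + (k + l))))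
    identity = ℤ-Solver.solve-∀
  eigenvalue-closed t (I∷_ {k} {suc l} (O∷ S)) = trans (cong (_+_ (- link t (k ℕ.+ l))) (eigenvalue-closed (suc t) (O∷ S)))
    (identity (+ t) (+ k) (+ l) (+ inversions S))
    where
    identity : ∀ t k l r →
      - ((1ℤ + t) * (1ℤ + (k + l))) + (+ 2 * (k + r) + (1ℤ + t) * k + - (k * (1ℤ + l)) + - ((1ℤ + t) * 0ℤ)) ≡
      + 2 * (k + r) + t * (1ℤ + k) + - ((1ℤ + k) * (1ℤ + l)) + - (t * (1ℤ + (k + (1ℤ + l))))
    identity = ℤ-Solver.solve-∀
  eigenvalue-closed t (O∷ []) = identity (+ t)
    where
    identity : ∀ t → 0ℤ ≡ + 2 * 0ℤ + t * 0ℤ + - (0ℤ * 1ℤ) + - (t * 0ℤ)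
    identity = ℤ-Solver.solve-∀
  eigenvalue-closed t (O∷_ {suc k} {l} (I∷ S)) = trans (cong (_+_ (link t (k ℕ.+ l))) (eigenvalue-closed (suc t) (I∷ S)))
    (identity (+ t) (+ k) (+ l) (+ inversions S))
    where
    identity : ∀ t k l r →
      (1ℤ + t) * (1ℤ + (k + l)) + (+ 2 * r + (1ℤ + t) * (1ℤ + k) + - ((1ℤ + k) * l) + - ((1ℤ + t) * (1ℤ + (k + l)))) ≡
      + 2 * ((1ℤ + k) + r) + t * (1ℤ + k) + - ((1ℤ + k) * (1ℤ + l)) + - (t * 0ℤ)
    identity = ℤ-Solver.solve-∀
  eigenvalue-closed t (O∷_ {k} {suc l} (O∷ S)) = trans (cong (_+_ 0ℤ) (eigenvalue-closed (suc t) (O∷ S)))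
    (identity (+ t) (+ k) (+ l) (+ inversions S))
    where
    identity : ∀ t k l r →
      0ℤ + (+ 2 * (k + r) + (1ℤ + t) * k + - (k * (1ℤ + l)) + - ((1ℤ + t) * 0ℤ)) ≡
      + 2 * (k + (k + r)) + t * k + - (k * (1ℤ + (1ℤ + l))) + - (t * 0ℤ)
    identity = ℤ-Solver.solve-∀

  -- The squared norm of the basis vector at position t, with n + 1 positions from t onwards:
  -- consecutive norms have the ratio given by link.
  norm : ℕ → ℕ → ℤ
  norm zero    n = 1ℤ
  norm (suc t) n = link t n * norm t (suc n)

  wordNorm : ℕ → Word k l → ℤ
  wordNorm t []              = 1ℤ
  wordNorm t (I∷_ {k} {l} S) = norm t (k ℕ.+ l) * wordNorm (suc t) S
  wordNorm t (O∷ S)          = wordNorm (suc t) S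

  norm-positive : ∀ t n → 0ℤ ℤ.< norm t n
  norm-positive zero    n = ℤ.+<+ (s≤s z≤n)
  norm-positive (suc t) n = *-positive {link t n} (ℤ.+<+ (s≤s z≤n)) (norm-positive t (suc n))

  wordNorm-positive : ∀ t (S : Word k l) → 0ℤ ℤ.< wordNorm t S
  wordNorm-positive t []              = ℤ.+<+ (s≤s z≤n)
  wordNorm-positive t (I∷_ {k} {l} S) = *-positive (norm-positive t (k ℕ.+ l)) (wordNorm-positive (suc t) S)
  wordNorm-positive t (O∷ S)          = wordNorm-positive (suc t) S

  ∑-words : ∀ k l (F : Word (suc k) (suc l) → ℤ) →
    ∑ (words (suc k) (suc l)) F ≡ ∑ (words k (suc l)) (F ∘ I∷_) + ∑ (words (suc k) l) (F ∘ O∷_)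
  ∑-words k l F = trans (∑-++ (map I∷_ (words k (suc l))) _ F)
                        (cong₂ _+_ (∑-map (words k (suc l)) I∷_ F) (∑-map (words (suc k) l) O∷_ F))

  onI : (Word k l → ℤ) → Word (suc k) l → ℤ
  onI F (I∷ S) = F S
  onI F (O∷ S) = 0ℤ

  onO : (Word k l → ℤ) → Word k (suc l) → ℤ
  onO F (I∷ S) = 0ℤ
  onO F (O∷ S) = F S

  ∑-onI : ∀ k l (F : Word k l → ℤ) → ∑ (words (suc k) l) (onI F) ≡ ∑ (words k l) F
  ∑-onI k zero    F = ∑-map (words k zero) I∷_ (onI F)
  ∑-onI k (suc l) F = trans (∑-words k l (onI F))
    (trans (cong (_+_ (∑ (words k (suc l)) F)) (∑-0 (words (suc k) l))) (ℤₚ.+-identityʳ _))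

  ∑-onO : ∀ k l (F : Word k l → ℤ) → ∑ (words k (suc l)) (onO F) ≡ ∑ (words k l) F
  ∑-onO zero    l F = ∑-map (words zero l) O∷_ (onO F)
  ∑-onO (suc k) l F = trans (∑-words k l (onO F))
    (trans (cong (_+ (∑ (words (suc k) l) F)) (∑-0 (words k (suc l)))) (ℤₚ.+-identityˡ _))

  -- Only words O I S contribute on the left and only I O S on the right, so both sums run over the
  -- common tail S; `onI` and `onO` extend by zero to get there. The norms of the two words have the
  -- ratio `link t (k ℕ.+ l)`, which is the coefficient of `swapDown`.
  swap-adjoint : ∀ t k l (f g : Word (suc k) (suc l) → ℤ) →
    ∑ (words (suc k) l) (λ S → wordNorm (suc t) S * (g (O∷ S) * ⟦ swapUp S ⟧ f)) ≡
    ∑ (words k (suc l)) (λ S → wordNorm t (I∷ S) * (f (I∷ S) * ⟦ swapDown t S ⟧ g))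
  swap-adjoint t k l f g = begin
    ∑ (words (suc k) l) (λ S → wordNorm (suc t) S * (g (O∷ S) * ⟦ swapUp S ⟧ f))
      ≡⟨ ∑-cong (words (suc k) l) (λ { (I∷ S) → moved S ; (O∷ S) → vanish (wordNorm (suc t) (O∷ S)) (g (O∷ O∷ S)) }) ⟩
    ∑ (words (suc k) l) (onI F)
      ≡⟨ ∑-onI k l F ⟩
    ∑ (words k l) F
      ≡⟨ ∑-onO k l F ⟨
    ∑ (words k (suc l)) (onO F)
      ≡⟨ ∑-cong (words k (suc l)) (λ { (I∷ S) → vanish (wordNorm t (I∷ I∷ S)) (f (I∷ I∷ S)) ; (O∷ S) → refl }) ⟨
    ∑ (words k (suc l)) (λ S → wordNorm t (I∷ S) * (f (I∷ S) * ⟦ swapDown t S ⟧ g)) ∎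
    where
    vanish : ∀ a b → a * (b * 0ℤ) ≡ 0ℤ
    vanish = ℤ-Solver.solve-∀
    F : Word k l → ℤ
    F S = wordNorm t (I∷ O∷ S) * (f (I∷ O∷ S) * (link t (k ℕ.+ l) * g (O∷ I∷ S) + 0ℤ))
    regroup : ∀ c n w a b → c * n * w * (a * (1ℤ * b + 0ℤ)) ≡ n * w * (b * (c * a + 0ℤ))
    regroup = ℤ-Solver.solve-∀
    moved : ∀ S → wordNorm (suc t) (I∷ S) * (g (O∷ I∷ S) * (1ℤ * f (I∷ O∷ S) + 0ℤ)) ≡ F S
    moved S = trans
      (regroup (link t (k ℕ.+ l)) (norm t (suc (k ℕ.+ l))) (wordNorm (suc (suc t)) S) (g (O∷ I∷ S)) (f (I∷ O∷ S)))
      (cong (λ n → norm t n * wordNorm (suc (suc t)) S * (f (I∷ O∷ S) * (link t (k ℕ.+ l) * g (O∷ I∷ S) + 0ℤ)))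
            (sym (ℕₚ.+-suc k l)))

  ∑-distrib : ∀ {A : Set} (xs : List A) (w a b c : A → ℤ) →
    ∑ xs (λ x → w x * (a x * (b x + c x))) ≡ ∑ xs (λ x → w x * (a x * b x)) + ∑ xs (λ x → w x * (a x * c x))
  ∑-distrib xs w a b c = trans (∑-cong xs λ x → distrib (w x) (a x) (b x) (c x))
                               (∑-+ xs (λ x → w x * (a x * b x)) (λ x → w x * (a x * c x)))
    where
    distrib : ∀ w a b c → w * (a * (b + c)) ≡ w * (a * b) + w * (a * c)
    distrib = ℤ-Solver.solve-∀

  Adjoint : ℕ → ℕ → ℕ → Set
  Adjoint t k l = ∀ f g → ∑ (words k l) (λ S → wordNorm t S * (g S * ⟦ up S ⟧ f)) ≡
                          ∑ (words k l) (λ S → wordNorm t S * (f S * ⟦ down t S ⟧ g))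

  adjoint-I : ∀ t k l → Adjoint (suc t) k l → ∀ (f g : Word (suc k) l → ℤ) →
    ∑ (words k l) (λ S → wordNorm t (I∷ S) * (g (I∷ S) * ⟦ up (I∷ S) ⟧ f)) ≡
    ∑ (words k l) (λ S → wordNorm t (I∷ S) * (f (I∷ S) * ⟦ down (suc t) S ⟧ (g ∘ I∷_)))
  adjoint-I t k l adj f g = begin
    ∑ (words k l) (λ S → wordNorm t (I∷ S) * (g (I∷ S) * ⟦ up (I∷ S) ⟧ f))
      ≡⟨ ∑-cong (words k l) (λ S → trans (cong (λ c → wordNorm t (I∷ S) * (g (I∷ S) * c)) (up-I S f))
                                         (ℤₚ.*-assoc n (wordNorm (suc t) S) _)) ⟩
    ∑ (words k l) (λ S → n * (wordNorm (suc t) S * (g (I∷ S) * ⟦ up S ⟧ (f ∘ I∷_))))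
      ≡⟨ ∑-* (words k l) n (λ S → wordNorm (suc t) S * (g (I∷ S) * ⟦ up S ⟧ (f ∘ I∷_))) ⟩
    n * ∑ (words k l) (λ S → wordNorm (suc t) S * (g (I∷ S) * ⟦ up S ⟧ (f ∘ I∷_)))
      ≡⟨ cong (n *_) (adj (f ∘ I∷_) (g ∘ I∷_)) ⟩
    n * ∑ (words k l) (λ S → wordNorm (suc t) S * (f (I∷ S) * ⟦ down (suc t) S ⟧ (g ∘ I∷_)))
      ≡⟨ ∑-* (words k l) n (λ S → wordNorm (suc t) S * (f (I∷ S) * ⟦ down (suc t) S ⟧ (g ∘ I∷_))) ⟨
    ∑ (words k l) (λ S → n * (wordNorm (suc t) S * (f (I∷ S) * ⟦ down (suc t) S ⟧ (g ∘ I∷_))))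
      ≡⟨ ∑-cong (words k l) (λ S → ℤₚ.*-assoc n (wordNorm (suc t) S) _) ⟨
    ∑ (words k l) (λ S → wordNorm t (I∷ S) * (f (I∷ S) * ⟦ down (suc t) S ⟧ (g ∘ I∷_))) ∎
    where
    n : ℤ
    n = norm t (k ℕ.+ l)

  adjoint-O : ∀ t k l → Adjoint (suc t) k l → ∀ (f g : Word k (suc l) → ℤ) →
    ∑ (words k l) (λ S → wordNorm t (O∷ S) * (g (O∷ S) * ⟦ up S ⟧ (f ∘ O∷_))) ≡
    ∑ (words k l) (λ S → wordNorm t (O∷ S) * (f (O∷ S) * ⟦ down t (O∷ S) ⟧ g))
  adjoint-O t k l adj f g = trans (adj (f ∘ O∷_) (g ∘ O∷_))
    (∑-cong (words k l) λ S → cong (λ c → wordNorm t (O∷ S) * (f (O∷ S) * c)) (sym (down-O t S g)))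

  up-down-adjoint : ∀ t k l → Adjoint t k l
  up-down-adjoint t zero zero f g = cong (λ c → 1ℤ * c + 0ℤ) (trans (ℤₚ.*-zeroʳ (g [])) (sym (ℤₚ.*-zeroʳ (f []))))
  up-down-adjoint t (suc k) zero f g = begin
    ∑ (words (suc k) zero) (λ S → wordNorm t S * (g S * ⟦ up S ⟧ f))
      ≡⟨ ∑-map (words k zero) I∷_ _ ⟩
    ∑ (words k zero) (λ S → wordNorm t (I∷ S) * (g (I∷ S) * ⟦ up (I∷ S) ⟧ f))
      ≡⟨ adjoint-I t k zero (up-down-adjoint (suc t) k zero) f g ⟩
    ∑ (words k zero) (λ S → wordNorm t (I∷ S) * (f (I∷ S) * ⟦ down (suc t) S ⟧ (g ∘ I∷_)))
      ≡⟨ ∑-cong (words k zero) (λ S → cong (λ c → wordNorm t (I∷ S) * (f (I∷ S) * c)) (no-O S)) ⟩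
    ∑ (words k zero) (λ S → wordNorm t (I∷ S) * (f (I∷ S) * ⟦ down t (I∷ S) ⟧ g))
      ≡⟨ ∑-map (words k zero) I∷_ _ ⟨
    ∑ (words (suc k) zero) (λ S → wordNorm t S * (f S * ⟦ down t S ⟧ g)) ∎
    where
    no-O : ∀ (S : Word k zero) → ⟦ down (suc t) S ⟧ (g ∘ I∷_) ≡ ⟦ down t (I∷ S) ⟧ g
    no-O []     = refl
    no-O (I∷ S) = sym (⟦⟧-push (down (suc t) (I∷ S)) I∷_ g)
  up-down-adjoint t zero (suc l) f g = begin
    ∑ (words zero (suc l)) (λ S → wordNorm t S * (g S * ⟦ up S ⟧ f))
      ≡⟨ ∑-map (words zero l) O∷_ _ ⟩
    ∑ (words zero l) (λ S → wordNorm t (O∷ S) * (g (O∷ S) * ⟦ up (O∷ S) ⟧ f))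
      ≡⟨ ∑-cong (words zero l) (λ S → cong (λ c → wordNorm t (O∷ S) * (g (O∷ S) * c)) (no-I S)) ⟩
    ∑ (words zero l) (λ S → wordNorm t (O∷ S) * (g (O∷ S) * ⟦ up S ⟧ (f ∘ O∷_)))
      ≡⟨ adjoint-O t zero l (up-down-adjoint (suc t) zero l) f g ⟩
    ∑ (words zero l) (λ S → wordNorm t (O∷ S) * (f (O∷ S) * ⟦ down t (O∷ S) ⟧ g))
      ≡⟨ ∑-map (words zero l) O∷_ _ ⟨
    ∑ (words zero (suc l)) (λ S → wordNorm t S * (f S * ⟦ down t S ⟧ g)) ∎
    where
    no-I : ∀ (S : Word zero l) → ⟦ up (O∷ S) ⟧ f ≡ ⟦ up S ⟧ (f ∘ O∷_)
    no-I []     = refl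
    no-I (O∷ S) = ⟦⟧-push (up (O∷ S)) O∷_ f
  up-down-adjoint t (suc k) (suc l) f g = begin
    ∑ (words (suc k) (suc l)) (λ S → wordNorm t S * (g S * ⟦ up S ⟧ f))
      ≡⟨ ∑-words k l _ ⟩
    ∑ (words k (suc l)) (λ S → wordNorm t (I∷ S) * (g (I∷ S) * ⟦ up (I∷ S) ⟧ f)) +
    ∑ (words (suc k) l) (λ S → wordNorm t (O∷ S) * (g (O∷ S) * ⟦ up (O∷ S) ⟧ f))
      ≡⟨ cong₂ _+_ (adjoint-I t k (suc l) (up-down-adjoint (suc t) k (suc l)) f g)
           (trans (∑-cong (words (suc k) l) λ S → cong (λ c → wordNorm t (O∷ S) * (g (O∷ S) * c)) (up-O S f))
           (trans (∑-distrib (words (suc k) l) (λ S → wordNorm t (O∷ S)) (λ S → g (O∷ S)) (λ S → ⟦ swapUp S ⟧ f) (λ S → ⟦ up S ⟧ (f ∘ O∷_)))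
                  (cong₂ _+_ (swap-adjoint t k l f g) (adjoint-O t (suc k) l (up-down-adjoint (suc t) (suc k) l) f g)))) ⟩
    tailI + (swapI + restO)
      ≡⟨ regroup tailI swapI restO ⟩
    (swapI + tailI) + restO
      ≡⟨ cong (_+ restO) (trans
           (∑-cong (words k (suc l)) λ S → cong (λ c → wordNorm t (I∷ S) * (f (I∷ S) * c)) (down-I t S g))
           (∑-distrib (words k (suc l)) (λ S → wordNorm t (I∷ S)) (λ S → f (I∷ S)) (λ S → ⟦ swapDown t S ⟧ g) (λ S → ⟦ down (suc t) S ⟧ (g ∘ I∷_)))) ⟨
    ∑ (words k (suc l)) (λ S → wordNorm t (I∷ S) * (f (I∷ S) * ⟦ down t (I∷ S) ⟧ g)) + restO
      ≡⟨ ∑-words k l _ ⟨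
    ∑ (words (suc k) (suc l)) (λ S → wordNorm t S * (f S * ⟦ down t S ⟧ g)) ∎
    where
    tailI swapI restO : ℤ
    tailI = ∑ (words k (suc l)) (λ S → wordNorm t (I∷ S) * (f (I∷ S) * ⟦ down (suc t) S ⟧ (g ∘ I∷_)))
    swapI = ∑ (words k (suc l)) (λ S → wordNorm t (I∷ S) * (f (I∷ S) * ⟦ swapDown t S ⟧ g))
    restO = ∑ (words (suc k) l) (λ S → wordNorm t (O∷ S) * (f (O∷ S) * ⟦ down t (O∷ S) ⟧ g))
    regroup : ∀ a b c → a + (b + c) ≡ (b + a) + c
    regroup = ℤ-Solver.solve-∀

  exteriorPower : ∀ k l → Ladder (Word k l)
  exteriorPower k l = record
    { _≟_        = _≟ʷ_
    ; elements   = words k l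
    ; unique     = words-unique k l
    ; complete   = words-complete
    ; weight     = wordNorm 0
    ; weight-pos = wordNorm-positive 0
    ; rank       = inversions
    ; degree     = k ℕ.* l
    ; up         = up
    ; down       = down 0
    ; up-rank    = up-inversions
    ; down-rank  = down-inversions 0
    ; adjoint    = up-down-adjoint 0 k l
    -- The first letter is at position t = 0, where the boundary correction vanishes and 2 ·
    -- inversions - k l remains.
    ; commutator = λ f S → trans (up-down-commutator 0 S f)
        (cong (λ c → ⟦ down 0 S ⟧ (λ T → ⟦ up T ⟧ f) + c * f S) (trans (eigenvalue-closed 0 S)
          (trans (simplify (+ inversions S) (+ k) (+ l) (boundary S))
                 (cong (λ d → + 2 * + inversions S + - d) (sym (ℤₚ.pos-* k l))))))
    }
    where
    simplify : ∀ r k l b → + 2 * r + 0ℤ * k + - (k * l) + - (0ℤ * b) ≡ + 2 * r + - (k * l)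
    simplify = ℤ-Solver.solve-∀

-- Gaussian polynomials as generating functions of inversions

module GaussianPolynomials where
  open PolynomialRing
  open Divisibility
  open Cyclotomic
  open Words using (I∷_; O∷_; words; inversions)
  open import Data.Bool using (true)
  open import Data.Bool.Properties using (T-≡)
  open import Data.Integer as ℤ using (ℤ; +_; 0ℤ; 1ℤ)
  open import Data.List using (List; []; _∷_; _++_; map; filter; length; cartesianProduct)
  open import Data.List.Properties using (filter-accept; filter-reject)
  open import Data.Nat as ℕ using (ℕ; zero; suc; _≤_; _∸_; _≟_; _+_)
  import Data.Nat.Properties as ℕₚ
  open import Data.Product using (_,_)
  open import Function using (_∘_)
  open import Function.Bundles using (Equivalence)
  open import Relation.Nullary using (yes; no; contradiction)
  open import Relation.Binary.PropositionalEquality using (_≡_; _≢_; refl; sym; trans; cong; cong₂)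
  open import Tactic.RingSolver using (solve-∀)
  open import Relation.Binary.Reasoning.Setoid ≋-setoid

  gf : ∀ {A : Set} → (A → ℕ) → List A → Poly
  gf rank []       = 0ᴾ
  gf rank (x ∷ xs) = q^ rank x +ᴾ gf rank xs

  coeff-q^-same : ∀ k → coeff (q^ k) k ≡ 1ℤ
  coeff-q^-same zero    = refl
  coeff-q^-same (suc k) = coeff-q^-same k

  coeff-q^-diff : ∀ k i → k ≢ i → coeff (q^ k) i ≡ 0ℤ
  coeff-q^-diff zero    zero    k≢i = contradiction refl k≢i
  coeff-q^-diff zero    (suc i) k≢i = refl
  coeff-q^-diff (suc k) zero    k≢i = refl
  coeff-q^-diff (suc k) (suc i) k≢i = coeff-q^-diff k i (k≢i ∘ cong suc)

  -- The right-hand side has the shape of `Ladder.count`, so comparisons of level sizes become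
  -- comparisons of coefficients.
  coeff-gf : ∀ {A : Set} (rank : A → ℕ) xs r →
             coeff (gf rank xs) r ≡ + length (filter (λ x → rank x ≟ r) xs)
  coeff-gf rank []       r = refl
  coeff-gf rank (x ∷ xs) r with rank x ≟ r
  ... | yes refl = trans (coeff-+ (q^ rank x) (gf rank xs) r) (trans
    (cong₂ ℤ._+_ (coeff-q^-same r) (coeff-gf rank xs r))
    (sym (cong (+_ ∘ length) (filter-accept (λ x → rank x ≟ r) {xs = xs} refl))))
  ... | no ≢r = trans (coeff-+ (q^ rank x) (gf rank xs) r) (trans
    (cong₂ ℤ._+_ (coeff-q^-diff (rank x) r ≢r) (coeff-gf rank xs r))
    (sym (cong (+_ ∘ length) (filter-reject (λ x → rank x ≟ r) {xs = xs} ≢r))))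

  gf-++ : ∀ {A : Set} (rank : A → ℕ) xs ys → gf rank (xs ++ ys) ≋ gf rank xs +ᴾ gf rank ys
  gf-++ rank []       ys = ≋-refl
  gf-++ rank (x ∷ xs) ys = ≋-trans (+-cong (≋-refl {q^ rank x}) (gf-++ rank xs ys))
                                   (≋-sym (+-assoc (q^ rank x) (gf rank xs) (gf rank ys)))

  gf-map : ∀ {A B : Set} (rank : A → ℕ) (rank′ : B → ℕ) (h : A → B) c xs →
           (∀ x → rank′ (h x) ≡ c + rank x) → gf rank′ (map h xs) ≋ q^ c *ᴾ gf rank xs
  gf-map rank rank′ h c []       e = ≋-sym (*-zeroʳ (q^ c))
  gf-map rank rank′ h c (x ∷ xs) e = begin
    q^ rank′ (h x) +ᴾ gf rank′ (map h xs)
      ≈⟨ +-cong (≋-trans (≋-reflexive (cong q^_ (e x))) (q^-+ c (rank x))) (gf-map rank rank′ h c xs e) ⟩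
    q^ c *ᴾ q^ rank x +ᴾ q^ c *ᴾ gf rank xs
      ≈⟨ *-distribˡ (q^ c) (q^ rank x) (gf rank xs) ⟨
    q^ c *ᴾ (q^ rank x +ᴾ gf rank xs) ∎

  gf-cartesianProduct : ∀ {A B : Set} (rank : A → ℕ) (rank′ : B → ℕ) xs ys →
    gf (λ (x , y) → rank x + rank′ y) (cartesianProduct xs ys) ≋ gf rank xs *ᴾ gf rank′ ys
  gf-cartesianProduct rank rank′ []       ys = ≋-refl
  gf-cartesianProduct rank rank′ (x ∷ xs) ys = begin
    gf _ (map (x ,_) ys ++ cartesianProduct xs ys)
      ≈⟨ gf-++ _ (map (x ,_) ys) _ ⟩
    gf _ (map (x ,_) ys) +ᴾ gf _ (cartesianProduct xs ys)
      ≈⟨ +-cong (gf-map rank′ _ (x ,_) (rank x) ys λ _ → refl) (gf-cartesianProduct rank rank′ xs ys) ⟩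
    q^ rank x *ᴾ gf rank′ ys +ᴾ gf rank xs *ᴾ gf rank′ ys
      ≈⟨ *-distribʳ (gf rank′ ys) (q^ rank x) (gf rank xs) ⟨
    (q^ rank x +ᴾ gf rank xs) *ᴾ gf rank′ ys ∎

  gauss : ℕ → ℕ → Poly
  gauss k l = gf inversions (words k l)

  gauss-0ˡ : ∀ l → gauss 0 l ≋ 1ᴾ
  gauss-0ˡ zero    = ≋-refl
  gauss-0ˡ (suc l) = ≋-trans (gf-map inversions inversions O∷_ 0 (words 0 l) λ _ → refl)
                             (≋-trans (*-identityˡ _) (gauss-0ˡ l))

  gauss-0ʳ : ∀ k → gauss k 0 ≋ 1ᴾ
  gauss-0ʳ zero    = ≋-refl
  gauss-0ʳ (suc k) = ≋-trans (gf-map inversions inversions I∷_ 0 (words k 0) λ _ → refl)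
                             (≋-trans (*-identityˡ _) (gauss-0ʳ k))

  -- Words are sorted by their first letter; a leading O forms an inversion with each of the `suc k`
  -- letters I.
  gauss-Pascal : ∀ k l → gauss (suc k) (suc l) ≋ gauss k (suc l) +ᴾ q^ (suc k) *ᴾ gauss (suc k) l
  gauss-Pascal k l = ≋-trans (gf-++ inversions (map I∷_ (words k (suc l))) _) (+-cong
    (≋-trans (gf-map inversions inversions I∷_ 0 (words k (suc l)) λ _ → refl) (*-identityˡ _))
    (gf-map inversions inversions O∷_ (suc k) (words (suc k) l) λ _ → refl))

  -- The product formula without division. In the Pascal recursion the two terms share the factor
  -- `[ k + suc l ]!`, and 1 - q^(k+1) + q^(k+1) (1 - q^(l+1)) is the last factor of the larger
  -- factorial.
  gauss-[]! : ∀ k l → gauss k l *ᴾ ([ k ]! *ᴾ [ l ]!) ≋ [ k + l ]!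
  gauss-[]! zero    l    = ≋-trans (*-congˡ (gauss-0ˡ l)) (≋-trans (*-identityˡ _) (*-identityˡ [ l ]!))
  gauss-[]! (suc k) zero = ≋-trans (*-congˡ (gauss-0ʳ (suc k))) (≋-trans (*-identityˡ _)
    (≋-trans (*-identityʳ [ suc k ]!) (≋-reflexive (cong [_]! (sym (ℕₚ.+-identityʳ (suc k)))))))
  gauss-[]! (suc k) (suc l) = begin
    gauss (suc k) (suc l) *ᴾ ([ k ]! *ᴾ u *ᴾ ([ l ]! *ᴾ v))
      ≈⟨ *-congˡ (gauss-Pascal k l) ⟩
    (gauss k (suc l) +ᴾ t *ᴾ gauss (suc k) l) *ᴾ ([ k ]! *ᴾ u *ᴾ ([ l ]! *ᴾ v))
      ≈⟨ expand (gauss k (suc l)) t (gauss (suc k) l) [ k ]! u [ l ]! v ⟩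
    gauss k (suc l) *ᴾ ([ k ]! *ᴾ ([ l ]! *ᴾ v)) *ᴾ u +ᴾ t *ᴾ (gauss (suc k) l *ᴾ ([ k ]! *ᴾ u *ᴾ [ l ]!)) *ᴾ v
      ≈⟨ +-cong (*-congˡ (gauss-[]! k (suc l))) (*-congˡ (*-congʳ t
           (≋-trans (gauss-[]! (suc k) l) (≋-reflexive (cong [_]! (sym (ℕₚ.+-suc k l))))))) ⟩
    [ k + suc l ]! *ᴾ u +ᴾ t *ᴾ [ k + suc l ]! *ᴾ v
      ≈⟨ collect [ k + suc l ]! u t v ⟩
    [ k + suc l ]! *ᴾ (u +ᴾ t *ᴾ v)
      ≈⟨ *-congʳ [ k + suc l ]! (1-q^-+ (suc k) (suc l)) ⟨
    [ suc k + suc l ]! ∎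
    where
    t u v : Poly
    t = q^ suc k
    u = 1-q^ suc k
    v = 1-q^ suc l
    expand : ∀ a t b x u y v → (a +ᴾ t *ᴾ b) *ᴾ (x *ᴾ u *ᴾ (y *ᴾ v)) ≋
             a *ᴾ (x *ᴾ (y *ᴾ v)) *ᴾ u +ᴾ t *ᴾ (b *ᴾ (x *ᴾ u *ᴾ y)) *ᴾ v
    expand = solve-∀ polyACR
    collect : ∀ f u t v → f *ᴾ u +ᴾ t *ᴾ f *ᴾ v ≋ f *ᴾ (u +ᴾ t *ᴾ v)
    collect = solve-∀ polyACR

  ∏-falling : ∀ k n → k ≤ n → (∏ k λ i → 1-q^ (n ∸ i)) *ᴾ [ n ∸ k ]! ≋ [ n ]!
  ∏-falling zero    n _   = *-identityˡ _
  ∏-falling (suc k) n k<n = begin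
    ∏ k (λ i → 1-q^ (n ∸ i)) *ᴾ 1-q^ (n ∸ k) *ᴾ [ n ∸ suc k ]!
      ≈⟨ swap (∏ k (λ i → 1-q^ (n ∸ i))) (1-q^ (n ∸ k)) [ n ∸ suc k ]! ⟩
    ∏ k (λ i → 1-q^ (n ∸ i)) *ᴾ ([ n ∸ suc k ]! *ᴾ 1-q^ (n ∸ k))
      ≡⟨ cong (λ j → ∏ k (λ i → 1-q^ (n ∸ i)) *ᴾ ([ n ∸ suc k ]! *ᴾ 1-q^ j)) n∸k ⟩
    ∏ k (λ i → 1-q^ (n ∸ i)) *ᴾ [ suc (n ∸ suc k) ]!
      ≡⟨ cong (λ j → ∏ k (λ i → 1-q^ (n ∸ i)) *ᴾ [ j ]!) n∸k ⟨
    ∏ k (λ i → 1-q^ (n ∸ i)) *ᴾ [ n ∸ k ]!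
      ≈⟨ ∏-falling k n (ℕₚ.<⇒≤ k<n) ⟩
    [ n ]! ∎
    where
    n∸k : n ∸ k ≡ suc (n ∸ suc k)
    n∸k = ℕₚ.+-∸-assoc 1 k<n
    swap : ∀ a b c → a *ᴾ b *ᴾ c ≋ a *ᴾ (c *ᴾ b)
    swap = solve-∀ polyACR

  qBinomial-gauss : ∀ {n} k l → n ≡ k + l → num (qBinomial n k) ≋ gauss k l *ᴾ den (qBinomial n k)
  -- Matching on the guard together with the proof that it is `true` makes `qBinomial` reduce to its
  -- fraction; both sides are then compared after multiplication by `[ l ]!`.
  qBinomial-gauss k l refl with k ℕ.≤ᵇ k + l | Equivalence.to T-≡ (ℕₚ.≤⇒≤ᵇ (ℕₚ.m≤m+n k l))
  ... | .true | refl = *-cancelʳ (∏ k λ i → 1-q^ (k + l ∸ i)) (gauss k l *ᴾ [ k ]!) ([]!-nonzero l) (begin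
    ∏ k (λ i → 1-q^ (k + l ∸ i)) *ᴾ [ l ]!
      ≡⟨ cong (λ j → ∏ k (λ i → 1-q^ (k + l ∸ i)) *ᴾ [ j ]!) (ℕₚ.m+n∸m≡n k l) ⟨
    ∏ k (λ i → 1-q^ (k + l ∸ i)) *ᴾ [ k + l ∸ k ]!
      ≈⟨ ∏-falling k (k + l) (ℕₚ.m≤m+n k l) ⟩
    [ k + l ]!
      ≈⟨ gauss-[]! k l ⟨
    gauss k l *ᴾ ([ k ]! *ᴾ [ l ]!)
      ≈⟨ *-assoc (gauss k l) [ k ]! [ l ]! ⟨
    gauss k l *ᴾ [ k ]! *ᴾ [ l ]! ∎)

-- Divisibility and non-negativity of the quotient

module Quotients where
  open PolynomialRing
  open Divisibility
  open Cyclotomic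
  open GaussianPolynomials
  open Floors
  open Ladders
  open Words using (words; inversions; exteriorPower)
  open import Data.Integer as ℤ using (ℤ; +_; 0ℤ; -1ℤ)
  import Data.Integer.Properties as ℤₚ
  import Data.Integer.Tactic.RingSolver as ℤ-Solver
  open import Data.List using ([]; _∷_; length)
  open import Data.Nat as ℕ using (ℕ; zero; suc; _≤_; _<_; _∸_; z≤n; s≤s; _/_; _+_; _*_)
  import Data.Nat.Properties as ℕₚ
  open import Data.Nat.Divisibility as ∣ℕ using (_∣_; _∣?_)
  open import Data.Nat.GCD using (gcd; gcd[m,n]∣n; gcd-greatest)
  open import Data.Product using (∃-syntax; _,_)
  open import Data.Sum using (inj₁; inj₂; [_,_]′)
  open import Relation.Nullary using (¬_; yes; no; contradiction)
  open import Relation.Binary.PropositionalEquality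
    using (_≡_; refl; sym; trans; cong; cong₂; subst; subst₂)
  open import Tactic.RingSolver using (solve-∀)
  open import Relation.Binary.Reasoning.Setoid ≋-setoid
  open _≋_

  module _ (x y z w N : ℕ) (1≤N : 1 ≤ N) (N∣x+z : N ∣ x + z) (N∣1+y+w : N ∣ suc (y + w)) where

    private
      g : ℕ
      g = gcd x N

    -- Put d = i + 1. If d does not divide N, superadditivity suffices. If d divides both N and x,
    -- it divides g, so both sides gain 1. If d divides N but not x, the unit on the left is paid
    -- for by `/-gain`.
    exponents-≤ : ∀ i → divisorsOf N i + ((x / suc i + y / suc i) + (z / suc i + w / suc i)) ≤
                        divisorsOf g i + ((x + y) / suc i + (z + w) / suc i)
    exponents-≤ i with suc i ∣? N | suc i ∣? x
    ... | no d∤N | _ rewrite ⟦∣⟧-no d∤N =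
      ℕₚ.m≤n⇒m≤o+n (divisorsOf g i) (ℕₚ.+-mono-≤ (/-superadditive x y (suc i)) (/-superadditive z w (suc i)))
    ... | yes d∣N | yes d∣x rewrite ⟦∣⟧-yes d∣N | ⟦∣⟧-yes (gcd-greatest d∣x d∣N) =
      s≤s (ℕₚ.+-mono-≤ (/-superadditive x y (suc i)) (/-superadditive z w (suc i)))
    ... | yes d∣N | no d∤x rewrite ⟦∣⟧-yes d∣N =
      ℕₚ.m≤n⇒m≤o+n (divisorsOf g i) (/-gain x y z w (suc i) (∣ℕ.∣-trans d∣N N∣x+z) (∣ℕ.∣-trans d∣N N∣1+y+w) d∤x)

    -- Multiplied by the four factorials in the denominators, dividend and divisor become monomials
    -- in the Φ d, and the quotient is the monomial of the difference of exponents.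
    1-q^-∣-gauss : 1-q^ N ∣ᴾ 1-q^ g *ᴾ (gauss x y *ᴾ gauss z w)
    1-q^-∣-gauss with cyclotomic (N + ((x + y) + (z + w)))
    ... | Φ , cyc = X , *-cancelʳ (X *ᴾ 1-q^ N) _ denominator-nonzero (begin
      X *ᴾ 1-q^ N *ᴾ (xy *ᴾ zw)
        ≈⟨ *-assoc X (1-q^ N) (xy *ᴾ zw) ⟩
      X *ᴾ (1-q^ N *ᴾ (xy *ᴾ zw))
        ≈⟨ *-congʳ X (*-cong (cyc N 1≤N N≤M) (*-cong
             (monomial-*-[]! x y (ℕₚ.≤-trans (ℕₚ.m≤m+n x y) x+y≤M) (ℕₚ.≤-trans (ℕₚ.m≤n+m y x) x+y≤M))
             (monomial-*-[]! z w (ℕₚ.≤-trans (ℕₚ.m≤m+n z w) z+w≤M) (ℕₚ.≤-trans (ℕₚ.m≤n+m w z) z+w≤M)))) ⟩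
      X *ᴾ (monomial Φ M (divisorsOf N) *ᴾ (monomial Φ M (floors x y) *ᴾ monomial Φ M (floors z w)))
        ≈⟨ *-congʳ X (monomial-+₃ (divisorsOf N) (floors x y) (floors z w)) ⟨
      X *ᴾ monomial Φ M lower
        ≈⟨ monomial-∸ Φ M lower upper exponents-≤ ⟩
      monomial Φ M upper
        ≈⟨ monomial-+₃ (divisorsOf g) (λ i → (x + y) / suc i) (λ i → (z + w) / suc i) ⟩
      monomial Φ M (divisorsOf g) *ᴾ (monomial Φ M (λ i → (x + y) / suc i) *ᴾ monomial Φ M (λ i → (z + w) / suc i))
        ≈⟨ *-cong (cyc g 1≤g (ℕₚ.≤-trans g≤N N≤M)) (*-cong ([]!-monomial cyc (x + y) x+y≤M) ([]!-monomial cyc (z + w) z+w≤M)) ⟨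
      1-q^ g *ᴾ ([ x + y ]! *ᴾ [ z + w ]!)
        ≈⟨ *-congʳ (1-q^ g) (*-cong (gauss-[]! x y) (gauss-[]! z w)) ⟨
      1-q^ g *ᴾ (gauss x y *ᴾ xy *ᴾ (gauss z w *ᴾ zw))
        ≈⟨ regroup (1-q^ g) (gauss x y) xy (gauss z w) zw ⟩
      1-q^ g *ᴾ (gauss x y *ᴾ gauss z w) *ᴾ (xy *ᴾ zw) ∎)
      where
      -- One bound that covers N, g and the arguments of all six factorials.
      M : ℕ
      M = N + ((x + y) + (z + w))
      N≤M : N ≤ M
      N≤M = ℕₚ.m≤m+n N _
      x+y≤M : x + y ≤ M
      x+y≤M = ℕₚ.m≤n⇒m≤o+n N (ℕₚ.m≤m+n (x + y) (z + w))
      z+w≤M : z + w ≤ M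
      z+w≤M = ℕₚ.m≤n⇒m≤o+n N (ℕₚ.m≤n+m (z + w) (x + y))
      g≤N : g ≤ N
      g≤N = ∣ℕ.∣⇒≤ {{ℕ.>-nonZero 1≤N}} (gcd[m,n]∣n x N)
      1≤g : 1 ≤ g
      1≤g = positive (gcd[m,n]∣n x N) 1≤N
        where
        positive : ∀ {d k} → d ∣ k → 1 ≤ k → 1 ≤ d
        positive {zero}  d∣k 1≤k = subst (1 ≤_) (∣ℕ.0∣⇒≡0 d∣k) 1≤k
        positive {suc d} d∣k 1≤k = s≤s z≤n
      xy zw : Poly
      xy = [ x ]! *ᴾ [ y ]!
      zw = [ z ]! *ᴾ [ w ]!
      floors : ℕ → ℕ → ℕ → ℕ
      floors a b i = a / suc i + b / suc i
      lower upper : ℕ → ℕ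
      lower i = divisorsOf N i + (floors x y i + floors z w i)
      upper i = divisorsOf g i + ((x + y) / suc i + (z + w) / suc i)
      X : Poly
      X = monomial Φ M (λ i → upper i ∸ lower i)
      denominator-nonzero : ¬ xy *ᴾ zw ≈ 0ᴾ
      denominator-nonzero = *ᴾ-nonzero {xy} (*ᴾ-nonzero {[ x ]!} ([]!-nonzero x) ([]!-nonzero y))
                                            (*ᴾ-nonzero {[ z ]!} ([]!-nonzero z) ([]!-nonzero w))
      monomial-*-[]! : ∀ a b → a ≤ M → b ≤ M → [ a ]! *ᴾ [ b ]! ≋ monomial Φ M (floors a b)
      monomial-*-[]! a b a≤M b≤M = ≋-trans (*-cong ([]!-monomial cyc a a≤M) ([]!-monomial cyc b b≤M))
        (≋-sym (monomial-+ Φ M (λ i → a / suc i) (λ i → b / suc i)))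
      monomial-+₃ : ∀ d e f → monomial Φ M (λ i → d i + (e i + f i)) ≋
                    monomial Φ M d *ᴾ (monomial Φ M e *ᴾ monomial Φ M f)
      monomial-+₃ d e f = ≋-trans (monomial-+ Φ M d (λ i → e i + f i)) (*-congʳ (monomial Φ M d) (monomial-+ Φ M e f))
      regroup : ∀ u a b c d → u *ᴾ (a *ᴾ b *ᴾ (c *ᴾ d)) ≋ u *ᴾ (a *ᴾ c) *ᴾ (b *ᴾ d)
      regroup = solve-∀ polyACR

  coeff-q^-*-< : ∀ N X i → i < N → coeff (q^ N *ᴾ X) i ≡ 0ℤ
  coeff-q^-*-< (suc N) X zero    _         = at (0∷-* (q^ N) X) 0
  coeff-q^-*-< (suc N) X (suc i) (s≤s i<N) = trans (at (0∷-* (q^ N) X) (suc i)) (coeff-q^-*-< N X i i<N)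

  coeff-q^-*-+ : ∀ N X i → coeff (q^ N *ᴾ X) (N + i) ≡ coeff X i
  coeff-q^-*-+ zero    X i = at (*-identityˡ X) i
  coeff-q^-*-+ (suc N) X i = trans (at (0∷-* (q^ N) X) (suc (N + i))) (coeff-q^-*-+ N X i)

  -- X = q^N X + (1 - q^g) P determines the coefficients of X from below and from above. Up to
  -- degree D / 2 the coefficients of (1 - q^g) P are non-negative; from D / 2 on, those of
  -- q^{-N} (q^g - 1) P are, as N ≥ g.
  nonneg-quotient : ∀ {N g D P X} → 1 ≤ N → g ≤ N → X *ᴾ 1-q^ N ≋ 1-q^ g *ᴾ P →
    (∀ i → 0ℤ ℤ.≤ coeff P i) →
    (∀ i d → 2 * (i + d) ≤ D → coeff P i ℤ.≤ coeff P (i + d)) →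
    (∀ i d → D ≤ 2 * i → coeff P (i + d) ℤ.≤ coeff P i) →
    ∀ i → 0ℤ ℤ.≤ coeff X i
  nonneg-quotient {N} {g} {D} {P} {X} 1≤N g≤N eq P≥0 P-inc P-dec i =
    [ below i i ℕₚ.≤-refl , above (length X) i (ℕₚ.m≤n+m (length X) i) ]′ (ℕₚ.≤-total (2 * i) D)
    where
    X≋ : X ≋ q^ N *ᴾ X +ᴾ (P +ᴾ (-ᴾ (q^ g *ᴾ P)))
    X≋ = begin
      X                                                ≈⟨ split X (q^ N) ⟩
      q^ N *ᴾ X +ᴾ X *ᴾ 1-q^ N                         ≈⟨ +-cong (≋-refl {q^ N *ᴾ X}) (≋-trans eq (expand (q^ g) P)) ⟩
      q^ N *ᴾ X +ᴾ (P +ᴾ (-ᴾ (q^ g *ᴾ P)))             ∎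
      where
      split : ∀ x a → x ≋ a *ᴾ x +ᴾ x *ᴾ (1ᴾ +ᴾ (-ᴾ a))
      split = solve-∀ polyACR
      expand : ∀ a p → (1ᴾ +ᴾ (-ᴾ a)) *ᴾ p ≋ p +ᴾ (-ᴾ (a *ᴾ p))
      expand = solve-∀ polyACR
    recurrence : ∀ j → coeff X j ≡ coeff (q^ N *ᴾ X) j ℤ.+ (coeff P j ℤ.- coeff (q^ g *ᴾ P) j)
    recurrence j = trans (at X≋ j) (trans (coeff-+ (q^ N *ᴾ X) _ j) (cong (λ c → coeff (q^ N *ᴾ X) j ℤ.+ c)
      (trans (coeff-+ P _ j) (cong (λ c → coeff P j ℤ.+ c) (trans (coeff-· -1ℤ (q^ g *ᴾ P) j) (ℤₚ.-1*i≡-i _))))))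
    shifted-P : ∀ j → 2 * j ≤ D → coeff (q^ g *ᴾ P) j ℤ.≤ coeff P j
    shifted-P j 2j≤D with ℕₚ.<-≤-connex j g
    ... | inj₁ j<g = subst (ℤ._≤ coeff P j) (sym (coeff-q^-*-< g P j j<g)) (P≥0 j)
    ... | inj₂ g≤j with ℕₚ.m≤n⇒∃[o]m+o≡n g≤j
    ...   | o , refl = subst₂ ℤ._≤_ (sym (coeff-q^-*-+ g P o)) (cong (coeff P) (ℕₚ.+-comm o g))
                         (P-inc o g (subst (λ k → 2 * k ≤ D) (ℕₚ.+-comm g o) 2j≤D))
    below-step : ∀ j → 2 * j ≤ D → 0ℤ ℤ.≤ coeff (q^ N *ᴾ X) j → 0ℤ ℤ.≤ coeff X j
    below-step j 2j≤D h = subst (0ℤ ℤ.≤_) (sym (recurrence j)) (ℤₚ.+-mono-≤ h (ℤₚ.i≤j⇒0≤j-i (shifted-P j 2j≤D)))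
    -- `n` is fuel: the step leads from N + o to o, which is smaller as 1 ≤ N. In degrees less than
    -- N the term q^N X contributes 0.
    below : ∀ n j → j ≤ n → 2 * j ≤ D → 0ℤ ℤ.≤ coeff X j
    below n j j≤n 2j≤D with ℕₚ.<-≤-connex j N
    ... | inj₁ j<N = below-step j 2j≤D (ℤₚ.≤-reflexive (sym (coeff-q^-*-< N X j j<N)))
    below zero    j j≤0 2j≤D | inj₂ N≤j = contradiction (ℕₚ.≤-trans 1≤N (ℕₚ.≤-trans N≤j j≤0)) λ ()
    below (suc n) j j≤n 2j≤D | inj₂ N≤j with ℕₚ.m≤n⇒∃[o]m+o≡n N≤j
    ... | o , refl = below-step (N + o) 2j≤D (subst (0ℤ ℤ.≤_) (sym (coeff-q^-*-+ N X o))
      (below n o (ℕₚ.≤-pred (ℕₚ.≤-trans (ℕₚ.+-monoˡ-≤ o 1≤N) j≤n))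
                 (ℕₚ.≤-trans (ℕₚ.*-monoʳ-≤ 2 (ℕₚ.m≤n+m o N)) 2j≤D)))
    coeff-beyond : ∀ Y j → length Y ≤ j → coeff Y j ≡ 0ℤ
    coeff-beyond []      j       _         = refl
    coeff-beyond (y ∷ Y) (suc j) (s≤s len) = coeff-beyond Y j len
    -- `n` bounds the distance from j to the end of the coefficient list, beyond which all
    -- coefficients are 0; the step from j to N + j uses up at least one unit as 1 ≤ N.
    above : ∀ n j → length X ≤ j + n → D ≤ 2 * j → 0ℤ ℤ.≤ coeff X j
    above zero    j len D≤2j = ℤₚ.≤-reflexive (sym (coeff-beyond X j (subst (length X ≤_) (ℕₚ.+-identityʳ j) len)))
    above (suc n) j len D≤2j = subst (0ℤ ℤ.≤_) (sym X-j)
      (ℤₚ.+-mono-≤ (above n (N + j) len′ (ℕₚ.≤-trans D≤2j (ℕₚ.*-monoʳ-≤ 2 (ℕₚ.m≤n+m j N))))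
                   (ℤₚ.i≤j⇒0≤j-i (subst (λ k → coeff P k ℤ.≤ coeff P (N ∸ g + j)) N∸g+j+g
                     (P-dec (N ∸ g + j) g (ℕₚ.≤-trans D≤2j (ℕₚ.*-monoʳ-≤ 2 (ℕₚ.m≤n+m j (N ∸ g))))))))
      where
      len′ : length X ≤ N + j + n
      len′ = ℕₚ.≤-trans len (ℕₚ.≤-trans (ℕₚ.≤-reflexive (ℕₚ.+-suc j n)) (ℕₚ.+-monoˡ-≤ n (ℕₚ.+-monoˡ-≤ j 1≤N)))
      g+N∸g+j : g + (N ∸ g + j) ≡ N + j
      g+N∸g+j = trans (sym (ℕₚ.+-assoc g (N ∸ g) j)) (cong (_+ j) (ℕₚ.m+[n∸m]≡n g≤N))
      N∸g+j+g : N ∸ g + j + g ≡ N + j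
      N∸g+j+g = trans (ℕₚ.+-comm (N ∸ g + j) g) g+N∸g+j
      -- The recurrence in degree N + j, solved for the coefficient of X in degree j: there q^N X
      -- contributes that coefficient, and q^g P the coefficient of P in degree N - g + j.
      X-j : coeff X j ≡ coeff X (N + j) ℤ.+ (coeff P (N ∸ g + j) ℤ.- coeff P (N + j))
      X-j = sym (trans (cong (ℤ._+ (coeff P (N ∸ g + j) ℤ.- coeff P (N + j))) (trans (recurrence (N + j))
        (cong₂ (λ a b → a ℤ.+ (coeff P (N + j) ℤ.- b)) (coeff-q^-*-+ N X j)
          (trans (cong (coeff (q^ g *ᴾ P)) (sym g+N∸g+j)) (coeff-q^-*-+ g P (N ∸ g + j))))))
        (cancel (coeff X j) (coeff P (N + j)) (coeff P (N ∸ g + j))))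
        where
        cancel : ∀ x p r → x ℤ.+ (p ℤ.- r) ℤ.+ (r ℤ.- p) ≡ x
        cancel = ℤ-Solver.solve-∀

  module Unimodal {A : Set} (V : Ladder A) where
    open Ladder V

    P : Poly
    P = gf rank elements

    P-nonneg : ∀ i → 0ℤ ℤ.≤ coeff P i
    P-nonneg i = subst (0ℤ ℤ.≤_) (sym (coeff-gf rank elements i)) (ℤ.+≤+ z≤n)

    count-≤⇒coeff-≤ : ∀ i j → count i ≤ count j → coeff P i ℤ.≤ coeff P j
    count-≤⇒coeff-≤ i j h = subst₂ ℤ._≤_ (sym (coeff-gf rank elements i)) (sym (coeff-gf rank elements j)) (ℤ.+≤+ h)

    P-increasing : ∀ i d → 2 * (i + d) ≤ degree → coeff P i ℤ.≤ coeff P (i + d)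
    P-increasing i zero    h rewrite ℕₚ.+-identityʳ i = ℤₚ.≤-refl
    P-increasing i (suc d) h rewrite ℕₚ.+-suc i d =
      ℤₚ.≤-trans (P-increasing i d (ℕₚ.<⇒≤ 2[i+d]<deg)) (count-≤⇒coeff-≤ _ _ (count-increasing (i + d) 2[i+d]<deg))
      where
      2[i+d]<deg : 2 * (i + d) < degree
      2[i+d]<deg = ℕₚ.<-≤-trans (ℕₚ.*-monoʳ-< 2 (ℕₚ.n<1+n (i + d))) h

    P-decreasing : ∀ i d → degree ≤ 2 * i → coeff P (i + d) ℤ.≤ coeff P i
    P-decreasing i zero    h rewrite ℕₚ.+-identityʳ i = ℤₚ.≤-refl
    P-decreasing i (suc d) h rewrite ℕₚ.+-suc i d =
      ℤₚ.≤-trans (count-≤⇒coeff-≤ _ _ (count-decreasing (i + d)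
                   (ℕₚ.≤-<-trans h (ℕₚ.*-monoʳ-< 2 (s≤s (ℕₚ.m≤m+n i d))))))
                 (P-decreasing i d h)

  nonneg-gauss-quotient : ∀ x y z w {N g X} → 1 ≤ N → g ≤ N →
    X *ᴾ 1-q^ N ≋ 1-q^ g *ᴾ (gauss x y *ᴾ gauss z w) → ∀ i → 0ℤ ℤ.≤ coeff X i
  nonneg-gauss-quotient x y z w {N} {g} {X} 1≤N g≤N eq =
    nonneg-quotient {P = P} {X = X} 1≤N g≤N
      (≋-trans eq (*-congʳ (1-q^ g) (≋-sym (gf-cartesianProduct inversions inversions (words x y) (words z w)))))
      P-nonneg P-increasing P-decreasing
    where open Unimodal (exteriorPower x y ⊗ exteriorPower z w)

-- The quotient for the given parameters

open PolynomialRing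
open Divisibility
open Cyclotomic
open GaussianPolynomials
open Quotients
open import Data.Nat as ℕ using (ℕ; _≤_; _∸_; _+_; _*_)
import Data.Nat.Properties as ℕₚ
open import Data.Nat.Properties using (m≤n⇒m≤n+o)
open import Data.Nat.Divisibility as ∣ℕ using (divides)
open import Data.Nat.GCD using (gcd; gcd[m,n]∣n)
open import Data.Product using (_,_; proj₁; proj₂)
open import Relation.Binary.PropositionalEquality using (refl; sym; trans; cong)
open import Tactic.RingSolver using (solve-∀)
open import Relation.Binary.Reasoning.Setoid ≋-setoid
open _≋_

theorem6p1 : (a b m n : ℕ) → 1 ≤ a → 1 ≤ b → (1≤m : 1 ≤ m) → 1 ≤ n →
    IsNonNegPolynomial
    (mkRatFun (1-q^ (gcd (a * m) (m + n))) (1-q^ (m + n)) (1-q^-nonzero (m≤n⇒m≤n+o n 1≤m))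
    *ᴿ qBinomial (a * m + b * m ∸ 1) (a * m)
    *ᴿ qBinomial (a * n + b * n) (a * n))
theorem6p1 a b m n 1≤a 1≤b 1≤m 1≤n = X ,
  nonneg-gauss-quotient (a * m) (b * m ∸ 1) (a * n) (b * n) {X = X} 1≤m+n
    (∣ℕ.∣⇒≤ {{ℕ.>-nonZero 1≤m+n}} (gcd[m,n]∣n (a * m) (m + n))) X-eq ,
  at (begin
    u *ᴾ num Q *ᴾ num Q′ *ᴾ 1ᴾ
      ≈⟨ *-identityʳ _ ⟩
    u *ᴾ num Q *ᴾ num Q′
      ≈⟨ *-cong (*-congʳ u (qBinomial-gauss (a * m) (b * m ∸ 1) (ℕₚ.+-∸-assoc (a * m) 1≤bm)))
                (qBinomial-gauss (a * n) (b * n) refl) ⟩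
    u *ᴾ (G *ᴾ den Q) *ᴾ (G′ *ᴾ den Q′)
      ≈⟨ regroup u G (den Q) G′ (den Q′) ⟩
    u *ᴾ (G *ᴾ G′) *ᴾ (den Q *ᴾ den Q′)
      ≈⟨ *-congˡ X-eq ⟨
    X *ᴾ 1-q^ (m + n) *ᴾ (den Q *ᴾ den Q′)
      ≈⟨ reassociate X (1-q^ (m + n)) (den Q) (den Q′) ⟩
    X *ᴾ (1-q^ (m + n) *ᴾ den Q *ᴾ den Q′) ∎)
  where
  1≤m+n : 1 ≤ m + n
  1≤m+n = m≤n⇒m≤n+o n 1≤m
  1≤bm : 1 ≤ b * m
  1≤bm = ℕₚ.*-mono-≤ 1≤b 1≤m
  divisibility : 1-q^ (m + n) ∣ᴾ 1-q^ gcd (a * m) (m + n) *ᴾ (gauss (a * m) (b * m ∸ 1) *ᴾ gauss (a * n) (b * n))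
  divisibility = 1-q^-∣-gauss (a * m) (b * m ∸ 1) (a * n) (b * n) (m + n) 1≤m+n
    (divides a (sym (ℕₚ.*-distribˡ-+ a m n)))
    -- Here the - 1 in the first binomial matters: suc ((b m - 1) + b n) is exactly b (m + n).
    (divides b (trans (cong (_+ b * n) (ℕₚ.m+[n∸m]≡n 1≤bm)) (sym (ℕₚ.*-distribˡ-+ b m n))))
  X : Poly
  X = proj₁ divisibility
  X-eq : X *ᴾ 1-q^ (m + n) ≋ 1-q^ gcd (a * m) (m + n) *ᴾ (gauss (a * m) (b * m ∸ 1) *ᴾ gauss (a * n) (b * n))
  X-eq = proj₂ divisibility
  Q Q′ : RatFun
  Q  = qBinomial (a * m + b * m ∸ 1) (a * m)
  Q′ = qBinomial (a * n + b * n) (a * n)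
  u G G′ : Poly
  u  = 1-q^ gcd (a * m) (m + n)
  G  = gauss (a * m) (b * m ∸ 1)
  G′ = gauss (a * n) (b * n)
  regroup : ∀ u a b c d → u *ᴾ (a *ᴾ b) *ᴾ (c *ᴾ d) ≋ u *ᴾ (a *ᴾ c) *ᴾ (b *ᴾ d)
  regroup = solve-∀ polyACR
  reassociate : ∀ x u c d → x *ᴾ u *ᴾ (c *ᴾ d) ≋ x *ᴾ (u *ᴾ c *ᴾ d)
  reassociate = solve-∀ polyACR
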